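{- Let $k$ be a finite field with $q$ elements where $q$ is a square, let $k_0\subset k$ be the subfield with $q^{1/2}$ elements, let $c\in k^*$, and let $\mu$ be the uniform distribution on $ck_0=\{cy: y\in k_0\}$ (regarded as a distribution on $k$). Then $\|\widehat\mu\|_1=q^{1/2}$. Moreover, for all integers $m,\alpha\ge 0$, if $x_0,\ldots,x_{2m+\alpha}$ are chosen independently from $\mu$, then $(x_0,\ldots,x_{2m+\alpha})\in H_m$ with probability $q^{ -(\alpha+1)/2}$. In particular (case $\alpha=0$), the square Hankel matrix $(x_{i+j})_{0\le i,j\le m}$ of order $m+1$ is singular with probability $q^{ -1/2}$.
   Context: For integers $m,n$ with $0\le 2m\le n+1$, $H_m\subseteq k^{n+1}$ is the set of sequences $(x_0,\ldots,x_n)$ with $x_i\in k$ for which there exist $a_0,\ldots,a_m\in k$, not all zero, such that $\sum_{i=0}^m a_ix_{i+j}=0$ for each $j=0,1,\ldots,n-m$ (here $n=2m+\alpha$). A distribution on $k$ is a function $\mu:k\to\mathbf{R}$ with $\mu(x)\ge 0$ for all $x\in k$ and $\sum_{x\in k}\mu(x)=1$. Fix a nontrivial homomorphism $\psi_0$ from the additive group of $k$ to the unit circle in $\mathbf{C}$. The Fourier transform of $\mu$ is $\widehat\mu(a)=\sum_{x\in k}\mu(x)\psi_0(ax)$ for $a\in k$, and $\|\widehat\mu\|_1=\sum_{a\in k}|\widehat\mu(a)|$. -}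

module Defs where

open import Algebra.Bundles using (CommutativeRing; RawMagma; RawMonoid)
import Algebra.Definitions
import Algebra.Definitions.RawMonoid as RawSum
import Algebra.Properties.Monoid.Sum as MonoidSum
open import Algebra.Morphism.Structures using (IsMagmaHomomorphism)
open import Data.Bool.Base using (Bool; true; false; if_then_else_)
open import Data.Fin.Base as Fin using (Fin; zero; suc; toℕ; fromℕ<; finToFun; funToFin)
import Data.Fin.Properties as Fin
open import Data.Integer.Base as ℤ using (+_)
import Data.Integer.Properties as ℤ
open import Data.Nat.Base as ℕ using (ℕ; zero; suc; _≤_; _∸_; s≤s; z≤n)
import Data.Nat.Properties as ℕ
open import Data.Product.Base using (Σ; ∃; _×_; _,_; proj₁; proj₂)
open import Data.Rational.Base as ℚ using (ℚ; 0ℚ; 1ℚ; ½; ∣_∣; _<_)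
import Data.Rational.Properties as ℚ
open import Data.Rational.Solver using (module +-*-Solver)
open import Data.Rational.Unnormalised.Base as ℚᵘ using (mkℚᵘ; *≡*; *≤*)
import Data.Rational.Unnormalised.Properties as ℚᵘ
open import Data.Sum.Base using (inj₁; inj₂)
open import Data.Vec.Functional using (Vector)
import Data.Vec.Functional.Relation.Binary.Equality.Setoid as VecSetoid
open import Function.Base using (_∘_)
open import Function.Bundles using (Inverse)
open import Level using (Level) renaming (suc to lsuc; _⊔_ to _⊔ˡ_)
open import Relation.Binary.Bundles using (Setoid)
import Relation.Binary.Construct.On as On
open import Relation.Binary.PropositionalEquality as ≡ using (_≡_; refl; sym; trans; cong; cong₂; subst; subst₂)
open import Relation.Nullary.Decidable using (Dec; yes; no; does; ¬?; _×-dec_; map′)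
open import Relation.Nullary.Negation using (¬_; contradiction)
open import Relation.Unary using (Pred; Decidable)
import Relation.Binary.Definitions as B

private
  variable
    a b c ℓ ℓ′ p : Level

module Bounding where
  open import Data.Rational.Base using (_+_; _*_; -_; _-_)
  open +-*-Solver

  close : ∀ {x y ε} → x < y + ε → y < x + ε → ∣ x - y ∣ < ε
  close {x} {y} {ε} p q with ℚ.∣p∣≡p∨∣p∣≡-p (x - y)
  ... | inj₁ e = subst₂ _<_ (sym e) (solve 2 (λ y ε → y :+ ε :- y := ε) refl y ε)
                   (ℚ.+-monoˡ-< (- y) p)
  ... | inj₂ e = subst₂ _<_
                   (trans (solve 2 (λ x y → y :- x := :- (x :- y)) refl x y) (sym e))
                   (solve 2 (λ x ε → x :+ ε :- x := ε) refl x ε)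
                   (ℚ.+-monoˡ-< (- x) q)

  p≤∣p∣ : ∀ p → p ℚ.≤ ∣ p ∣
  p≤∣p∣ p with ℚ.∣p∣≡p∨∣p∣≡-p p
  ... | inj₁ e = ℚ.≤-reflexive (sym e)
  ... | inj₂ e = ℚ.≤-trans
    (ℚ.≤-trans (ℚ.≤-reflexive (solve 1 (λ p → p := :- (:- p)) refl p))
      (ℚ.neg-antimono-≤ (subst (0ℚ ℚ.≤_) e (ℚ.0≤∣p∣ p))))
    (ℚ.0≤∣p∣ p)

  upper : ∀ {x y ε} → ∣ x - y ∣ < ε → x < y + ε
  upper {x} {y} {ε} h = subst (_< y + ε) (solve 2 (λ x y → y :+ (x :- y) := x) refl x y)
    (ℚ.+-monoʳ-< y (ℚ.≤-<-trans (p≤∣p∣ (x - y)) h))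

  half+half : ∀ ε → ½ * ε + ½ * ε ≡ ε
  half+half ε = trans (sym (ℚ.*-distribʳ-+ ε ½ ½)) (ℚ.*-identityˡ ε)

  half>0 : ∀ {ε} → 0ℚ < ε → 0ℚ < ½ * ε
  half>0 = ℚ.*-monoʳ-<-pos ½

  *-mono-≤ : ∀ {a b c d} → 0ℚ ℚ.≤ a → 0ℚ ℚ.≤ d → a ℚ.≤ b → c ℚ.≤ d → a * c ℚ.≤ b * d
  *-mono-≤ {a} {b} {c} {d} 0≤a 0≤d a≤b c≤d = ℚ.≤-trans
    (ℚ.*-monoˡ-≤-nonNeg a {{ℚ.nonNegative 0≤a}} c≤d)
    (ℚ.*-monoʳ-≤-nonNeg d {{ℚ.nonNegative 0≤d}} a≤b)

  *-pos : ∀ {a b} → 0ℚ < a → 0ℚ < b → 0ℚ < a * b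
  *-pos {a} {b} 0<a 0<b = subst (_< a * b) (ℚ.*-zeroʳ a)
    (ℚ.*-monoʳ-<-pos a {{ℚ.positive 0<a}} 0<b)

  shrink : ∀ {B ε} → 0ℚ < B → 0ℚ < ε → ∃ λ δ → 0ℚ < δ × B * δ ≡ ε
  shrink {B} {ε} 0<B 0<ε =
    (ℚ.1/ B) * ε
    , *-pos (ℚ.positive⁻¹ (ℚ.1/ B) {{ℚ.1/pos⇒pos B}}) 0<ε
    , trans (sym (ℚ.*-assoc B (ℚ.1/ B) ε))
        (trans (cong (_* ε) (ℚ.*-inverseʳ B)) (ℚ.*-identityˡ ε))
    where instance
      B-pos : ℚ.Positive B
      B-pos = ℚ.positive 0<B
      B-nonZero : ℚ.NonZero B
      B-nonZero = ℚ.pos⇒nonZero B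

  +-close : ∀ {a b c d δ} → ∣ a - c ∣ < δ → ∣ b - d ∣ < δ → ∣ a + b - (c + d) ∣ < δ + δ
  +-close {a} {b} {c} {d} {δ} ac bd = begin-strict
    ∣ a + b - (c + d) ∣
      ≡⟨ cong ∣_∣ (solve 4 (λ a b c d → (a :+ b) :- (c :+ d) := (a :- c) :+ (b :- d)) refl a b c d) ⟩
    ∣ (a - c) + (b - d) ∣     ≤⟨ ℚ.∣p+q∣≤∣p∣+∣q∣ (a - c) (b - d) ⟩
    ∣ a - c ∣ + ∣ b - d ∣     <⟨ ℚ.+-mono-< ac bd ⟩
    δ + δ ∎
    where open ℚ.≤-Reasoning

  neg-close : ∀ {a b δ} → ∣ a - b ∣ < δ → ∣ - a - - b ∣ < δ
  neg-close {a} {b} {δ} = subst (_< δ) (trans (sym (ℚ.∣-p∣≡∣p∣ (a - b)))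
    (cong ∣_∣ (solve 2 (λ a b → :- (a :- b) := :- a :- :- b) refl a b)))

  *-close : ∀ {a b c d A B δ} → 0ℚ < A → 0ℚ < B → ∣ a ∣ ℚ.≤ A → ∣ d ∣ ℚ.≤ B →
            ∣ b - d ∣ < δ → ∣ a - c ∣ < δ → ∣ a * b - c * d ∣ < (A + B) * δ
  *-close {a} {b} {c} {d} {A} {B} {δ} 0<A 0<B a≤A d≤B bd ac = begin-strict
      ∣ a * b - c * d ∣
        ≡⟨ cong ∣_∣ (solve 4 (λ a b c d → a :* b :- c :* d := a :* (b :- d) :+ (a :- c) :* d)
                      refl a b c d) ⟩
      ∣ a * (b - d) + (a - c) * d ∣
        ≤⟨ ℚ.∣p+q∣≤∣p∣+∣q∣ (a * (b - d)) ((a - c) * d) ⟩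
      ∣ a * (b - d) ∣ + ∣ (a - c) * d ∣
        ≡⟨ cong₂ _+_ (ℚ.∣p*q∣≡∣p∣*∣q∣ a (b - d)) (ℚ.∣p*q∣≡∣p∣*∣q∣ (a - c) d) ⟩
      ∣ a ∣ * ∣ b - d ∣ + ∣ a - c ∣ * ∣ d ∣
        ≤⟨ ℚ.+-mono-≤
             (ℚ.*-monoʳ-≤-nonNeg ∣ b - d ∣ {{ℚ.∣-∣-nonNeg (b - d)}} a≤A)
             (ℚ.*-monoˡ-≤-nonNeg ∣ a - c ∣ {{ℚ.∣-∣-nonNeg (a - c)}} d≤B) ⟩
      A * ∣ b - d ∣ + ∣ a - c ∣ * B
        <⟨ ℚ.+-mono-< (ℚ.*-monoʳ-<-pos A {{ℚ.positive 0<A}} bd)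
                      (ℚ.*-monoˡ-<-pos B {{ℚ.positive 0<B}} ac) ⟩
      A * δ + δ * B
        ≡⟨ solve 3 (λ A B δ → A :* δ :+ δ :* B := (A :+ B) :* δ) refl A B δ ⟩
      (A + B) * δ ∎
      where open ℚ.≤-Reasoning

open Bounding

CloseFrom : (ℕ → ℚ) → ℚ → Set
CloseFrom x ε = ∃ λ N → ∀ m n → N ≤ m → N ≤ n → ∣ x m ℚ.- x n ∣ < ε

IsCauchy : (ℕ → ℚ) → Set
IsCauchy x = ∀ ε → 0ℚ < ε → CloseFrom x ε

-- The real numbers, as Cauchy sequences of rationals up to the equivalence
-- `_≃_` below.
record ℝ : Set where
  constructor mkℝ
  field
    seq    : ℕ → ℚ
    cauchy : IsCauchy seq

open ℝ public

infix 4 _≃_ _≤ℝ_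

record _≃_ (x y : ℝ) : Set where
  constructor mk≃
  field
    eventually : ∀ ε → 0ℚ < ε → ∃ λ N → ∀ n → N ≤ n → ∣ seq x n ℚ.- seq y n ∣ < ε

record _≤ℝ_ (x y : ℝ) : Set where
  constructor mk≤
  field
    eventually : ∀ ε → 0ℚ < ε → ∃ λ N → ∀ n → N ≤ n → seq x n < seq y n ℚ.+ ε

fromℚ : ℚ → ℝ
fromℚ p = mkℝ (λ _ → p) (λ ε 0<ε → 0 , λ _ _ _ _ →
  subst (λ z → ∣ z ∣ < ε) (sym (ℚ.+-inverseʳ p)) 0<ε)

fromℕ : ℕ → ℝ
fromℕ n = fromℚ (+ n ℚ./ 1)

0ℝ 1ℝ : ℝ
0ℝ = fromℚ 0ℚ
1ℝ = fromℚ 1ℚ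

infixl 6 _+ℝ_ _-ℝ_
infixl 7 _*ℝ_
infix  8 -ℝ_

-- The Cauchy proofs are opaque because unfolding them makes type checking very
-- slow; nothing depends on the moduli they compute.
opaque
  +-cauchy : ∀ x y → IsCauchy (λ n → seq x n ℚ.+ seq y n)
  +-cauchy x y ε 0<ε = M ℕ.⊔ N , λ m n m≥ n≥ →
    subst (∣ seq x m ℚ.+ seq y m ℚ.- (seq x n ℚ.+ seq y n) ∣ <_) (half+half ε)
      (+-close {seq x m} {seq y m} {seq x n} {seq y n} {½ ℚ.* ε}
        (proj₂ cx m n (ℕ.m⊔n≤o⇒m≤o M N m≥) (ℕ.m⊔n≤o⇒m≤o M N n≥))
        (proj₂ cy m n (ℕ.m⊔n≤o⇒n≤o M N m≥) (ℕ.m⊔n≤o⇒n≤o M N n≥)))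
    where
    cx : CloseFrom (seq x) (½ ℚ.* ε)
    cx = cauchy x (½ ℚ.* ε) (half>0 0<ε)
    cy : CloseFrom (seq y) (½ ℚ.* ε)
    cy = cauchy y (½ ℚ.* ε) (half>0 0<ε)
    M N : ℕ
    M = proj₁ cx
    N = proj₁ cy

_+ℝ_ : ℝ → ℝ → ℝ
x +ℝ y = mkℝ (λ n → seq x n ℚ.+ seq y n) (+-cauchy x y)

opaque
  -‿cauchy : ∀ x → IsCauchy (λ n → ℚ.- seq x n)
  -‿cauchy x ε 0<ε = proj₁ cx , λ m n m≥ n≥ →
    neg-close {seq x m} {seq x n} {ε} (proj₂ cx m n m≥ n≥)
    where
    cx : CloseFrom (seq x) ε
    cx = cauchy x ε 0<ε

-ℝ_ : ℝ → ℝ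
-ℝ x = mkℝ (λ n → ℚ.- seq x n) (-‿cauchy x)

_-ℝ_ : ℝ → ℝ → ℝ
x -ℝ y = x +ℝ (-ℝ y)

EventuallyBounded : ℝ → Set
EventuallyBounded x = ∃ λ B → 0ℚ < B × ∃ λ N → ∀ n → N ≤ n → ∣ seq x n ∣ ℚ.≤ B

eventuallyBounded : ∀ x → EventuallyBounded x
eventuallyBounded x with cauchy x 1ℚ (ℚ.positive⁻¹ 1ℚ)
... | N , f = ∣ seq x N ∣ + 1ℚ
            , ℚ.+-mono-≤-< (ℚ.0≤∣p∣ (seq x N)) (ℚ.positive⁻¹ 1ℚ)
            , N , λ n N≤n → begin
  ∣ seq x n ∣
    ≡⟨ cong ∣_∣ (solve 2 (λ a b → a := b :+ (a :- b)) refl (seq x n) (seq x N)) ⟩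
  ∣ seq x N + (seq x n - seq x N) ∣
    ≤⟨ ℚ.∣p+q∣≤∣p∣+∣q∣ (seq x N) (seq x n - seq x N) ⟩
  ∣ seq x N ∣ + ∣ seq x n - seq x N ∣
    ≤⟨ ℚ.+-monoʳ-≤ ∣ seq x N ∣ (ℚ.<⇒≤ (f n N N≤n ℕ.≤-refl)) ⟩
  ∣ seq x N ∣ + 1ℚ ∎
  where
  open import Data.Rational.Base using (_+_; _-_)
  open +-*-Solver
  open ℚ.≤-Reasoning

opaque
  *-cauchy : ∀ x y → IsCauchy (λ n → seq x n ℚ.* seq y n)
  *-cauchy x y ε 0<ε = N , λ m n m≥ n≥ →
    subst (∣ seq x m ℚ.* seq y m ℚ.- seq x n ℚ.* seq y n ∣ <_) (proj₂ (proj₂ δ))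
      (*-close {seq x m} {seq y m} {seq x n} {seq y n} {A} {B} {proj₁ δ} 0<A 0<B
        (proj₂ (proj₂ (proj₂ bx)) m (KLM≤ m≥ .proj₁))
        (proj₂ (proj₂ (proj₂ by)) n (KLM≤ n≥ .proj₂ .proj₁))
        (proj₂ cy m n (KLM≤ m≥ .proj₂ .proj₂ .proj₂) (KLM≤ n≥ .proj₂ .proj₂ .proj₂))
        (proj₂ cx m n (KLM≤ m≥ .proj₂ .proj₂ .proj₁) (KLM≤ n≥ .proj₂ .proj₂ .proj₁)))
    where
    bx : EventuallyBounded x
    bx = eventuallyBounded x
    by : EventuallyBounded y
    by = eventuallyBounded y
    A B : ℚ
    A = proj₁ bx
    B = proj₁ by
    0<A : 0ℚ < A
    0<A = proj₁ (proj₂ bx)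
    0<B : 0ℚ < B
    0<B = proj₁ (proj₂ by)
    0<A+B : 0ℚ < A ℚ.+ B
    0<A+B = ℚ.+-mono-< {0ℚ} {A} {0ℚ} {B} 0<A 0<B
    δ : ∃ λ δ → 0ℚ < δ × (A ℚ.+ B) ℚ.* δ ≡ ε
    δ = shrink 0<A+B 0<ε
    cx : CloseFrom (seq x) (proj₁ δ)
    cx = cauchy x (proj₁ δ) (proj₁ (proj₂ δ))
    cy : CloseFrom (seq y) (proj₁ δ)
    cy = cauchy y (proj₁ δ) (proj₁ (proj₂ δ))
    K L N : ℕ
    K = proj₁ (proj₂ (proj₂ bx))
    L = proj₁ (proj₂ (proj₂ by))
    N = (K ℕ.⊔ L) ℕ.⊔ (proj₁ cx ℕ.⊔ proj₁ cy)
    KLM≤ : ∀ {i} → N ≤ i → K ≤ i × L ≤ i × proj₁ cx ≤ i × proj₁ cy ≤ i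
    KLM≤ N≤i =
      let KL≤ = ℕ.m⊔n≤o⇒m≤o (K ℕ.⊔ L) (proj₁ cx ℕ.⊔ proj₁ cy) N≤i
          c≤  = ℕ.m⊔n≤o⇒n≤o (K ℕ.⊔ L) (proj₁ cx ℕ.⊔ proj₁ cy) N≤i
      in ℕ.m⊔n≤o⇒m≤o K L KL≤ , ℕ.m⊔n≤o⇒n≤o K L KL≤
       , ℕ.m⊔n≤o⇒m≤o (proj₁ cx) (proj₁ cy) c≤ , ℕ.m⊔n≤o⇒n≤o (proj₁ cx) (proj₁ cy) c≤

_*ℝ_ : ℝ → ℝ → ℝ
x *ℝ y = mkℝ (λ n → seq x n ℚ.* seq y n) (*-cauchy x y)

½^_ : ℕ → ℚ
½^ zero  = 1ℚ
½^ suc n = ½ ℚ.* ½^ n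

-- Bisection for √(max r 0): both bounds start from 0 ≤ √r < 1 + r.
√-bounds : ℚ → ℕ → ℚ × ℚ
√-bounds r zero    = 0ℚ , 1ℚ ℚ.+ (r ℚ.⊔ 0ℚ)
√-bounds r (suc n) = bisect (√-bounds r n)
  where
  bisect : ℚ × ℚ → ℚ × ℚ
  bisect (lo , hi) =
    let mid = ½ ℚ.* (lo ℚ.+ hi)
    in if does (mid ℚ.* mid ℚ.≤? r ℚ.⊔ 0ℚ) then (mid , hi) else (lo , mid)

p≤∣↥p∣ : ∀ p → p ℚ.≤ + ℤ.∣ ℚ.↥ p ∣ ℚ./ 1
p≤∣↥p∣ p@(ℚ.mkℚ n d c) = ℚ.toℚᵘ-cancel-≤ (ℚᵘ.≤-trans
  (*≤* (begin
    n ℤ.* + 1             ≡⟨ ℤ.*-identityʳ n ⟩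
    n                     ≤⟨ i≤+∣i∣ n ⟩
    + ℤ.∣ n ∣             ≤⟨ ℤ.+≤+ (ℕ.m≤m*n ℤ.∣ n ∣ (suc d)) ⟩
    + (ℤ.∣ n ∣ ℕ.* suc d) ≡⟨ ℤ.pos-* ℤ.∣ n ∣ (suc d) ⟩
    + ℤ.∣ n ∣ ℤ.* + suc d ∎))
  (ℚᵘ.≤-reflexive (ℚᵘ.≃-sym (ℚ.toℚᵘ-fromℚᵘ (mkℚᵘ (+ ℤ.∣ n ∣) 0)))))
  where
  open ℤ.≤-Reasoning
  i≤+∣i∣ : ∀ i → i ℤ.≤ + ℤ.∣ i ∣
  i≤+∣i∣ (+ n)      = ℤ.≤-refl
  i≤+∣i∣ ℤ.-[1+ n ] = ℤ.-≤+

suc-/1 : ∀ n → + suc n ℚ./ 1 ≡ 1ℚ ℚ.+ (+ n ℚ./ 1)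
suc-/1 n = ℚ.toℚᵘ-injective (ℚᵘ.≃-trans (ℚ.toℚᵘ-fromℚᵘ (mkℚᵘ (+ suc n) 0))
  (ℚᵘ.≃-sym (ℚᵘ.≃-trans (ℚ.toℚᵘ-homo-+ 1ℚ (+ n ℚ./ 1))
    (ℚᵘ.≃-trans (ℚᵘ.+-congʳ ℚᵘ.1ℚᵘ (ℚ.toℚᵘ-fromℚᵘ (mkℚᵘ (+ n) 0)))
      (*≡* (cong (λ z → (+ 1 ℤ.+ z) ℤ.* + 1) (ℤ.*-identityʳ (+ n))))))))

module Sqrt where
  open import Data.Rational.Base using (_+_; _*_; -_; _-_; _⊔_)
  open +-*-Solver
  open ℚ.≤-Reasoning

  record Bounds (r : ℚ) (n : ℕ) (b : ℚ × ℚ) : Set where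
    field
      lo≥0  : 0ℚ ℚ.≤ proj₁ b
      lo²≤r : proj₁ b * proj₁ b ℚ.≤ r ⊔ 0ℚ
      r<hi² : r ⊔ 0ℚ < proj₂ b * proj₂ b
      width : proj₂ b ≡ proj₁ b + ½^ n * (1ℚ + (r ⊔ 0ℚ))

  open Bounds

  ½^≥0 : ∀ n → 0ℚ ℚ.≤ ½^ n
  ½^≥0 zero    = ℚ.nonNegative⁻¹ 1ℚ
  ½^≥0 (suc n) = ℚ.*-monoˡ-≤-nonNeg ½ (½^≥0 n)

  ½^≤1 : ∀ n → ½^ n ℚ.≤ 1ℚ
  ½^≤1 zero    = ℚ.≤-refl
  ½^≤1 (suc n) = *-mono-≤ {½} {1ℚ} {½^ n} {1ℚ} (ℚ.nonNegative⁻¹ ½) (ℚ.nonNegative⁻¹ 1ℚ)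
    (ℚ.≤ᵇ⇒≤ _) (½^≤1 n)

  bounds : ∀ r n → Bounds r n (√-bounds r n)
  bounds r zero = record
    { lo≥0  = ℚ.≤-refl
    ; lo²≤r = s≥0
    ; r<hi² = begin-strict
        s                  ≡⟨ ℚ.+-identityˡ s ⟨
        0ℚ + s             <⟨ ℚ.+-monoˡ-< s (ℚ.positive⁻¹ 1ℚ) ⟩
        1ℚ + s             ≡⟨ ℚ.*-identityʳ (1ℚ + s) ⟨
        (1ℚ + s) * 1ℚ      ≤⟨ ℚ.*-monoˡ-≤-nonNeg (1ℚ + s) {{ℚ.nonNegative (ℚ.+-mono-≤ (ℚ.nonNegative⁻¹ 1ℚ) s≥0)}}
                                 (ℚ.+-monoʳ-≤ 1ℚ s≥0) ⟩
        (1ℚ + s) * (1ℚ + s) ∎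
    ; width = trans (sym (ℚ.*-identityˡ (1ℚ + s))) (sym (ℚ.+-identityˡ _))
    }
    where
    s = r ⊔ 0ℚ
    s≥0 : 0ℚ ℚ.≤ s
    s≥0 = ℚ.p≤q⊔p r 0ℚ
  bounds r (suc n) = choose (mid * mid ℚ.≤? r ⊔ 0ℚ)
    where
    B = bounds r n
    lo = proj₁ (√-bounds r n)
    hi = proj₂ (√-bounds r n)
    mid = ½ * (lo + hi)
    w = 1ℚ + (r ⊔ 0ℚ)
    w≥0 : 0ℚ ℚ.≤ w
    w≥0 = ℚ.+-mono-≤ (ℚ.nonNegative⁻¹ 1ℚ) (ℚ.p≤q⊔p r 0ℚ)
    hi≥0 : 0ℚ ℚ.≤ hi
    hi≥0 = subst (0ℚ ℚ.≤_) (sym (width B)) (ℚ.+-mono-≤ (lo≥0 B)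
      (subst (ℚ._≤ ½^ n * w) (ℚ.*-zeroʳ (½^ n)) (ℚ.*-monoˡ-≤-nonNeg (½^ n) {{ℚ.nonNegative (½^≥0 n)}} w≥0)))
    choose : (d : Dec (mid * mid ℚ.≤ r ⊔ 0ℚ)) →
             Bounds r (suc n) (if does d then (mid , hi) else (lo , mid))
    choose (yes m²≤r) = record
      { lo≥0  = ℚ.*-monoˡ-≤-nonNeg ½ (ℚ.+-mono-≤ (lo≥0 B) hi≥0)
      ; lo²≤r = m²≤r
      ; r<hi² = r<hi² B
      ; width = begin-equality
          hi ≡⟨ solve 2 (λ l h → h := con ½ :* (l :+ h) :+ con ½ :* (h :- l)) refl lo hi ⟩
          mid + ½ * (hi - lo)
             ≡⟨ cong (λ z → mid + ½ * (z - lo)) (width B) ⟩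
          mid + ½ * ((lo + ½^ n * w) - lo)
             ≡⟨ cong (λ z → mid + z) (solve 3 (λ l p w → con ½ :* ((l :+ p :* w) :- l) := (con ½ :* p) :* w) refl lo (½^ n) w) ⟩
          mid + ½^ (suc n) * w ∎
      }
    choose (no m²≰r) = record
      { lo≥0  = lo≥0 B
      ; lo²≤r = lo²≤r B
      ; r<hi² = ℚ.≰⇒> m²≰r
      ; width = begin-equality
          mid ≡⟨ cong (λ z → ½ * (lo + z)) (width B) ⟩
          ½ * (lo + (lo + ½^ n * w))
            ≡⟨ solve 3 (λ l p w → con ½ :* (l :+ (l :+ p :* w)) := l :+ (con ½ :* p) :* w) refl lo (½^ n) w ⟩
          lo + ½^ (suc n) * w ∎
      }

  k½^k≤1 : ∀ n → (+ n ℚ./ 1) * ½^ n ℚ.≤ 1ℚ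
  k½^k≤1 zero    = ℚ.≤ᵇ⇒≤ _
  k½^k≤1 (suc n) = begin
    (+ suc n ℚ./ 1) * (½ * ½^ n) ≡⟨ cong (_* (½ * ½^ n)) (suc-/1 n) ⟩
    (1ℚ + (+ n ℚ./ 1)) * (½ * ½^ n)
      ≡⟨ solve 2 (λ x p → (con 1ℚ :+ x) :* (con ½ :* p) := con ½ :* (p :+ x :* p)) refl (+ n ℚ./ 1) (½^ n) ⟩
    ½ * (½^ n + (+ n ℚ./ 1) * ½^ n) ≤⟨ ℚ.*-monoˡ-≤-nonNeg ½ (ℚ.+-mono-≤ (½^≤1 n) (k½^k≤1 n)) ⟩
    1ℚ ∎

  ½^-antitone : ∀ {m n} → m ≤ n → ½^ n ℚ.≤ ½^ m
  ½^-antitone {n = n} z≤n = ½^≤1 n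
  ½^-antitone (s≤s m≤n)   = ℚ.*-monoˡ-≤-nonNeg ½ (½^-antitone m≤n)

  widths→0 : ∀ C ε → 0ℚ < C → 0ℚ < ε → ∃ λ N → ∀ n → N ≤ n → ½^ n * C ℚ.≤ ε
  widths→0 C ε 0<C 0<ε with shrink 0<ε 0<C
  ... | δ , 0<δ , εδ≡C = K , λ n K≤n → begin
    ½^ n * C           ≤⟨ ℚ.*-monoʳ-≤-nonNeg C {{ℚ.nonNegative (ℚ.<⇒≤ 0<C)}} (½^-antitone K≤n) ⟩
    ½^ K * C           ≡⟨ cong (½^ K *_) εδ≡C ⟨
    ½^ K * (ε * δ)     ≡⟨ solve 3 (λ p e d → p :* (e :* d) := (p :* e) :* d) refl (½^ K) ε δ ⟩
    (½^ K * ε) * δ     ≤⟨ ℚ.*-monoˡ-≤-nonNeg (½^ K * ε) {{ℚ.nonNegative ½^Kε≥0}} (p≤∣↥p∣ δ) ⟩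
    (½^ K * ε) * (+ K ℚ./ 1) ≡⟨ solve 3 (λ p e k → (p :* e) :* k := (k :* p) :* e) refl (½^ K) ε (+ K ℚ./ 1) ⟩
    ((+ K ℚ./ 1) * ½^ K) * ε ≤⟨ ℚ.*-monoʳ-≤-nonNeg ε {{ℚ.nonNegative (ℚ.<⇒≤ 0<ε)}} (k½^k≤1 K) ⟩
    1ℚ * ε             ≡⟨ ℚ.*-identityˡ ε ⟩
    ε ∎
    where
    K = ℤ.∣ ℚ.↥ δ ∣
    ½^Kε≥0 : 0ℚ ℚ.≤ ½^ K * ε
    ½^Kε≥0 = subst (ℚ._≤ ½^ K * ε) (ℚ.*-zeroʳ (½^ K))
      (ℚ.*-monoˡ-≤-nonNeg (½^ K) {{ℚ.nonNegative (½^≥0 K)}} (ℚ.<⇒≤ 0<ε))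

  ⊔0-shift : ∀ {a b δ} → 0ℚ < δ → a < b + δ → a ⊔ 0ℚ < (b ⊔ 0ℚ) + δ
  ⊔0-shift {a} {b} {δ} 0<δ a<b+δ with ℚ.≤-total a 0ℚ
  ... | inj₁ a≤0 = subst (_< (b ⊔ 0ℚ) + δ) (sym (ℚ.p≤q⇒p⊔q≡q a≤0))
    (ℚ.+-mono-≤-< (ℚ.p≤q⊔p b 0ℚ) 0<δ)
  ... | inj₂ a≥0 = subst (_< (b ⊔ 0ℚ) + δ) (sym (ℚ.p≥q⇒p⊔q≡p a≥0))
    (ℚ.<-≤-trans a<b+δ (ℚ.+-monoˡ-≤ δ (ℚ.p≤p⊔q b 0ℚ)))

  lo : ℚ → ℕ → ℚ
  lo r n = proj₁ (√-bounds r n)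

  -- If lo a m ≥ lo b n + 2η while lo b n is within η of its upper bound,
  -- then a and b differ by at least η².
  lo-close : ∀ a b m n η → 0ℚ < η → a < b + η * η →
             ½^ n * (1ℚ + (b ⊔ 0ℚ)) ℚ.≤ η → lo a m < lo b n + (η + η)
  lo-close a b m n η 0<η a<b+η² w≤η with lo b n + (η + η) ℚ.≤? lo a m
  ... | no ≰  = ℚ.≰⇒> ≰
  ... | yes l+2η≤ = contradiction (ℚ.<-trans too-small too-large) (ℚ.<-irrefl refl)
    where
    A = bounds a m
    B = bounds b n
    l = lo b n
    h = proj₂ (√-bounds b n)
    η≥0 = ℚ.<⇒≤ 0<η
    l+2η≥0 : 0ℚ ℚ.≤ l + (η + η)
    l+2η≥0 = ℚ.+-mono-≤ (lo≥0 B) (ℚ.+-mono-≤ η≥0 η≥0)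
    l+η≥0 : 0ℚ ℚ.≤ l + η
    l+η≥0 = ℚ.+-mono-≤ (lo≥0 B) η≥0
    h≤l+η : h ℚ.≤ l + η
    h≤l+η = subst (ℚ._≤ l + η) (sym (width B)) (ℚ.+-monoʳ-≤ l w≤η)
    W≥0 : 0ℚ ℚ.≤ ½^ n * (1ℚ + (b ⊔ 0ℚ))
    W≥0 = subst (ℚ._≤ ½^ n * (1ℚ + (b ⊔ 0ℚ))) (ℚ.*-zeroʳ (½^ n))
      (ℚ.*-monoˡ-≤-nonNeg (½^ n) {{ℚ.nonNegative (½^≥0 n)}}
        (ℚ.+-mono-≤ (ℚ.nonNegative⁻¹ 1ℚ) (ℚ.p≤q⊔p b 0ℚ)))
    h≥0 : 0ℚ ℚ.≤ h
    h≥0 = subst (0ℚ ℚ.≤_) (sym (width B)) (ℚ.+-mono-≤ (lo≥0 B) W≥0)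
    too-small : (l + (η + η)) * (l + (η + η)) < (l + η) * (l + η) + η * η
    too-small = begin-strict
      (l + (η + η)) * (l + (η + η)) ≤⟨ *-mono-≤ l+2η≥0 (lo≥0 A) l+2η≤ l+2η≤ ⟩
      lo a m * lo a m               ≤⟨ lo²≤r A ⟩
      a ⊔ 0ℚ                        <⟨ ⊔0-shift {a} {b} (*-pos 0<η 0<η) a<b+η² ⟩
      (b ⊔ 0ℚ) + η * η              <⟨ ℚ.+-monoˡ-< (η * η) (r<hi² B) ⟩
      h * h + η * η                 ≤⟨ ℚ.+-monoˡ-≤ (η * η) (*-mono-≤ h≥0 l+η≥0 h≤l+η h≤l+η) ⟩
      (l + η) * (l + η) + η * η ∎
    too-large : (l + η) * (l + η) + η * η < (l + (η + η)) * (l + (η + η))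
    too-large = begin-strict
      (l + η) * (l + η) + η * η     ≡⟨ ℚ.+-identityʳ _ ⟨
      (l + η) * (l + η) + η * η + 0ℚ
        <⟨ ℚ.+-monoʳ-< ((l + η) * (l + η) + η * η)
             (ℚ.+-mono-≤-< (ℚ.+-mono-≤ lη≥0 lη≥0) (ℚ.+-mono-< (*-pos 0<η 0<η) (*-pos 0<η 0<η))) ⟩
      (l + η) * (l + η) + η * η + ((l * η + l * η) + (η * η + η * η))
        ≡⟨ solve 2 (λ l e → (l :+ e) :* (l :+ e) :+ e :* e :+ ((l :* e :+ l :* e) :+ (e :* e :+ e :* e))
                     := (l :+ (e :+ e)) :* (l :+ (e :+ e))) refl l η ⟩
      (l + (η + η)) * (l + (η + η)) ∎
      where
      lη≥0 : 0ℚ ℚ.≤ l * η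
      lη≥0 = subst (ℚ._≤ l * η) (ℚ.*-zeroʳ l) (ℚ.*-monoˡ-≤-nonNeg l {{ℚ.nonNegative (lo≥0 B)}} η≥0)

opaque
  √-cauchy : ∀ x → IsCauchy (λ n → proj₁ (√-bounds (seq x n) n))
  √-cauchy x ε 0<ε = N , λ m n m≥ n≥ → close (half m n m≥ n≥) (half n m n≥ m≥)
    where
    open Sqrt
    η : ℚ
    η = ½ ℚ.* ε
    0<η : 0ℚ < η
    0<η = half>0 0<ε
    bx : EventuallyBounded x
    bx = eventuallyBounded x
    B : ℚ
    B = proj₁ bx
    0<B : 0ℚ < B
    0<B = proj₁ (proj₂ bx)
    K : ℕ
    K = proj₁ (proj₂ (proj₂ bx))
    wd : ∃ λ L → ∀ n → L ≤ n → ½^ n ℚ.* (1ℚ ℚ.+ B) ℚ.≤ η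
    wd = widths→0 (1ℚ ℚ.+ B) η (ℚ.+-mono-< {0ℚ} {1ℚ} {0ℚ} {B} (ℚ.positive⁻¹ 1ℚ) 0<B) 0<η
    L : ℕ
    L = proj₁ wd
    cx : CloseFrom (seq x) (η ℚ.* η)
    cx = cauchy x (η ℚ.* η) (*-pos 0<η 0<η)
    M : ℕ
    M = proj₁ cx
    N : ℕ
    N = K ℕ.⊔ (L ℕ.⊔ M)
    K≤ : ∀ {i} → N ≤ i → K ≤ i
    K≤ = ℕ.m⊔n≤o⇒m≤o K (L ℕ.⊔ M)
    L≤ : ∀ {i} → N ≤ i → L ≤ i
    L≤ h = ℕ.m⊔n≤o⇒m≤o L M (ℕ.m⊔n≤o⇒n≤o K (L ℕ.⊔ M) h)
    M≤ : ∀ {i} → N ≤ i → M ≤ i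
    M≤ h = ℕ.m⊔n≤o⇒n≤o L M (ℕ.m⊔n≤o⇒n≤o K (L ℕ.⊔ M) h)
    half : ∀ m n → N ≤ m → N ≤ n → lo (seq x m) m < lo (seq x n) n ℚ.+ ε
    half m n m≥ n≥ = subst (λ z → lo (seq x m) m < lo (seq x n) n ℚ.+ z) (half+half ε)
      (lo-close (seq x m) (seq x n) m n η 0<η
        (upper {seq x m} {seq x n} (proj₂ cx m n (M≤ m≥) (M≤ n≥)))
        (ℚ.≤-trans
          (ℚ.*-monoˡ-≤-nonNeg (½^ n) {{ℚ.nonNegative (½^≥0 n)}} (ℚ.+-monoʳ-≤ 1ℚ
            (ℚ.⊔-lub (ℚ.≤-trans (p≤∣p∣ (seq x n)) (proj₂ (proj₂ (proj₂ bx)) n (K≤ n≥)))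
                     (ℚ.<⇒≤ 0<B))))
          (proj₂ wd n (L≤ n≥))))

-- √ x is the square root of max x 0; the n-th term takes n bisection steps
-- at the n-th rational approximation of x.
√ : ℝ → ℝ
√ x = mkℝ (λ n → proj₁ (√-bounds (seq x n) n)) (√-cauchy x)

≃-refl : ∀ {x} → x ≃ x
≃-refl {x} = mk≃ λ ε 0<ε → 0 , λ n _ → subst (λ z → ∣ z ∣ < ε) (sym (ℚ.+-inverseʳ (seq x n))) 0<ε

+ℝ-0-rawMonoid : RawMonoid _ _
+ℝ-0-rawMonoid = record { _≈_ = _≃_ ; _∙_ = _+ℝ_ ; ε = 0ℝ }

*ℝ-1-rawMonoid : RawMonoid _ _
*ℝ-1-rawMonoid = record { _≈_ = _≃_ ; _∙_ = _*ℝ_ ; ε = 1ℝ }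

sumℝ productℝ : ∀ {n} → Vector ℝ n → ℝ
sumℝ     = RawSum.sum +ℝ-0-rawMonoid
productℝ = RawSum.sum *ℝ-1-rawMonoid

sumℕ : ∀ {n} → Vector ℕ n → ℕ
sumℕ = RawSum.sum ℕ.+-0-rawMonoid

1/ℕ : ℕ → ℚ
1/ℕ zero    = 0ℚ
1/ℕ (suc n) = + 1 ℚ./ suc n

-- The reciprocal of a natural number; only used at nonzero arguments
-- (recip 0 = 0 is a convention).
recip : ℕ → ℝ
recip n = fromℚ (1/ℕ n)

record ℂ : Set where
  constructor _+i_
  field
    re im : ℝ

open ℂ public

infix 4 _≃ᶜ_

_≃ᶜ_ : ℂ → ℂ → Set
z ≃ᶜ w = re z ≃ re w × im z ≃ im w

0ᶜ 1ᶜ : ℂ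
0ᶜ = 0ℝ +i 0ℝ
1ᶜ = 1ℝ +i 0ℝ

infixl 6 _+ᶜ_
infixl 7 _*ᶜ_ _•_

_+ᶜ_ _*ᶜ_ : ℂ → ℂ → ℂ
z +ᶜ w = (re z +ℝ re w) +i (im z +ℝ im w)
z *ᶜ w = (re z *ℝ re w -ℝ im z *ℝ im w) +i (re z *ℝ im w +ℝ im z *ℝ re w)

_•_ : ℝ → ℂ → ℂ
x • z = (x *ℝ re z) +i (x *ℝ im z)

modulus : ℂ → ℝ
modulus z = √ (re z *ℝ re z +ℝ im z *ℝ im z)

+ᶜ-0-rawMonoid : RawMonoid _ _
+ᶜ-0-rawMonoid = record { _≈_ = _≃ᶜ_ ; _∙_ = _+ᶜ_ ; ε = 0ᶜ }

*ᶜ-rawMagma : RawMagma _ _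
*ᶜ-rawMagma = record { _≈_ = _≃ᶜ_ ; _∙_ = _*ᶜ_ }

sumᶜ : ∀ {n} → Vector ℂ n → ℂ
sumᶜ = RawSum.sum +ᶜ-0-rawMonoid

-- A bijective enumeration of S, up to its equality; finite sums over S run along
-- such an enumeration.
HasCardinality : Setoid a ℓ → ℕ → Set _
HasCardinality S n = Inverse (≡.setoid (Fin n)) S

module _ {S : Setoid a ℓ} {n : ℕ} (enum : HasCardinality S n) where
  open Setoid S renaming (refl to ≈-refl; sym to ≈-sym; trans to ≈-trans)
  open Inverse enum

  infix 4 _≈?_
  _≈?_ : B.Decidable _≈_
  x ≈? y = map′ (λ e → ≈-trans (≈-sym (inverseˡ refl)) (≈-trans (to-cong e) (inverseˡ refl)))
                from-cong (from x Fin.≟ from y)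

  any? : {P : Pred Carrier p} → P B.Respects _≈_ → Decidable P → Dec (∃ P)
  any? resp P? = map′ (λ (i , q) → to i , q)
                      (λ (x , q) → from x , resp (≈-sym (inverseˡ refl)) q)
                      (Fin.any? (P? ∘ to))

  -- The number of x with P x.
  sizeOf : {P : Pred Carrier p} → Decidable P → ℕ
  sizeOf P? = sumℕ (λ i → if does (P? (to i)) then 1 else 0)

  ∑ℝ : (Carrier → ℝ) → ℝ
  ∑ℝ f = sumℝ (f ∘ to)

  ∑ᶜ : (Carrier → ℂ) → ℂ
  ∑ᶜ f = sumᶜ (f ∘ to)

  vectors : ∀ m → HasCardinality (VecSetoid.≋-setoid S m) (n ℕ.^ m)
  vectors m = record
    { to        = λ i → to ∘ finToFun i
    ; from      = λ x → funToFin (from ∘ x)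
    ; to-cong   = λ { refl _ → ≈-refl }
    ; from-cong = λ x≋y → funToFin-cong (from-cong ∘ x≋y)
    ; inverse   = (λ { {x} refl j → ≈-trans (to-cong (Fin.finToFun-funToFin (from ∘ x) j)) (inverseˡ refl) })
                , (λ {i} x≋ → trans (funToFin-cong (inverseʳ ∘ x≋)) (Fin.funToFin-finToFin {m} i))
    }
    where
    funToFin-cong : ∀ {m} {f g : Fin m → Fin n} → (∀ j → f j ≡ g j) → funToFin f ≡ funToFin g
    funToFin-cong {zero}  f≗g = refl
    funToFin-cong {suc m} f≗g = cong₂ Fin.combine (f≗g zero) (funToFin-cong (f≗g ∘ suc))

  record Distribution : Set (a ⊔ˡ ℓ) where
    field
      prob      : Carrier → ℝ
      prob-cong : ∀ {x y} → x ≈ y → prob x ≃ prob y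
      prob≥0    : ∀ x → 0ℝ ≤ℝ prob x
      total     : ∑ℝ prob ≃ 1ℝ

module UniformTotal where
  open import Data.Rational.Base using (_+_; _*_)

  indicatorℝ : Bool → ℚ → ℝ
  indicatorℝ d r = if d then fromℚ r else 0ℝ

  indicatorℕ : Bool → ℕ
  indicatorℕ d = if d then 1 else 0

  sum-indicator : ∀ {n} (d : Vector Bool n) r N →
    seq (sumℝ (λ i → indicatorℝ (d i) r)) N ≡ (+ sumℕ (indicatorℕ ∘ d) ℚ./ 1) * r
  sum-indicator {zero}  d r N = sym (ℚ.*-zeroˡ r)
  sum-indicator {suc n} d r N with d zero
  ... | false = trans (ℚ.+-identityˡ _) (sum-indicator (d ∘ suc) r N)
  ... | true  = trans (cong (λ z → r + z) (sum-indicator (d ∘ suc) r N))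
    (trans (sym (trans (ℚ.*-distribʳ-+ r 1ℚ (+ k ℚ./ 1)) (cong (_+ ((+ k ℚ./ 1) * r)) (ℚ.*-identityˡ r))))
           (cong (_* r) (sym (suc-/1 k))))
    where k = sumℕ (indicatorℕ ∘ d ∘ suc)

  indicator≤sum : ∀ {n} (d : Vector Bool n) i → indicatorℕ (d i) ≤ sumℕ (indicatorℕ ∘ d)
  indicator≤sum d zero    = ℕ.m≤m+n _ _
  indicator≤sum d (suc i) = ℕ.≤-trans (indicator≤sum (d ∘ suc) i) (ℕ.m≤n+m _ _)

  n*1/n : ∀ n → 1 ≤ n → (+ n ℚ./ 1) * 1/ℕ n ≡ 1ℚ
  n*1/n (suc n) _ = ℚ.toℚᵘ-injective (ℚᵘ.≃-trans (ℚ.toℚᵘ-homo-* (+ suc n ℚ./ 1) (+ 1 ℚ./ suc n))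
    (ℚᵘ.≃-trans (ℚᵘ.*-cong (ℚ.toℚᵘ-fromℚᵘ (mkℚᵘ (+ suc n) 0)) (ℚ.toℚᵘ-fromℚᵘ (mkℚᵘ (+ 1) n)))
      (*≡* (cong +_ (trans (ℕ.*-identityʳ (suc n ℕ.* 1)) (trans (ℕ.*-comm (suc n) 1) (sym (ℕ.*-identityˡ _))))))))

  1/ℕ≥0 : ∀ n → 0ℚ ℚ.≤ 1/ℕ n
  1/ℕ≥0 zero    = ℚ.≤-refl
  1/ℕ≥0 (suc n) = ℚ.nonNegative⁻¹ _ {{ℚ.normalize-nonNeg 1 (suc n)}}

  const≥0 : ∀ {r} → 0ℚ ℚ.≤ r → 0ℝ ≤ℝ fromℚ r
  const≥0 0≤r = mk≤ λ ε 0<ε → 0 , λ _ _ → ℚ.+-mono-≤-< 0≤r 0<ε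

module _ {S : Setoid a ℓ} {n : ℕ} (enum : HasCardinality S n) where
  open Setoid S renaming (refl to ≈-refl; sym to ≈-sym; trans to ≈-trans)
  open Inverse enum
  open Distribution
  open UniformTotal

  uniform : {P : Pred Carrier p} → P B.Respects _≈_ → Decidable P → ∃ P → Distribution enum
  uniform {P = P} resp P? (x₀ , px₀) = record
    { prob      = λ x → if does (P? x) then recip size else 0ℝ
    ; prob-cong = cong-lemma
    ; prob≥0    = nonneg
    ; total     = mk≃ λ ε 0<ε → 0 , λ N _ → subst (λ z → ∣ z ∣ < ε)
        (sym (trans (cong (ℚ._- 1ℚ) (trans (sum-indicator (does ∘ P? ∘ to) (1/ℕ size) N) (n*1/n size size≥1)))
          (ℚ.+-inverseʳ 1ℚ))) 0<ε
    }
    where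
    size : ℕ
    size = sizeOf enum P?
    size≥1 : 1 ≤ size
    size≥1 = ℕ.≤-trans (lemma (P? (to (from x₀)))) (indicator≤sum (does ∘ P? ∘ to) (from x₀))
      where
      lemma : (d : Dec (P (to (from x₀)))) → 1 ≤ indicatorℕ (does d)
      lemma (yes _) = ℕ.≤-refl
      lemma (no ¬q) = contradiction (resp (≈-sym (inverseˡ refl)) px₀) ¬q
    cong-lemma : ∀ {x y} → x ≈ y →
      (if does (P? x) then recip size else 0ℝ) ≃ (if does (P? y) then recip size else 0ℝ)
    cong-lemma {x} {y} x≈y with P? x | P? y
    ... | yes _ | yes _ = ≃-refl {recip size}
    ... | no _  | no _  = ≃-refl {0ℝ}
    ... | yes q | no ¬q = contradiction (resp x≈y q) ¬q
    ... | no ¬q | yes q = contradiction (resp (≈-sym x≈y) q) ¬q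
    nonneg : ∀ x → 0ℝ ≤ℝ (if does (P? x) then recip size else 0ℝ)
    nonneg x with does (P? x)
    ... | true  = const≥0 (1/ℕ≥0 size)
    ... | false = const≥0 ℚ.≤-refl

  -- The probability that x ∈ E when the coordinates of x are drawn
  -- independently from μ.
  Pr : Distribution enum → ∀ {m} {E : Pred (Vector Carrier m) p} → Decidable E → ℝ
  Pr μ {m} E? = ∑ℝ (vectors enum m)
    (λ x → if does (E? x) then productℝ (λ i → prob μ (x i)) else 0ℝ)

record FiniteField c ℓ : Set (lsuc (c ⊔ˡ ℓ)) where
  field
    commutativeRing : CommutativeRing c ℓ

  open CommutativeRing commutativeRing public
    hiding (zero) renaming (refl to ≈-refl; sym to ≈-sym; trans to ≈-trans)
  open Algebra.Definitions _≈_ using (Invertible)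

  field
    0≉1     : 0# ≉ 1#
    inverse : ∀ x → x ≉ 0# → Invertible 1# _*_ x
    order   : ℕ
    enum    : HasCardinality setoid order

  open MonoidSum +-monoid public using (sum; sum-cong-≋)

module _ (k : FiniteField c ℓ) where
  open FiniteField k

  record Subfield p : Set (c ⊔ˡ ℓ ⊔ˡ lsuc p) where
    field
      _∈K       : Pred Carrier p
      ∈K-resp-≈ : _∈K B.Respects _≈_
      0∈K       : 0# ∈K
      1∈K       : 1# ∈K
      +-closed  : ∀ {x y} → x ∈K → y ∈K → (x + y) ∈K
      -‿closed  : ∀ {x} → x ∈K → (- x) ∈K
      *-closed  : ∀ {x y} → x ∈K → y ∈K → (x * y) ∈K
      ⁻¹-closed : ∀ {x y} → x ∈K → x * y ≈ 1# → y ∈K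

    subsetoid : Setoid (c ⊔ˡ p) ℓ
    subsetoid = On.setoid {B = Σ Carrier _∈K} setoid proj₁

  module _ (k₀ : Subfield p) {s : ℕ} (enum₀ : HasCardinality (Subfield.subsetoid k₀) s) (c : Carrier) where
    open Subfield k₀
    open Inverse enum₀ using (to; from; inverseˡ)

    _∈cK : Pred Carrier _
    x ∈cK = ∃ λ y → y ∈K × x ≈ c * y

    _∈cK? : Decidable _∈cK
    x ∈cK? = map′ (λ (i , e) → proj₁ (to i) , proj₂ (to i) , e)
                  (λ (y , y∈ , e) → from (y , y∈) , ≈-trans e (*-congˡ (≈-sym (inverseˡ {y , y∈} refl))))
                  (Fin.any? (λ i → _≈?_ enum x (c * proj₁ (to i))))

    uniformOn-cK : Distribution enum
    uniformOn-cK = uniform enum (λ x≈x′ (y , y∈ , e) → y , y∈ , ≈-trans (≈-sym x≈x′) e)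
                     _∈cK? (c * 0# , 0# , 0∈K , ≈-refl)

  -- Magma homomorphisms suffice: a map between groups preserving the operation
  -- is a group homomorphism.
  record NontrivialCharacter : Set (c ⊔ˡ ℓ) where
    field
      ψ              : Carrier → ℂ
      isHomomorphism : IsMagmaHomomorphism +-rawMagma *ᶜ-rawMagma ψ
      on-circle      : ∀ x → modulus (ψ x) ≃ 1ℝ
      nontrivial     : ¬ (∀ x → ψ x ≃ᶜ 1ᶜ)

  module _ (ψ₀ : NontrivialCharacter) (μ : Distribution enum) where
    open NontrivialCharacter ψ₀
    open Distribution μ

    fourier : Carrier → ℂ
    fourier y = ∑ᶜ enum (λ x → prob x • ψ (y * x))

    ‖fourier‖₁ : ℝ
    ‖fourier‖₁ = ∑ℝ enum (λ y → modulus (fourier y))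

  module _ (m n : ℕ) (2m≤1+n : 2 ℕ.* m ≤ suc n) where

    i+j≤n : (i : Fin (suc m)) (j : Fin (suc (n ∸ m))) → toℕ i ℕ.+ toℕ j ≤ n
    i+j≤n i j = ℕ.≤-trans (ℕ.+-mono-≤ (Fin.toℕ≤pred[n] i) (Fin.toℕ≤pred[n] j))
                          (ℕ.≤-reflexive (ℕ.m+[n∸m]≡n (m≤n m 2m≤1+n)))
      where
      m≤n : ∀ m → 2 ℕ.* m ≤ suc n → m ≤ n
      m≤n zero    _       = z≤n
      m≤n (suc m) (s≤s h) = ℕ.≤-trans (ℕ.≤-trans (s≤s (ℕ.m≤m+n m 0)) (ℕ.m≤n+m (suc (m ℕ.+ 0)) m)) h

    -- shifted x j i = x_{i+j}
    shifted : Vector Carrier (suc n) → Fin (suc (n ∸ m)) → Vector Carrier (suc m)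
    shifted x j i = x (fromℕ< (s≤s (i+j≤n i j)))

    IsRelation : Vector Carrier (suc n) → Vector Carrier (suc m) → Set ℓ
    IsRelation x a = ¬ (∀ i → a i ≈ 0#) ×
      (∀ (j : Fin (suc (n ∸ m))) → sum (λ i → a i * shifted x j i) ≈ 0#)

    -- The relations are indexed by j = 0, …, n - m.
    H : Pred (Vector Carrier (suc n)) (c ⊔ˡ ℓ)
    H x = ∃ (IsRelation x)

    H? : Decidable H
    H? x = any? (vectors enum (suc m))
      (λ a≈b (a≉0 , rel) →
        (λ b≈0 → a≉0 (λ i → ≈-trans (a≈b i) (b≈0 i))) ,
        (λ j → ≈-trans (sum-cong-≋ (λ i → *-congʳ {shifted x j i} (≈-sym (a≈b i)))) (rel j)))
      (λ a → ¬? (Fin.all? (λ i → _≈?_ enum (a i) 0#))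
             ×-dec Fin.all? (λ j → _≈?_ enum _ 0#))

  Matrix : ℕ → Set c
  Matrix n = Vector (Vector Carrier n) n

  1ᴹ : ∀ {n} → Matrix n
  1ᴹ i j = if does (i Fin.≟ j) then 1# else 0#

  infixl 7 _*ᴹ_
  _*ᴹ_ : ∀ {n} → Matrix n → Matrix n → Matrix n
  (M *ᴹ N) i j = sum (λ l → M i l * N l j)

  infix 4 _≈ᴹ_
  _≈ᴹ_ : ∀ {n} → Matrix n → Matrix n → Set ℓ
  M ≈ᴹ N = ∀ i j → M i j ≈ N i j

  -- Invertible asks for a two-sided inverse matrix.
  Singular : ∀ {n} → Pred (Matrix n) (c ⊔ˡ ℓ)
  Singular M = ¬ (Algebra.Definitions.Invertible _≈ᴹ_ 1ᴹ _*ᴹ_ M)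

  Singular? : ∀ {n} → Decidable (Singular {n})
  Singular? {n} M = ¬? (any? (vectors (vectors enum n) n)
    (λ N≈N′ (l , r) →
      (λ i j → ≈-trans (sum-cong-≋ (λ h → *-congʳ (≈-sym (N≈N′ i h)))) (l i j)) ,
      (λ i j → ≈-trans (sum-cong-≋ (λ h → *-congˡ (≈-sym (N≈N′ h j)))) (r i j)))
    (λ N → (N *ᴹ M ≈ᴹ? 1ᴹ) ×-dec (M *ᴹ N ≈ᴹ? 1ᴹ)))
    where
    _≈ᴹ?_ : (M N : Matrix n) → Dec (M ≈ᴹ N)
    M ≈ᴹ? N = Fin.all? (λ i → Fin.all? (λ j → _≈?_ enum (M i j) (N i j)))
    infix 4 _≈ᴹ?_

  -- hankel m x i j = x_{i+j}
  hankel : ∀ m → Vector Carrier (suc (2 ℕ.* m)) → Matrix (suc m)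
  hankel m x i j = x (fromℕ< (s≤s (ℕ.+-mono-≤ (Fin.toℕ≤pred[n] i)
    (ℕ.≤-trans (Fin.toℕ≤pred[n] j) (ℕ.m≤m+n m 0)))))

2m≤1+2m+α : ∀ m α → 2 ℕ.* m ≤ suc (2 ℕ.* m ℕ.+ α)
2m≤1+2m+α m α = ℕ.m≤n⇒m≤1+n (ℕ.m≤m+n (2 ℕ.* m) α)

{-# OPTIONS --safe #-}

-- Over a field with q elements, let K(m, j) be the space of a ∈ F^m with
-- ∑ᵢ aᵢ x₍ᵢ₊ₜ₎ = 0 for all t < j. For a ∈ K(m+1, j) put ρ(a) = ∑ᵢ aᵢ x₍ᵢ₋₁₎,
-- where x₍₋₁₎ is arbitrary. If m ≤ j, evaluating ∑ᵢₗ aᵢ bₗ x₍ᵢ₊ₗ₋₁₎ in two ways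
-- gives a₀ ρ(b) = b₀ ρ(a), so (a₀, ρ(a)) ranges over a subspace of dimension at
-- most one; its kernel is K(m, j+1). Hence |K(m+1, j)| = q |K(m, j+1)| as soon
-- as K(m+1, j) ≠ 0. Summing over x, and counting the pairs (x, a) with
-- a ∈ K(m, j) also by a, shows that exactly q^(2m) sequences x of length m + j
-- have K(m+1, j) ≠ 0.
--
-- Since k = k₀ + θ k₀, a relation over k between elements of k₀ splits into two
-- relations over k₀, so this count for F = k₀ gives the probabilities.
--
-- For the Fourier transform, ψ(yw) μ̂(y) = μ̂(y) for all w ∈ c k₀, so averaging
-- over w shows that μ̂(y) is idempotent, hence 0 or 1. So the norm is
-- ∑ μ̂(y) = q μ(0).
module Submission where

open import Defs
open import Algebra.Bundles using (CommutativeRing)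
import Algebra.Definitions
open import Algebra.Morphism.Structures using (IsMagmaHomomorphism)
import Algebra.Properties.CommutativeSemigroup as SemigroupProperties
import Algebra.Properties.Ring as RingProperties
import Algebra.Properties.Semiring.Sum as SemiringSum
open import Data.Bool.Base using (Bool; true; if_then_else_)
open import Data.Fin.Base as Fin using (Fin; zero; suc; toℕ; fromℕ<; combine; _↑ˡ_; _↑ʳ_)
import Data.Fin.Permutation as Perm
import Data.Fin.Properties as Fin
open import Data.Integer.Base as ℤ using (+_)
import Data.Integer.Properties as ℤ
open import Data.Nat.Base as ℕ using (ℕ; zero; suc; _^_; _≤_; _<_; _∸_; z≤n; s≤s)
import Data.Nat.Properties as ℕ
open import Data.Nat.Solver using (module +-*-Solver)
open import Data.Product.Base using (∃; _×_; _,_; proj₁; proj₂)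
open import Data.Rational.Base as ℚ using (ℚ; 0ℚ; 1ℚ; ½; ∣_∣)
import Data.Rational.Properties as ℚ
import Data.Rational.Solver as ℚSolver
open import Data.Rational.Unnormalised.Base using (mkℚᵘ; *≡*)
import Data.Rational.Unnormalised.Properties as ℚᵘ
open import Data.Sum.Base using (_⊎_; inj₁; inj₂)
open import Data.Unit.Base using (⊤; tt)
open import Data.Vec.Functional using (Vector; _∷_; head; tail)
import Data.Vec.Functional.Relation.Binary.Equality.Setoid as VecSetoid
open import Function.Base using (_∘_; case_of_)
open import Function.Bundles using (Inverse)
open import Function.Definitions using (Injective)
open import Level using (Level)
open import Relation.Binary.Bundles using (Setoid)
import Relation.Binary.Definitions as B
open import Relation.Binary.PropositionalEquality using (_≡_; refl; sym; trans; cong; cong₂; subst; subst₂; module ≡-Reasoning)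
import Relation.Binary.Reasoning.Setoid as SetoidReasoning
open import Relation.Nullary.Decidable using (Dec; yes; no; does; _×-dec_; ¬?; map′)
open import Relation.Nullary.Negation using (¬_; contradiction)
open import Relation.Unary using (Pred; Decidable)

-- The dimension of K(m+1, j) varies with x and is never computed. When K(m+1, j) = 0, both spaces
-- have one element, so both cases fit the identity |K(m+1, j)| + (q - 1) = q |K(m, j+1)| + (q - 1)
-- [K(m+1, j) ≠ 0]. It is linear in the indicator, so summing over x leaves the number of degenerate
-- sequences as the only unknown; dividing by q - 1 then needs q ≥ 2.
--
-- For n = 2m + α the length is N = n + 1 and j = m + α + 1. With s = √q this gives s^(2m) sequences
-- out of s^(2m+α+1).
--
-- On the analytic side the obstacle is constructive: equality of reals is undecidable, and
-- nontriviality of ψ is a negated statement, so no w with ψ(w) ≠ 1 is at hand. Idempotents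
-- circumvent both. An idempotent complex number is 0 or 1, and one rational approximation of its
-- real part tells which. This yields ψ(0) = 1, the vanishing of ∑ ψ, and the replacement of |μ̂(y)|
-- by the real part of μ̂(y).

private
  variable
    a b c ℓ ℓ′ p p′ : Level

-- Counting in finite setoids

module ΣN = SemiringSum ℕ.+-*-semiring

⟦_⟧ : {P : Set p} → Dec P → ℕ
⟦ d ⟧ = if does d then 1 else 0

⟦⟧-yes : {P : Set p} (d : Dec P) → P → ⟦ d ⟧ ≡ 1
⟦⟧-yes (yes _) _ = refl
⟦⟧-yes (no ¬x) x = contradiction x ¬x

⟦⟧-no : {P : Set p} (d : Dec P) → ¬ P → ⟦ d ⟧ ≡ 0
⟦⟧-no (yes x) ¬x = contradiction x ¬x
⟦⟧-no (no _)  _  = refl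

⟦⟧-cong : {P : Set p} {Q : Set p′} (d : Dec P) (e : Dec Q) → (P → Q) → (Q → P) → ⟦ d ⟧ ≡ ⟦ e ⟧
⟦⟧-cong (yes x) e f g = sym (⟦⟧-yes e (f x))
⟦⟧-cong (no ¬x) e f g = sym (⟦⟧-no e (¬x ∘ g))

sum-const : ∀ n c → sumℕ {n} (λ _ → c) ≡ n ℕ.* c
sum-const zero    c = refl
sum-const (suc n) c = cong (c ℕ.+_) (sum-const n c)

sum-none : ∀ {n} {R : Pred (Fin n) p} (R? : Decidable R) → (∀ i → ¬ R i) → sumℕ (⟦_⟧ ∘ R?) ≡ 0
sum-none {n = n} R? ¬R = trans (ΣN.sum-cong-≗ (λ i → ⟦⟧-no (R? i) (¬R i)))
  (trans (sum-const n 0) (ℕ.*-zeroʳ n))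

sum-unique : ∀ {n} {R : Pred (Fin n) p} (R? : Decidable R) i → R i → (∀ j → R j → j ≡ i) →
             sumℕ (⟦_⟧ ∘ R?) ≡ 1
sum-unique R? zero    r u = cong₂ ℕ._+_ (⟦⟧-yes (R? zero) r)
  (sum-none (R? ∘ suc) (λ i r′ → contradiction (u (suc i) r′) λ ()))
sum-unique R? (suc i) r u = cong₂ ℕ._+_ (⟦⟧-no (R? zero) (λ r′ → contradiction (u zero r′) λ ()))
  (sum-unique (R? ∘ suc) i r (λ j r′ → Fin.suc-injective (u (suc j) r′)))

sum-+ : ∀ m {n} (f : Vector ℕ (m ℕ.+ n)) → sumℕ f ≡ sumℕ (f ∘ (_↑ˡ n)) ℕ.+ sumℕ (f ∘ (m ↑ʳ_))
sum-+ zero    f = refl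
sum-+ (suc m) f = trans (cong (f zero ℕ.+_) (sum-+ m (f ∘ suc))) (sym (ℕ.+-assoc (f zero) _ _))

sum-* : ∀ m {n} (f : Vector ℕ (m ℕ.* n)) → sumℕ f ≡ sumℕ (λ i → sumℕ (λ j → f (combine {m} {n} i j)))
sum-* zero        f = refl
sum-* (suc m) {n} f = trans (sum-+ n f) (cong (sumℕ (f ∘ (_↑ˡ (m ℕ.* n))) ℕ.+_) (sum-* m (f ∘ (n ↑ʳ_))))

∑ℕ : {S : Setoid a ℓ} {n : ℕ} → HasCardinality S n → (Setoid.Carrier S → ℕ) → ℕ
∑ℕ enum f = sumℕ (f ∘ Inverse.to enum)

module _ {S : Setoid a ℓ} {n : ℕ} (enum : HasCardinality S n) where
  open Setoid S using (Carrier; _≈_) renaming (refl to ≈-refl; sym to ≈-sym; trans to ≈-trans)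
  open Inverse enum

  sizeOf-cong : {P : Pred Carrier p} {Q : Pred Carrier p′} (P? : Decidable P) (Q? : Decidable Q) →
                (∀ x → P x → Q x) → (∀ x → Q x → P x) → sizeOf enum P? ≡ sizeOf enum Q?
  sizeOf-cong P? Q? f g = ΣN.sum-cong-≗ (λ i → ⟦⟧-cong (P? (to i)) (Q? (to i)) (f (to i)) (g (to i)))

  sizeOf-all : {P : Pred Carrier p} (P? : Decidable P) → (∀ x → P x) → sizeOf enum P? ≡ n
  sizeOf-all P? all = trans (ΣN.sum-cong-≗ (λ i → ⟦⟧-yes (P? (to i)) (all (to i))))
    (trans (sum-const n 1) (ℕ.*-identityʳ n))

  sizeOf-unique : {P : Pred Carrier p} (P? : Decidable P) → P B.Respects _≈_ →
                  ∀ x → P x → (∀ y → P y → y ≈ x) → sizeOf enum P? ≡ 1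
  sizeOf-unique P? resp x px u = sum-unique (P? ∘ to) (from x) (resp (≈-sym (inverseˡ refl)) px)
    (λ j pj → trans (sym (inverseʳ ≈-refl)) (from-cong (u (to j) pj)))

  sizeOf-none : {P : Pred Carrier p} (P? : Decidable P) → (∀ x → ¬ P x) → sizeOf enum P? ≡ 0
  sizeOf-none P? none = sum-none (P? ∘ to) (none ∘ to)

  open VecSetoid S using (_≋_)

  ∷-cong : ∀ {N} {x y} {xs ys : Vector Carrier N} → x ≈ y → xs ≋ ys → (x ∷ xs) ≋ (y ∷ ys)
  ∷-cong x≈y xs≋ys zero    = x≈y
  ∷-cong x≈y xs≋ys (suc i) = xs≋ys i

  -- The enumeration of vectors reads an index as digits with the head most significant, so the sum
  -- splits into a double sum. An enumerated vector is only pointwise equal to head and tail put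
  -- together, hence the congruence hypothesis on `f`.
  ∑ℕ-vectors-suc : ∀ {N} (f : Vector Carrier (suc N) → ℕ) → (∀ {x y} → x ≋ y → f x ≡ f y) →
    ∑ℕ (vectors enum (suc N)) f ≡ ∑ℕ enum (λ h → ∑ℕ (vectors enum N) (λ x → f (h ∷ x)))
  ∑ℕ-vectors-suc {N} f f-cong = trans (sum-* n {n ^ N} (f ∘ Inverse.to (vectors enum (suc N))))
    (ΣN.sum-cong-≗ {n} (λ i → ΣN.sum-cong-≗ {n ^ N} (λ j → f-cong (split i j))))
    where
    split : ∀ i j → Inverse.to (vectors enum (suc N)) (combine {n} {n ^ N} i j) ≋ (to i ∷ Inverse.to (vectors enum N) j)
    split i j zero    = to-cong (cong proj₁ (Fin.remQuot-combine {n} i j))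
    split i j (suc l) = to-cong (cong (λ z → Fin.finToFun (proj₂ z) l) (Fin.remQuot-combine {n} i j))

module _ {S : Setoid a ℓ} {T : Setoid b ℓ′} {m n : ℕ}
         (enumS : HasCardinality S m) (enumT : HasCardinality T n) where
  private
    module S = Setoid S
    module T = Setoid T
    module ES = Inverse enumS
    module ET = Inverse enumT

  -- Double counting of the pairs with `Q t` and `f t ≈ s`: a row with `P s` contains exactly one of
  -- them, and so does a column with `Q t`. No inverse function is required, only injectivity on `Q`
  -- and surjectivity onto `P`.
  sizeOf-bijection : {P : Pred S.Carrier p} {Q : Pred T.Carrier p′} (P? : Decidable P) (Q? : Decidable Q) →
    P B.Respects S._≈_ → Q B.Respects T._≈_ →
    (f : T.Carrier → S.Carrier) → (∀ {s t} → s T.≈ t → f s S.≈ f t) →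
    (∀ t → Q t → P (f t)) → (∀ s t → Q s → Q t → f s S.≈ f t → s T.≈ t) →
    (∀ x → P x → ∃ λ t → Q t × f t S.≈ x) →
    sizeOf enumS P? ≡ sizeOf enumT Q?
  sizeOf-bijection {P = P} {Q} P? Q? P-resp Q-resp f f-cong f-maps f-inj f-surj = begin
    sumℕ (λ i → ⟦ P? (ES.to i) ⟧)          ≡⟨ ΣN.sum-cong-≗ (λ i → sym (row i)) ⟩
    sumℕ (λ i → sumℕ (λ j → ⟦ R? i j ⟧))   ≡⟨ ΣN.∑-comm (λ i j → ⟦ R? i j ⟧) ⟩
    sumℕ (λ j → sumℕ (λ i → ⟦ R? i j ⟧))   ≡⟨ ΣN.sum-cong-≗ column ⟩
    sumℕ (λ j → ⟦ Q? (ET.to j) ⟧)          ∎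
    where
    open ≡-Reasoning
    R : Fin m → Fin n → Set _
    R i j = Q (ET.to j) × f (ET.to j) S.≈ ES.to i
    R? : ∀ i j → Dec (R i j)
    R? i j = Q? (ET.to j) ×-dec _≈?_ enumS (f (ET.to j)) (ES.to i)
    row : ∀ i → sumℕ (λ j → ⟦ R? i j ⟧) ≡ ⟦ P? (ES.to i) ⟧
    row i with P? (ES.to i)
    ... | yes px = let t , qt , ft≈ = f-surj (ES.to i) px ; to-t = ET.inverseˡ {t} refl in
      sum-unique (R? i) (ET.from t)
        (Q-resp (T.sym to-t) qt , S.trans (f-cong to-t) ft≈)
        (λ j (qj , fj≈) → trans (sym (ET.inverseʳ T.refl))
          (ET.from-cong (f-inj _ _ qj qt (S.trans fj≈ (S.sym ft≈)))))
    ... | no ¬px = sum-none (R? i) (λ j (qj , fj≈) → ¬px (P-resp fj≈ (f-maps _ qj)))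
    column : ∀ j → sumℕ (λ i → ⟦ R? i j ⟧) ≡ ⟦ Q? (ET.to j) ⟧
    column j with Q? (ET.to j)
    ... | yes qj = sum-unique (λ i → yes qj ×-dec _≈?_ enumS (f (ET.to j)) (ES.to i)) (ES.from (f (ET.to j)))
        (qj , S.sym (ES.inverseˡ refl))
        (λ i (_ , fj≈) → trans (sym (ES.inverseʳ S.refl)) (ES.from-cong (S.sym fj≈)))
    ... | no ¬qj = sum-none (λ i → no ¬qj ×-dec _≈?_ enumS (f (ET.to j)) (ES.to i)) (λ i (qj , _) → ¬qj qj)

-- Linear relations of Hankel type over a finite field

module Hankel (F : FiniteField c ℓ) where
  open FiniteField F hiding (sum; sum-cong-≋)
  open VecSetoid setoid using (_≋_)
  module ΣF = SemiringSum semiring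
  open ΣF using (sum)

  infix 4 _≟_
  _≟_ : B.Decidable _≈_
  _≟_ = _≈?_ enum

  ≈-reflexive : ∀ {x y} → x ≡ y → x ≈ y
  ≈-reflexive refl = ≈-refl

  x≈0⇒x*y≈0 : ∀ {x} y → x ≈ 0# → x * y ≈ 0#
  x≈0⇒x*y≈0 y x≈0 = ≈-trans (*-congʳ x≈0) (zeroˡ y)

  y≈0⇒x*y≈0 : ∀ x {y} → y ≈ 0# → x * y ≈ 0#
  y≈0⇒x*y≈0 x y≈0 = ≈-trans (*-congˡ y≈0) (zeroʳ x)

  x≈0⇒x+y≈y : ∀ {x} y → x ≈ 0# → x + y ≈ y
  x≈0⇒x+y≈y y x≈0 = ≈-trans (+-congʳ x≈0) (+-identityˡ y)

  y≈0⇒x+y≈x : ∀ x {y} → y ≈ 0# → x + y ≈ x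
  y≈0⇒x+y≈x x y≈0 = ≈-trans (+-congˡ y≈0) (+-identityʳ x)

  +-cancelˡ′ : ∀ x {y z} → x + y ≈ x + z → y ≈ z
  +-cancelˡ′ x {y} {z} e = begin
    y               ≈⟨ x≈0⇒x+y≈y y (-‿inverseˡ x) ⟨
    (- x + x) + y   ≈⟨ +-assoc (- x) x y ⟩
    - x + (x + y)   ≈⟨ +-congˡ e ⟩
    - x + (x + z)   ≈⟨ +-assoc (- x) x z ⟨
    (- x + x) + z   ≈⟨ x≈0⇒x+y≈y z (-‿inverseˡ x) ⟩
    z               ∎
    where open SetoidReasoning setoid

  *-cancelˡ : ∀ x {y z} → x ≉ 0# → x * y ≈ x * z → y ≈ z
  *-cancelˡ x {y} {z} x≉0 e with inverse x x≉0
  ... | x⁻¹ , x⁻¹x≈1 , _ = begin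
    y               ≈⟨ *-identityˡ y ⟨
    1# * y          ≈⟨ *-congʳ x⁻¹x≈1 ⟨
    (x⁻¹ * x) * y   ≈⟨ *-assoc x⁻¹ x y ⟩
    x⁻¹ * (x * y)   ≈⟨ *-congˡ e ⟩
    x⁻¹ * (x * z)   ≈⟨ *-assoc x⁻¹ x z ⟨
    (x⁻¹ * x) * z   ≈⟨ *-congʳ x⁻¹x≈1 ⟩
    1# * z          ≈⟨ *-identityˡ z ⟩
    z               ∎
    where open SetoidReasoning setoid

  xy≈0⇒y≈0 : ∀ {x y} → x ≉ 0# → x * y ≈ 0# → y ≈ 0#
  xy≈0⇒y≈0 {x} x≉0 e = *-cancelˡ x x≉0 (≈-trans e (≈-sym (zeroʳ x)))

  cancelling : ∀ {p} → p ≉ 0# → ∀ x → ∃ λ μ → x + μ * p ≈ 0#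
  cancelling {p} p≉0 x with inverse p p≉0
  ... | p⁻¹ , p⁻¹p≈1 , _ = - x * p⁻¹ , (begin
    x + - x * p⁻¹ * p    ≈⟨ +-congˡ (*-assoc (- x) p⁻¹ p) ⟩
    x + - x * (p⁻¹ * p)  ≈⟨ +-congˡ (*-congˡ p⁻¹p≈1) ⟩
    x + - x * 1#         ≈⟨ +-congˡ (*-identityʳ (- x)) ⟩
    x + - x              ≈⟨ -‿inverseʳ x ⟩
    0#                   ∎)
    where open SetoidReasoning setoid

  -- The determinant of `(p , r)` and `(x , y)` vanishes. The factor `μ` is solved for in a
  -- coordinate where `(p , r)` is nonzero, and the determinant settles the other coordinate.
  proportional : ∀ {p r x y} → ¬ (p ≈ 0# × r ≈ 0#) → p * y ≈ x * r →
                 ∃ λ μ → x + μ * p ≈ 0# × y + μ * r ≈ 0#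
  proportional {p} {r} {x} {y} pr≉0 py≈xr with p ≟ 0#
  ... | no p≉0 = let μ , x+μp≈0 = cancelling p≉0 x in
    μ , x+μp≈0 , xy≈0⇒y≈0 p≉0 (begin
      p * (y + μ * r)          ≈⟨ distribˡ p y (μ * r) ⟩
      p * y + p * (μ * r)      ≈⟨ +-cong py≈xr (≈-sym (*-assoc p μ r)) ⟩
      x * r + p * μ * r        ≈⟨ +-congˡ (*-congʳ (*-comm p μ)) ⟩
      x * r + μ * p * r        ≈⟨ distribʳ r x (μ * p) ⟨
      (x + μ * p) * r          ≈⟨ x≈0⇒x*y≈0 r x+μp≈0 ⟩
      0#                       ∎)
    where open SetoidReasoning setoid
  ... | yes p≈0 = let μ , y+μr≈0 = cancelling r≉0 y in
    μ , ≈-trans (x≈0⇒x+y≈y (μ * p) x≈0) (y≈0⇒x*y≈0 μ p≈0) , y+μr≈0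
    where
    r≉0 : r ≉ 0#
    r≉0 r≈0 = pr≉0 (p≈0 , r≈0)
    x≈0 : x ≈ 0#
    x≈0 = xy≈0⇒y≈0 r≉0 (≈-trans (*-comm r x) (≈-trans (≈-sym py≈xr) (x≈0⇒x*y≈0 y p≈0)))

  -- `X` is an infinite sequence so that the index `i + t` needs no bound; finite sequences enter
  -- through `ext`.
  pair : ∀ {m} → Vector Carrier m → (ℕ → Carrier) → ℕ → Carrier
  pair a X t = sum (λ i → a i * X (toℕ i ℕ.+ t))

  Ann : ∀ {m} → ℕ → Vector Carrier m → (ℕ → Carrier) → Set ℓ
  Ann j a X = ∀ t → t < j → pair a X t ≈ 0#

  -- Opaque, so that indicators of these decisions stay folded in goals.
  opaque
    Ann? : ∀ {m} j (a : Vector Carrier m) X → Dec (Ann j a X)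
    Ann? j a X = map′ (λ f t → f {t}) (λ f {t} → f t) (ℕ.allUpTo? (λ t → pair a X t ≟ 0#) j)

  pair-cong : ∀ {m} {a b : Vector Carrier m} X Y t → a ≋ b → (∀ i → X i ≈ Y i) → pair a X t ≈ pair b Y t
  pair-cong X Y t a≋b X≈Y = ΣF.sum-cong-≋ (λ i → *-cong (a≋b i) (X≈Y (toℕ i ℕ.+ t)))

  Ann-respˡ : ∀ {m j} {a b : Vector Carrier m} X → a ≋ b → Ann j a X → Ann j b X
  Ann-respˡ X a≋b ann t t<j = ≈-trans (≈-sym (pair-cong X X t a≋b (λ _ → ≈-refl))) (ann t t<j)

  Ann-respʳ : ∀ {m j} (a : Vector Carrier m) {X Y} → (∀ i → X i ≈ Y i) → Ann j a X → Ann j a Y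
  Ann-respʳ a {X} {Y} X≈Y ann t t<j = ≈-trans (≈-sym (pair-cong X Y t (λ i → ≈-refl {a i}) X≈Y)) (ann t t<j)

  pair-suc : ∀ {m} (a : Vector Carrier m) X t → pair a X (suc t) ≈ pair a (X ∘ suc) t
  pair-suc {m} a X t = ΣF.sum-cong-≋ {m} {λ i → a i * X (toℕ i ℕ.+ suc t)} (λ i → *-congˡ (≈-reflexive (cong X (ℕ.+-suc (toℕ i) t))))

  pair-linear : ∀ {m} μ (a b : Vector Carrier m) X t →
                pair (λ i → μ * a i + b i) X t ≈ μ * pair a X t + pair b X t
  pair-linear μ a b X t = begin
    sum (λ i → (μ * a i + b i) * Z i)              ≈⟨ ΣF.sum-cong-≋ (λ i → ≈-trans (distribʳ (Z i) _ (b i)) (+-congʳ (*-assoc μ (a i) (Z i)))) ⟩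
    sum (λ i → μ * (a i * Z i) + b i * Z i)        ≈⟨ ΣF.∑-distrib-+ (λ i → μ * (a i * Z i)) _ ⟩
    sum (λ i → μ * (a i * Z i)) + pair b X t       ≈⟨ +-congʳ (ΣF.*-distribˡ-sum μ (λ i → a i * Z i)) ⟨
    μ * pair a X t + pair b X t                    ∎
    where
    open SetoidReasoning setoid
    Z : Fin _ → Carrier
    Z i = X (toℕ i ℕ.+ t)

  sum-zero : ∀ {n} {f : Vector Carrier n} → (∀ i → f i ≈ 0#) → sum f ≈ 0#
  sum-zero {n} f≈0 = ≈-trans (ΣF.sum-cong-≋ f≈0) (ΣF.sum-replicate-zero n)

  pair-zero : ∀ {m} {a : Vector Carrier m} X t → (∀ i → a i ≈ 0#) → pair a X t ≈ 0#
  pair-zero X t a≈0 = sum-zero (λ i → x≈0⇒x*y≈0 _ (a≈0 i))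

  -- In the counts below, `N ≡ j + m` makes `m + j - 1` the largest index read from a sequence, so
  -- its padding does not affect the equations. For coefficient vectors the padding is what `shift`
  -- brings in at the end.
  ext : ∀ {N} → Vector Carrier N → ℕ → Carrier
  ext {zero}  x _       = 0#
  ext {suc N} x zero    = head x
  ext {suc N} x (suc i) = ext (tail x) i

  ext-cong : ∀ {N} {x y : Vector Carrier N} → x ≋ y → ∀ i → ext x i ≈ ext y i
  ext-cong {zero}  x≋y i       = ≈-refl
  ext-cong {suc N} x≋y zero    = x≋y zero
  ext-cong {suc N} x≋y (suc i) = ext-cong (x≋y ∘ suc) i

  ext-toℕ : ∀ {N} (x : Vector Carrier N) i → ext x (toℕ i) ≡ x i
  ext-toℕ x zero    = refl
  ext-toℕ x (suc i) = ext-toℕ (tail x) i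

  ext-≥ : ∀ {N} (x : Vector Carrier N) {i} → N ≤ i → ext x i ≡ 0#
  ext-≥ {zero}  x N≤i       = refl
  ext-≥ {suc N} x (s≤s N≤i) = ext-≥ (tail x) N≤i

  NonZeroVec : ∀ {m} → Vector Carrier m → Set ℓ
  NonZeroVec a = ¬ (∀ i → a i ≈ 0#)

  -- The equations hold for the sequence X; prepending a term to X makes the
  -- next equation, shifted one step back, available as ρ.
  module Relations (X : ℕ → Carrier) (m j : ℕ) (m≤j : m ≤ j) where

    X₊ : ℕ → Carrier
    X₊ zero    = 0#
    X₊ (suc i) = X i

    K : Pred (Vector Carrier (suc m)) ℓ
    K a = Ann j a X

    K⁻ : Pred (Vector Carrier m) ℓ
    K⁻ b = Ann (suc j) b X

    ρ : Vector Carrier (suc m) → Carrier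
    ρ a = pair a X₊ 0

    K? : Decidable K
    K? a = Ann? j a X

    K⁻? : Decidable K⁻
    K⁻? b = Ann? (suc j) b X

    -- Both sides are the double sum ∑ aᵢ bₗ x₍ᵢ₊ₗ₋₁₎.
    symmetric : ∀ (a b : Vector Carrier (suc m)) → sum (λ i → a i * pair b X₊ (toℕ i)) ≈ sum (λ i → b i * pair a X₊ (toℕ i))
    symmetric a b = begin
      sum (λ i → a i * pair b X₊ (toℕ i))
        ≈⟨ ΣF.sum-cong-≋ (λ i → ΣF.*-distribˡ-sum (a i) (λ l → b l * X₊ (toℕ l ℕ.+ toℕ i))) ⟩
      sum (λ i → sum (λ l → a i * (b l * X₊ (toℕ l ℕ.+ toℕ i))))
        ≈⟨ ΣF.∑-comm (λ i l → a i * (b l * X₊ (toℕ l ℕ.+ toℕ i))) ⟩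
      sum (λ l → sum (λ i → a i * (b l * X₊ (toℕ l ℕ.+ toℕ i))))
        ≈⟨ ΣF.sum-cong-≋ (λ l → ΣF.sum-cong-≋ (λ i → exchange i l)) ⟩
      sum (λ l → sum (λ i → b l * (a i * X₊ (toℕ i ℕ.+ toℕ l))))
        ≈⟨ ΣF.sum-cong-≋ (λ l → ΣF.*-distribˡ-sum (b l) (λ i → a i * X₊ (toℕ i ℕ.+ toℕ l))) ⟨
      sum (λ l → b l * pair a X₊ (toℕ l)) ∎
      where
      open SetoidReasoning setoid
      exchange : ∀ i l → a i * (b l * X₊ (toℕ l ℕ.+ toℕ i)) ≈ b l * (a i * X₊ (toℕ i ℕ.+ toℕ l))
      exchange i l = begin
        a i * (b l * X₊ (toℕ l ℕ.+ toℕ i))  ≈⟨ *-congˡ (*-congˡ (≈-reflexive (cong X₊ (ℕ.+-comm (toℕ l) (toℕ i))))) ⟩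
        a i * (b l * X₊ (toℕ i ℕ.+ toℕ l))  ≈⟨ *-assoc (a i) (b l) _ ⟨
        a i * b l * X₊ (toℕ i ℕ.+ toℕ l)    ≈⟨ *-congʳ (*-comm (a i) (b l)) ⟩
        b l * a i * X₊ (toℕ i ℕ.+ toℕ l)    ≈⟨ *-assoc (b l) (a i) _ ⟩
        b l * (a i * X₊ (toℕ i ℕ.+ toℕ l))  ∎

    -- Term `i + 1` contains `pair b X i`, which vanishes because `i < m ≤ j`. This is where `m ≤ j`
    -- enters.
    first-term : ∀ (a b : Vector Carrier (suc m)) → K b → sum (λ i → a i * pair b X₊ (toℕ i)) ≈ head a * ρ b
    first-term a b kb = y≈0⇒x+y≈x _ (sum-zero (λ i → y≈0⇒x*y≈0 (a (suc i))
      (≈-trans (pair-suc b X₊ (toℕ i)) (kb (toℕ i) (ℕ.<-≤-trans (Fin.toℕ<n i) m≤j)))))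

    cross : ∀ a b → K a → K b → head a * ρ b ≈ head b * ρ a
    cross a b ka kb = ≈-trans (≈-sym (first-term a b kb)) (≈-trans (symmetric a b) (first-term b a ka))

    0∷-pair : ∀ (b : Vector Carrier m) Z t → pair (0# ∷ b) Z t ≈ pair b (Z ∘ suc) t
    0∷-pair b Z t = x≈0⇒x+y≈y _ (zeroˡ (Z t))

    0∷-K : ∀ b → K⁻ b → K (0# ∷ b)
    0∷-K b k t t<j = ≈-trans (0∷-pair b X t) (≈-trans (≈-sym (pair-suc b X t)) (k (suc t) (s≤s t<j)))

    0∷-ρ : ∀ b → K⁻ b → ρ (0# ∷ b) ≈ 0#
    0∷-ρ b k = ≈-trans (0∷-pair b X₊ 0) (k 0 (s≤s z≤n))

    -- Since the head contributes nothing, equation `0` for `tail a` is `ρ a ≈ 0#` and equation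
    -- `t + 1` is equation `t` for `a`. With `0∷-K` and `0∷-ρ` this identifies `K⁻` with the kernel
    -- of `a ↦ (head a , ρ a)` on `K`.
    tail-K⁻ : ∀ a → K a → head a ≈ 0# → ρ a ≈ 0# → K⁻ (tail a)
    tail-K⁻ a k h≈0 ρ≈0 zero    _         = ≈-trans (≈-sym (x≈0⇒x+y≈y _ (x≈0⇒x*y≈0 _ h≈0))) ρ≈0
    tail-K⁻ a k h≈0 ρ≈0 (suc t) (s≤s t<j) = ≈-trans (pair-suc (tail a) X t)
      (≈-trans (≈-sym (x≈0⇒x+y≈y _ (x≈0⇒x*y≈0 _ h≈0))) (k t t<j))

    -- The image of such an `a` under `(head , ρ)` is nonzero, so by `cross` it spans the image of
    -- `K`.
    Pivot : Pred (Vector Carrier (suc m)) ℓ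
    Pivot a = K a × ¬ (head a ≈ 0# × ρ a ≈ 0#)

    -- For `head a ≈ 0#` this is division of the polynomial `∑ aᵢ Tⁱ` by `T`, kept at the same
    -- length.
    shift : Vector Carrier (suc m) → Vector Carrier (suc m)
    shift a i = ext a (suc (toℕ i))

    shift-pair : ∀ a Z t → pair (shift a) Z t ≈ pair (tail a) Z t
    shift-pair a Z t = begin
      sum f                                 ≈⟨ ΣF.sum-init-last f ⟩
      sum (f ∘ Fin.inject₁) + f (Fin.fromℕ m) ≈⟨ y≈0⇒x+y≈x _ (x≈0⇒x*y≈0 _ (≈-reflexive (ext-≥ (tail a) (ℕ.≤-reflexive (sym (Fin.toℕ-fromℕ m)))))) ⟩
      sum (f ∘ Fin.inject₁)                 ≈⟨ ΣF.sum-cong-≋ (λ i → *-cong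
                                                  (≈-reflexive (trans (cong (ext (tail a)) (Fin.toℕ-inject₁ i)) (ext-toℕ (tail a) i)))
                                                  (≈-reflexive (cong (λ n → Z (n ℕ.+ t)) (Fin.toℕ-inject₁ i)))) ⟩
      pair (tail a) Z t                     ∎
      where
      open SetoidReasoning setoid
      f : Vector Carrier (suc m)
      f i = shift a i * Z (toℕ i ℕ.+ t)

    -- Without a pivot K is stable under shift, which kills every vector eventually.
    pivot : ∀ a → K a → NonZeroVec a → ∃ Pivot
    pivot a ka a≉0 with any? (vectors enum (suc m)) {P = Pivot}
      (λ {a} {b} a≋b (k , ne) → Ann-respˡ X a≋b k , λ (h , r) →
        ne (≈-trans (a≋b zero) h , ≈-trans (pair-cong X₊ X₊ 0 a≋b (λ _ → ≈-refl)) r))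
      (λ a → K? a ×-dec ¬? ((head a ≟ 0#) ×-dec (ρ a ≟ 0#)))
    ... | yes p = p
    ... | no ¬p = contradiction (λ i → ≈-trans (≈-reflexive (sym (ext-toℕ a i))) (vanish (toℕ i) a ka)) a≉0
      where
      trivial : ∀ a → K a → head a ≈ 0# × ρ a ≈ 0#
      trivial a k with (head a ≟ 0#) ×-dec (ρ a ≟ 0#)
      ... | yes e = e
      ... | no ne = contradiction (a , k , ne) ¬p
      vanish : ∀ r a → K a → ext a r ≈ 0#
      vanish zero    a k = proj₁ (trivial a k)
      vanish (suc r) a k = ≈-trans (≈-sym (shifted-entry r)) (vanish r (shift a) shift-K)
        where
        shift-K : K (shift a)
        shift-K t t<j = ≈-trans (shift-pair a X t)
          (tail-K⁻ a k (proj₁ (trivial a k)) (proj₂ (trivial a k)) t (ℕ.m≤n⇒m≤1+n t<j))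
        shifted-entry : ∀ r → ext (shift a) r ≈ ext a (suc r)
        shifted-entry r with r ℕ.<? suc m
        ... | yes r<1+m = ≈-reflexive (trans (cong (ext (shift a)) (sym (Fin.toℕ-fromℕ< r<1+m)))
          (trans (ext-toℕ (shift a) (Fin.fromℕ< r<1+m)) (cong (λ n → ext a (suc n)) (Fin.toℕ-fromℕ< r<1+m))))
        ... | no r≮1+m = ≈-reflexive (trans (ext-≥ (shift a) (ℕ.≮⇒≥ r≮1+m))
          (sym (ext-≥ (tail a) (ℕ.<⇒≤ (ℕ.≮⇒≥ r≮1+m)))))

    module _ (p : Vector Carrier (suc m)) (pv : Pivot p) where
      kp : K p
      kp = proj₁ pv

      -- Parametrises `K` by pairs of a scalar and an element of `K⁻`, packed into one vector: the
      -- head of `v` is the coefficient of the pivot, its tail the kernel part.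
      combination : Vector Carrier (suc m) → Vector Carrier (suc m)
      combination v i = head v * p i + (0# ∷ tail v) i

      combination-head : ∀ v → head (combination v) ≈ head v * head p
      combination-head v = +-identityʳ _

      combination-ρ : ∀ v → K⁻ (tail v) → ρ (combination v) ≈ head v * ρ p
      combination-ρ v k = ≈-trans (pair-linear (head v) p (0# ∷ tail v) X₊ 0) (y≈0⇒x+y≈x _ (0∷-ρ (tail v) k))

      -- The kernel part is invisible to `head` and `ρ`, so the coefficient of `p` can be read off
      -- in whichever of them is nonzero at `p`. Cancelling that multiple of `p` leaves the tail.
      combination-injective : ∀ v w → K⁻ (tail v) → K⁻ (tail w) → combination v ≋ combination w → v ≋ w
      combination-injective v w kv kw e = go
        where
        heads : head v ≈ head w
        heads with head p ≟ 0#
        ... | no h≉0 = *-cancelˡ (head p) h≉0 (≈-trans (*-comm (head p) (head v)) (≈-trans (≈-sym (combination-head v))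
          (≈-trans (e zero) (≈-trans (combination-head w) (*-comm (head w) (head p))))))
        ... | yes h≈0 = *-cancelˡ (ρ p) (λ ρ≈0 → proj₂ pv (h≈0 , ρ≈0))
          (≈-trans (*-comm (ρ p) (head v)) (≈-trans (≈-sym (combination-ρ v kv))
          (≈-trans (pair-cong X₊ X₊ 0 e (λ _ → ≈-refl)) (≈-trans (combination-ρ w kw) (*-comm (head w) (ρ p))))))
        go : v ≋ w
        go zero    = heads
        go (suc i) = +-cancelˡ′ (head v * p (suc i))
          (≈-trans (e (suc i)) (+-congʳ (*-congʳ (≈-sym heads))))

      combination-K : ∀ v → K⁻ (tail v) → K (combination v)
      combination-K v k t t<j = ≈-trans (pair-linear (head v) p (0# ∷ tail v) X t)
        (≈-trans (x≈0⇒x+y≈y _ (y≈0⇒x*y≈0 (head v) (kp t t<j))) (0∷-K (tail v) k t t<j))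

      combination-surjective : ∀ a → K a → ∃ λ v → K⁻ (tail v) × combination v ≋ a
      combination-surjective a ka with proportional (proj₂ pv) (cross p a kp ka)
      -- `proportional` finds `μ` such that `a + μ p` lies in the kernel; hence the coefficient of
      -- `p` in `a` is `- μ`.
      ... | μ , head≈0 , ρ≈0 = (- μ ∷ tail d) , tail-K⁻ d kd d-head≈0 d-ρ≈0 , eq
        where
        d : Vector Carrier (suc m)
        d i = μ * p i + a i
        kd : K d
        kd t t<j = ≈-trans (pair-linear μ p a X t) (≈-trans (x≈0⇒x+y≈y _ (y≈0⇒x*y≈0 μ (kp t t<j))) (ka t t<j))
        d-head≈0 : head d ≈ 0#
        d-head≈0 = ≈-trans (+-comm _ _) head≈0
        d-ρ≈0 : ρ d ≈ 0#
        d-ρ≈0 = ≈-trans (pair-linear μ p a X₊ 0) (≈-trans (+-comm _ _) ρ≈0)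
        restore : ∀ i → - μ * p i + d i ≈ a i
        restore i = ≈-trans (≈-sym (+-assoc _ _ _))
          (x≈0⇒x+y≈y _ (≈-trans (≈-sym (distribʳ (p i) (- μ) μ)) (x≈0⇒x*y≈0 _ (-‿inverseˡ μ))))
        eq : combination (- μ ∷ tail d) ≋ a
        eq zero    = ≈-trans (+-congˡ (≈-sym d-head≈0)) (restore zero)
        eq (suc i) = restore (suc i)

      size-K : sizeOf (vectors enum (suc m)) K? ≡ order ℕ.* sizeOf (vectors enum m) K⁻?
      size-K = begin
        sizeOf (vectors enum (suc m)) K?
          ≡⟨ sizeOf-bijection (vectors enum (suc m)) (vectors enum (suc m)) {P = K} {Q = K⁻ ∘ tail} K? (K⁻? ∘ tail)
               (λ a≋b → Ann-respˡ X a≋b) (λ a≋b → Ann-respˡ X (a≋b ∘ suc))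
               combination
               (λ {v} {w} v≋w → λ { zero → +-congʳ (*-congʳ (v≋w zero)) ; (suc i) → +-cong (*-congʳ (v≋w zero)) (v≋w (suc i)) })
               combination-K combination-injective combination-surjective ⟩
        sizeOf (vectors enum (suc m)) (K⁻? ∘ tail)
          ≡⟨ ∑ℕ-vectors-suc enum {m} (λ v → ⟦ K⁻? (tail v) ⟧)
               (λ a≋b → ⟦⟧-cong (K⁻? _) (K⁻? _) (Ann-respˡ X (a≋b ∘ suc))
                                              (Ann-respˡ X (λ i → ≈-sym (a≋b (suc i))))) ⟩
        sumℕ {order} (λ i → sizeOf (vectors enum m) K⁻?)
          ≡⟨ sum-const order _ ⟩
        order ℕ.* sizeOf (vectors enum m) K⁻? ∎
        where open ≡-Reasoning

  -- Counting the sequences with a nonzero relation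

  Degenerate : ∀ m → ℕ → (ℕ → Carrier) → Set _
  Degenerate m j X = ∃ λ (a : Vector Carrier m) → NonZeroVec a × Ann j a X

  opaque
    Degenerate? : ∀ m j X → Dec (Degenerate m j X)
    Degenerate? m j X = any? (vectors enum m) {P = λ a → NonZeroVec a × Ann j a X}
      (λ a≋b (a≉0 , ann) → (λ b≈0 → a≉0 (λ i → ≈-trans (a≋b i) (b≈0 i))) , Ann-respˡ X a≋b ann)
      (λ a → ¬? (Fin.all? (λ i → a i ≟ 0#)) ×-dec Ann? j a X)

  zeros : ∀ {m} → Vector Carrier m
  zeros _ = 0#

  size-trivial : ∀ m j X → ¬ Degenerate m j X → sizeOf (vectors enum m) (λ a → Ann? j a X) ≡ 1
  size-trivial m j X ¬d = sizeOf-unique (vectors enum m) (λ a → Ann? j a X)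
    (λ a≋b → Ann-respˡ X a≋b) zeros (λ t _ → pair-zero {a = zeros {m}} X t (λ _ → ≈-refl)) unique
    where
    unique : ∀ a → Ann j a X → ∀ i → a i ≈ 0#
    unique a ann with Fin.all? (λ i → a i ≟ 0#)
    ... | yes a≈0 = a≈0
    ... | no a≉0  = contradiction (a , a≉0 , ann) ¬d

  module _ {p : ℕ} (order≡1+p : order ≡ suc p) where

    -- Here `p` is `order - 1`. In the degenerate case a pivot exists and `size-K` applies;
    -- otherwise both sizes are `1` and the identity reads `1 + p ≡ order`. Having the indicator as
    -- a summand allows summation over all sequences.
    size-relation : ∀ X m j → m ≤ j →
      sizeOf (vectors enum (suc m)) (λ a → Ann? j a X) ℕ.+ p ≡
      order ℕ.* sizeOf (vectors enum m) (λ a → Ann? (suc j) a X) ℕ.+ ⟦ Degenerate? (suc m) j X ⟧ ℕ.* p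
    size-relation X m j m≤j with Degenerate? (suc m) j X
    ... | yes (a , a≉0 , ka) = let b , pv = Relations.pivot X m j m≤j a ka a≉0 in
      cong₂ ℕ._+_ (Relations.size-K X m j m≤j b pv) (sym (ℕ.+-identityʳ p))
    ... | no ¬d = begin
      sizeOf (vectors enum (suc m)) (λ a → Ann? j a X) ℕ.+ p ≡⟨ cong (ℕ._+ p) (size-trivial (suc m) j X ¬d) ⟩
      suc p                                                  ≡⟨ order≡1+p ⟨
      order                                                  ≡⟨ ℕ.*-identityʳ order ⟨
      order ℕ.* 1                                            ≡⟨ cong (order ℕ.*_) (size-trivial m (suc j) X ¬d⁻) ⟨
      order ℕ.* sizeOf (vectors enum m) (λ a → Ann? (suc j) a X) ≡⟨ ℕ.+-identityʳ _ ⟨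
      order ℕ.* sizeOf (vectors enum m) (λ a → Ann? (suc j) a X) ℕ.+ 0 ∎
      where
      open ≡-Reasoning
      ¬d⁻ : ¬ Degenerate m (suc j) X
      ¬d⁻ (b , b≉0 , kb) = ¬d ((0# ∷ b) , (λ z → b≉0 (z ∘ suc)) , Relations.0∷-K X m j m≤j b kb)

  size-head : ∀ {N} (P : Pred (Vector Carrier (suc N)) ℓ) (P? : Decidable P) → P B.Respects _≋_ →
    sizeOf (vectors enum (suc N)) P? ≡ ∑ℕ enum (λ h → sizeOf (vectors enum N) (λ x → P? (h ∷ x)))
  size-head P P? resp = ∑ℕ-vectors-suc enum (λ x → ⟦ P? x ⟧)
    (λ x≋y → ⟦⟧-cong (P? _) (P? _) (resp x≋y) (resp (λ i → ≈-sym (x≋y i))))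

  -- The `j` equations on `x` are independent. If `head a` is nonzero, equation `0` determines the
  -- first entry from the rest, and the other equations concern only the rest. If `head a` vanishes,
  -- the first entry is free and `tail a` takes over.
  fibre-size : ∀ m j {N} → N ≡ j ℕ.+ m → (a : Vector Carrier (suc m)) → NonZeroVec a →
               sizeOf (vectors enum N) (λ x → Ann? j a (ext x)) ≡ order ^ m
  fibre-size m j N≡ a a≉0 with head a ≟ 0#
  fibre-size m zero    refl a a≉0 | no _  = sizeOf-all (vectors enum m) (λ x → Ann? 0 a (ext x)) (λ _ _ ())
  fibre-size m (suc j) refl a a≉0 | no h≉0 = begin
    sizeOf (vectors enum (suc N)) (λ x → Ann? (suc j) a (ext x))
      ≡⟨ size-head _ (λ x → Ann? (suc j) a (ext x)) (λ x≋y → Ann-respʳ a (ext-cong x≋y)) ⟩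
    ∑ℕ enum (λ h → sizeOf (vectors enum N) (λ x → Ann? (suc j) a (ext (h ∷ x))))
      ≡⟨ ΣN.∑-comm (λ i i′ → ⟦ Ann? (suc j) a (ext (Inverse.to enum i ∷ Inverse.to (vectors enum N) i′)) ⟧) ⟩
    ∑ℕ (vectors enum N) (λ x → sizeOf enum (λ h → Ann? (suc j) a (ext (h ∷ x))))
      ≡⟨ ΣN.sum-cong-≗ (λ i → column (Inverse.to (vectors enum N) i)) ⟩
    sizeOf (vectors enum N) (λ x → Ann? j a (ext x))
      ≡⟨ fibre-size m j refl a a≉0 ⟩
    order ^ m ∎
    where
    open ≡-Reasoning
    N = j ℕ.+ m
    column : ∀ x → sizeOf enum (λ h → Ann? (suc j) a (ext (h ∷ x))) ≡ ⟦ Ann? j a (ext x) ⟧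
    column x with Ann? j a (ext x) | cancelling h≉0 (pair (tail a) (ext x) 0)
    ... | yes ann | h , eq = sizeOf-unique enum (λ h → Ann? (suc j) a (ext (h ∷ x)))
      (λ h≈ → Ann-respʳ a (ext-cong (∷-cong enum h≈ (λ _ → ≈-refl))))
      h
      (λ { zero _ → first ; (suc t) (s≤s t<j) → ≈-trans (pair-suc a (ext (h ∷ x)) t) (ann t t<j) })
      (λ h′ ann′ → *-cancelˡ (head a) h≉0 (+-cancelˡ′ (pair (tail a) (ext x) 0)
        (≈-trans (+-comm _ _) (≈-trans (ann′ 0 (s≤s z≤n)) (≈-trans (≈-sym first) (+-comm _ _))))))
      where
      first : pair a (ext (h ∷ x)) 0 ≈ 0#
      first = ≈-trans (+-comm _ _) (≈-trans (+-congˡ (*-comm (head a) h)) eq)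
    ... | no ¬ann | _ = sizeOf-none enum (λ h → Ann? (suc j) a (ext (h ∷ x)))
      (λ h ann → ¬ann (λ t t<j → ≈-trans (≈-sym (pair-suc a (ext (h ∷ x)) t)) (ann (suc t) (s≤s t<j))))
  fibre-size zero    j         N≡ a a≉0 | yes h≈0 = contradiction (λ { zero → h≈0 }) a≉0
  fibre-size (suc m) j {zero}  N≡ a a≉0 | yes h≈0 with () ← trans N≡ (ℕ.+-suc j m)
  fibre-size (suc m) j {suc N} N≡ a a≉0 | yes h≈0 = begin
    sizeOf (vectors enum (suc N)) (λ x → Ann? j a (ext x))
      ≡⟨ size-head _ (λ x → Ann? j a (ext x)) (λ x≋y → Ann-respʳ a (ext-cong x≋y)) ⟩
    ∑ℕ enum (λ h → sizeOf (vectors enum N) (λ x → Ann? j a (ext (h ∷ x))))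
      ≡⟨ ΣN.sum-cong-≗ (λ i → sizeOf-cong (vectors enum N) (λ x → Ann? j a (ext (Inverse.to enum i ∷ x))) (λ x → Ann? j (tail a) (ext x))
           (λ x ann t t<j → ≈-trans (≈-sym (drop-head (Inverse.to enum i) x t)) (ann t t<j))
           (λ x ann t t<j → ≈-trans (drop-head (Inverse.to enum i) x t) (ann t t<j))) ⟩
    sumℕ {order} (λ _ → sizeOf (vectors enum N) (λ x → Ann? j (tail a) (ext x)))
      ≡⟨ sum-const order _ ⟩
    order ℕ.* sizeOf (vectors enum N) (λ x → Ann? j (tail a) (ext x))
      ≡⟨ cong (order ℕ.*_) (fibre-size m j (ℕ.suc-injective (trans N≡ (ℕ.+-suc j m))) (tail a)
           (λ t≈0 → a≉0 (λ { zero → h≈0 ; (suc i) → t≈0 i }))) ⟩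
    order ^ suc m ∎
    where
    open ≡-Reasoning
    drop-head : ∀ h x t → pair a (ext (h ∷ x)) t ≈ pair (tail a) (ext x) t
    drop-head h x t = x≈0⇒x+y≈y _ (x≈0⇒x*y≈0 _ h≈0)

  opaque
    zero? : ∀ {m} (a : Vector Carrier m) → Dec (∀ i → a i ≈ 0#)
    zero? a = Fin.all? (λ i → a i ≟ 0#)

  -- Pairs `(x , a)` counted by `a`: the zero vector admits all `order ^ N` sequences, any other
  -- `order ^ m`. The `order ^ m` added on the left lets the right side run over all `a` instead of
  -- the nonzero ones.
  size-total : ∀ m j {N} → N ≡ j ℕ.+ m →
    ∑ℕ (vectors enum N) (λ x → sizeOf (vectors enum (suc m)) (λ a → Ann? j a (ext x))) ℕ.+ order ^ m ≡
    order ^ N ℕ.+ order ^ suc m ℕ.* order ^ m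
  size-total m j {N} N≡ = begin
    ∑ℕ (vectors enum N) (λ x → sizeOf A (λ a → Ann? j a (ext x))) ℕ.+ Q
      -- The extra `Q` is placed on the zero vector, which turns the claim into a comparison for
      -- each `a`.
      ≡⟨ cong₂ ℕ._+_ (ΣN.∑-comm (λ i i′ → ⟦ Ann? j (Inverse.to A i′) (ext (Inverse.to (vectors enum N) i)) ⟧)) (sym (weighted Q)) ⟩
    ∑ℕ A f ℕ.+ ∑ℕ A (λ a → ⟦ zero? a ⟧ ℕ.* Q)
      ≡⟨ ΣN.∑-distrib-+ (f ∘ Inverse.to A) _ ⟨
    ∑ℕ A (λ a → f a ℕ.+ ⟦ zero? a ⟧ ℕ.* Q)
      ≡⟨ ΣN.sum-cong-≗ (λ i → pointwise (Inverse.to A i)) ⟩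
    ∑ℕ A (λ a → ⟦ zero? a ⟧ ℕ.* order ^ N ℕ.+ Q)
      ≡⟨ ΣN.∑-distrib-+ (λ i → ⟦ zero? (Inverse.to A i) ⟧ ℕ.* order ^ N) _ ⟩
    ∑ℕ A (λ a → ⟦ zero? a ⟧ ℕ.* order ^ N) ℕ.+ sumℕ {order ^ suc m} (λ _ → Q)
      ≡⟨ cong₂ ℕ._+_ (weighted (order ^ N)) (sum-const (order ^ suc m) Q) ⟩
    order ^ N ℕ.+ order ^ suc m ℕ.* Q ∎
    where
    open ≡-Reasoning
    A = vectors enum (suc m)
    Q = order ^ m
    f : Vector Carrier (suc m) → ℕ
    f a = sizeOf (vectors enum N) (λ x → Ann? j a (ext x))
    weighted : ∀ w → ∑ℕ A (λ a → ⟦ zero? a ⟧ ℕ.* w) ≡ w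
    weighted w = trans (sym (ΣN.*-distribʳ-sum w (λ i → ⟦ zero? (Inverse.to A i) ⟧)))
      (trans (cong (ℕ._* w) (sizeOf-unique A (zero? {suc m}) (λ a≋b a≈0 i → ≈-trans (≈-sym (a≋b i)) (a≈0 i))
        zeros (λ _ → ≈-refl) (λ a a≈0 → a≈0))) (ℕ.*-identityˡ w))
    pointwise : ∀ a → f a ℕ.+ ⟦ zero? a ⟧ ℕ.* Q ≡ ⟦ zero? a ⟧ ℕ.* order ^ N ℕ.+ Q
    pointwise a with zero? a
    ... | yes a≈0 = cong₂ ℕ._+_ (trans (sizeOf-all (vectors enum N) (λ x → Ann? j a (ext x))
        (λ x t _ → pair-zero {a = a} (ext x) t a≈0)) (sym (ℕ.*-identityˡ (order ^ N)))) (ℕ.*-identityˡ Q)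
    ... | no a≉0 = trans (ℕ.+-identityʳ (f a)) (fibre-size m j N≡ a a≉0)

  -- `size-total` with `m - 1` and `j + 1`, multiplied by `order` to clear the power
  -- `order ^ (m - 1)`. In this form it also holds for `m = 0`, where the empty vector satisfies
  -- every equation.
  size-total⁻ : ∀ m j {N} → N ≡ j ℕ.+ m →
    order ℕ.* ∑ℕ (vectors enum N) (λ x → sizeOf (vectors enum m) (λ a → Ann? (suc j) a (ext x))) ℕ.+ order ^ m ≡
    order ℕ.* order ^ N ℕ.+ order ^ m ℕ.* order ^ m
  size-total⁻ zero    j {N} N≡ = cong (λ z → order ℕ.* z ℕ.+ 1)
    (trans (ΣN.sum-cong-≗ (λ i → sizeOf-all (vectors enum 0) (λ a → Ann? (suc j) a (ext (Inverse.to (vectors enum N) i))) (λ _ _ _ → ≈-refl)))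
           (trans (sum-const (order ^ N) 1) (ℕ.*-identityʳ _)))
  size-total⁻ (suc m) j {N} N≡ = begin
    order ℕ.* B ℕ.+ order ℕ.* order ^ m  ≡⟨ ℕ.*-distribˡ-+ order B _ ⟨
    order ℕ.* (B ℕ.+ order ^ m)          ≡⟨ cong (order ℕ.*_) (size-total m (suc j) (trans N≡ (ℕ.+-suc j m))) ⟩
    order ℕ.* (order ^ N ℕ.+ order ^ suc m ℕ.* order ^ m)
      ≡⟨ ℕ.*-distribˡ-+ order (order ^ N) _ ⟩
    order ℕ.* order ^ N ℕ.+ order ℕ.* (order ^ suc m ℕ.* order ^ m)
      ≡⟨ cong (order ℕ.* order ^ N ℕ.+_) (trans (cong (order ℕ.*_) (ℕ.*-comm (order ^ suc m) (order ^ m))) (sym (ℕ.*-assoc order (order ^ m) (order ^ suc m)))) ⟩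
    order ℕ.* order ^ N ℕ.+ order ^ suc m ℕ.* order ^ suc m ∎
    where
    open ≡-Reasoning
    B = ∑ℕ (vectors enum N) (λ x → sizeOf (vectors enum (suc m)) (λ a → Ann? (suc j) a (ext x)))

  degenerate-size : ∀ {p} → order ≡ suc (suc p) → ∀ m j {N} → N ≡ j ℕ.+ m → m ≤ j →
    sizeOf (vectors enum N) (λ x → Degenerate? (suc m) j (ext x)) ≡ order ^ m ℕ.* order ^ m
  degenerate-size {p} order≡ m j {N} N≡ m≤j = arithmetic {order} {p} order≡ (size-total m j N≡) (size-total⁻ m j N≡) summed
    where
    open ≡-Reasoning
    V = vectors enum N
    summed : ∑ℕ V (λ x → sizeOf (vectors enum (suc m)) (λ a → Ann? j a (ext x))) ℕ.+ order ^ N ℕ.* suc p ≡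
             order ℕ.* ∑ℕ V (λ x → sizeOf (vectors enum m) (λ a → Ann? (suc j) a (ext x)))
               ℕ.+ sizeOf V (λ x → Degenerate? (suc m) j (ext x)) ℕ.* suc p
    summed = begin
      ∑ℕ V A ℕ.+ order ^ N ℕ.* suc p
        ≡⟨ cong (∑ℕ V A ℕ.+_) (sum-const (order ^ N) (suc p)) ⟨
      ∑ℕ V A ℕ.+ ∑ℕ V (λ _ → suc p)
        ≡⟨ ΣN.∑-distrib-+ (A ∘ Inverse.to V) _ ⟨
      ∑ℕ V (λ x → A x ℕ.+ suc p)
        ≡⟨ ΣN.sum-cong-≗ (λ i → size-relation order≡ (ext (Inverse.to V i)) m j m≤j) ⟩
      ∑ℕ V (λ x → order ℕ.* B x ℕ.+ D x ℕ.* suc p)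
        ≡⟨ ΣN.∑-distrib-+ (λ i → order ℕ.* B (Inverse.to V i)) _ ⟩
      ∑ℕ V (λ x → order ℕ.* B x) ℕ.+ ∑ℕ V (λ x → D x ℕ.* suc p)
        ≡⟨ cong₂ ℕ._+_ (ΣN.*-distribˡ-sum order (B ∘ Inverse.to V)) (ΣN.*-distribʳ-sum (suc p) (D ∘ Inverse.to V)) ⟨
      order ℕ.* ∑ℕ V B ℕ.+ ∑ℕ V D ℕ.* suc p ∎
      where
      A B D : Vector Carrier N → ℕ
      A x = sizeOf (vectors enum (suc m)) (λ a → Ann? j a (ext x))
      B x = sizeOf (vectors enum m) (λ a → Ann? (suc j) a (ext x))
      D x = ⟦ Degenerate? (suc m) j (ext x) ⟧
    -- With `T` for `q ^ N` and `Q` for `q ^ m`, the terms in `T` cancel since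
    -- `T + T (q - 1) = q T`. What remains is `G (q - 1) = Q² (q - 1)`.
    arithmetic : ∀ {q p A B G T Q} → q ≡ suc (suc p) → A ℕ.+ Q ≡ T ℕ.+ q ℕ.* Q ℕ.* Q →
      q ℕ.* B ℕ.+ Q ≡ q ℕ.* T ℕ.+ Q ℕ.* Q → A ℕ.+ T ℕ.* suc p ≡ q ℕ.* B ℕ.+ G ℕ.* suc p → G ≡ Q ℕ.* Q
    arithmetic {q} {p} {A} {B} {G} {T} {Q} refl eA eB eG = ℕ.*-cancelʳ-≡ G (Q ℕ.* Q) (suc p)
      (ℕ.+-cancelˡ-≡ (q ℕ.* T ℕ.+ Q ℕ.* Q) _ _ (begin
        q ℕ.* T ℕ.+ Q ℕ.* Q ℕ.+ G ℕ.* suc p    ≡⟨ cong (ℕ._+ G ℕ.* suc p) eB ⟨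
        q ℕ.* B ℕ.+ Q ℕ.+ G ℕ.* suc p          ≡⟨ swap (q ℕ.* B) Q (G ℕ.* suc p) ⟩
        q ℕ.* B ℕ.+ G ℕ.* suc p ℕ.+ Q          ≡⟨ cong (ℕ._+ Q) eG ⟨
        A ℕ.+ T ℕ.* suc p ℕ.+ Q                ≡⟨ swap A (T ℕ.* suc p) Q ⟩
        A ℕ.+ Q ℕ.+ T ℕ.* suc p                ≡⟨ cong (ℕ._+ T ℕ.* suc p) eA ⟩
        T ℕ.+ q ℕ.* Q ℕ.* Q ℕ.+ T ℕ.* suc p    ≡⟨ solve 3 (λ p T Q → T :+ (con 2 :+ p) :* Q :* Q :+ T :* (con 1 :+ p)
                                                    := (con 2 :+ p) :* T :+ Q :* Q :+ Q :* Q :* (con 1 :+ p)) refl p T Q ⟩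
        q ℕ.* T ℕ.+ Q ℕ.* Q ℕ.+ Q ℕ.* Q ℕ.* suc p ∎))
      where
      open +-*-Solver
      swap : ∀ a b c → a ℕ.+ b ℕ.+ c ≡ a ℕ.+ c ℕ.+ b
      swap = solve 3 (λ a b c → a :+ b :+ c := a :+ c :+ b) refl

-- Relations with entries in a subfield

-- If `y` were missed, punching it out of the codomain would inject `suc n` elements into `n`.
injective⇒surjective : ∀ {n} (f : Fin n → Fin n) → Injective _≡_ _≡_ f → ∀ y → ∃ λ x → f x ≡ y
injective⇒surjective {suc n} f f-inj y with Fin.any? (λ x → f x Fin.≟ y)
... | yes found  = found
... | no missing = contradiction
  (Fin.injective⇒≤ {f = λ x → Fin.punchOut (missed x)}
    (λ {x} {x′} e → f-inj (Fin.punchOut-injective (missed x) (missed x′) e)))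
  ℕ.1+n≰n
  where
  missed : ∀ x → ¬ (y ≡ f x)
  missed x e = missing (x , sym e)

-- This takes the place of dimension arguments: comparing cardinalities yields both the basis of the
-- field over the subfield and the inverses of matrices.
injection⇒surjection : {S : Setoid a ℓ} {T : Setoid b ℓ′} {m n : ℕ} →
  HasCardinality S m → HasCardinality T n → m ≡ n →
  (f : Setoid.Carrier S → Setoid.Carrier T) →
  (∀ {x y} → Setoid._≈_ S x y → Setoid._≈_ T (f x) (f y)) →
  (∀ {x y} → Setoid._≈_ T (f x) (f y) → Setoid._≈_ S x y) →
  ∀ y → ∃ λ x → Setoid._≈_ T (f x) y
injection⇒surjection {S = S} {T} eS eT refl f f-cong f-inj y =
  let i , e = injective⇒surjective (ET.from ∘ f ∘ ES.to)
                (λ e → trans (sym (ES.inverseʳ (S.refl)))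
                        (trans (ES.from-cong (f-inj (from-injective e))) (ES.inverseʳ S.refl)))
                (ET.from y)
  in ES.to i , from-injective e
  where
  module S = Setoid S
  module T = Setoid T
  module ES = Inverse eS
  module ET = Inverse eT
  from-injective : ∀ {x y} → ET.from x ≡ ET.from y → x T.≈ y
  from-injective e = T.trans (T.sym (ET.inverseˡ refl)) (T.trans (ET.to-cong e) (ET.inverseˡ refl))

module _ (k : FiniteField c ℓ) where
  open FiniteField k

  order≥2 : ∃ λ p → order ≡ suc (suc p)
  order≥2 = go order enum
    where
    go : ∀ n → HasCardinality setoid n → ∃ λ p → n ≡ suc (suc p)
    go 0 e = case Inverse.from e 0# of λ ()
    go 1 e = contradiction (≈-trans (≈-sym (Inverse.inverseˡ e refl))
      (≈-trans (Inverse.to-cong e (unique (Inverse.from e 0#) (Inverse.from e 1#))) (Inverse.inverseˡ e refl))) 0≉1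
      where
      unique : ∀ (i j : Fin 1) → i ≡ j
      unique zero zero = refl
    go (suc (suc p)) e = p , refl

module SubfieldBasis (k : FiniteField c ℓ) (k₀ : Subfield k p)
                     {s : ℕ} (enum₀ : HasCardinality (Subfield.subsetoid k₀) s) where
  open FiniteField k
  open Subfield k₀
  private
    module S = Setoid subsetoid

  subfield : FiniteField _ _
  subfield = record
    { commutativeRing = record
      { Carrier = S.Carrier
      ; _≈_     = S._≈_
      ; _+_     = λ (x , x∈) (y , y∈) → x + y , +-closed x∈ y∈
      ; _*_     = λ (x , x∈) (y , y∈) → x * y , *-closed x∈ y∈
      ; -_      = λ (x , x∈) → - x , -‿closed x∈
      ; 0#      = 0# , 0∈K
      ; 1#      = 1# , 1∈K
      ; isCommutativeRing = record
        { isRing = record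
          { +-isAbelianGroup = record
            { isGroup = record
              { isMonoid = record
                { isSemigroup = record
                  { isMagma = record { isEquivalence = S.isEquivalence ; ∙-cong = +-cong }
                  ; assoc = λ (x , _) (y , _) (z , _) → +-assoc x y z
                  }
                ; identity = (λ (x , _) → +-identityˡ x) , (λ (x , _) → +-identityʳ x)
                }
              ; inverse = (λ (x , _) → -‿inverseˡ x) , (λ (x , _) → -‿inverseʳ x)
              ; ⁻¹-cong = -‿cong
              }
            ; comm = λ (x , _) (y , _) → +-comm x y
            }
          ; *-cong = *-cong
          ; *-assoc = λ (x , _) (y , _) (z , _) → *-assoc x y z
          ; *-identity = (λ (x , _) → *-identityˡ x) , (λ (x , _) → *-identityʳ x)
          ; distrib = (λ (x , _) (y , _) (z , _) → distribˡ x y z) , (λ (x , _) (y , _) (z , _) → distribʳ x y z)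
          }
        ; *-comm = λ (x , _) (y , _) → *-comm x y
        }
      }
    ; 0≉1     = 0≉1
    ; inverse = λ (x , x∈) x≉0 → let y , yx≈1 , xy≈1 = inverse x x≉0 in
        (y , ⁻¹-closed x∈ xy≈1) , yx≈1 , xy≈1
    ; order   = s
    ; enum    = enum₀
    }

  open SemigroupProperties +-commutativeSemigroup using (interchange)
  module H  = Hankel k
  module H₀ = Hankel subfield
  open H using (pair; Ann; ext; NonZeroVec; Degenerate; _≟_; x≈0⇒x+y≈y; x≈0⇒x*y≈0; y≈0⇒x*y≈0; y≈0⇒x+y≈x)
  module K₀ = FiniteField subfield

  ∈K? : ∀ x → Dec (x ∈K)
  ∈K? x = map′ (λ (i , e) → ∈K-resp-≈ e (proj₂ (Inverse.to enum₀ i)))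
    (λ x∈ → Inverse.from enum₀ (x , x∈) , Inverse.inverseˡ enum₀ {x , x∈} refl)
    (Fin.any? (λ i → proj₁ (Inverse.to enum₀ i) ≟ x))

  module _ (order≡ : order ≡ s ℕ.* s) where

    -- Otherwise the field would inject into the subfield, giving `s * s ≤ s`, which fails because
    -- the subfield has at least two elements.
    outside : ∃ λ θ → ¬ (θ ∈K)
    outside with any? enum {P = λ θ → ¬ (θ ∈K)} (λ e ∉ x∈ → ∉ (∈K-resp-≈ (≈-sym e) x∈)) (¬? ∘ ∈K?)
    ... | yes found = found
    ... | no ¬found = contradiction (subst (_≤ s) order≡ (Fin.injective⇒≤ {f = f} f-injective)) s*s≰s
      where
      all∈ : ∀ x → x ∈K
      all∈ x with ∈K? x
      ... | yes x∈ = x∈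
      ... | no x∉  = contradiction (x , x∉) ¬found
      f : Fin order → Fin s
      f i = Inverse.from enum₀ (Inverse.to enum i , all∈ _)
      f-injective : Injective _≡_ _≡_ f
      f-injective e = trans (sym (Inverse.inverseʳ enum ≈-refl)) (trans (Inverse.from-cong enum
        (≈-trans (≈-sym (Inverse.inverseˡ enum₀ {_ , all∈ _} refl))
          (≈-trans (Inverse.to-cong enum₀ e) (Inverse.inverseˡ enum₀ {_ , all∈ _} refl))))
        (Inverse.inverseʳ enum ≈-refl))
      s*s≰s : ¬ (s ℕ.* s ≤ s)
      s*s≰s with order≥2 subfield
      ... | r , refl = ℕ.<⇒≱ (ℕ.m<m+n s {suc r ℕ.* s} (s≤s z≤n))

    θ : Carrier
    θ = proj₁ outside

    -- A nonzero `v` would give `θ = - u v⁻¹`, an element of the subfield.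
    independent : ∀ {u v} → u ∈K → v ∈K → θ * v + u ≈ 0# → v ≈ 0#
    independent {u} {v} u∈ v∈ e with v ≟ 0#
    ... | yes v≈0 = v≈0
    ... | no v≉0 with inverse v v≉0
    ... | w , _ , vw≈1 = contradiction
      (∈K-resp-≈ (≈-sym θ≈) (-‿closed (*-closed u∈ (⁻¹-closed v∈ vw≈1)))) (proj₂ outside)
      where
      open SetoidReasoning setoid
      θ≈ : θ ≈ - (u * w)
      θ≈ = H.+-cancelˡ′ (u * w) (begin
        u * w + θ               ≈⟨ +-congˡ (*-identityʳ θ) ⟨
        u * w + θ * 1#          ≈⟨ +-congˡ (*-congˡ vw≈1) ⟨
        u * w + θ * (v * w)     ≈⟨ +-congˡ (*-assoc θ v w) ⟨
        u * w + θ * v * w       ≈⟨ distribʳ w u (θ * v) ⟨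
        (u + θ * v) * w         ≈⟨ x≈0⇒x*y≈0 w (≈-trans (+-comm u _) e) ⟩
        0#                      ≈⟨ -‿inverseʳ (u * w) ⟨
        u * w + - (u * w)       ∎)

    -- By `independent` the map `(u , v) ↦ θ v + u` is injective on pairs from the subfield. There
    -- are `s * s` such pairs, as many as field elements, so it is surjective.
    spanning : ∀ x → ∃ λ ((u , v) : S.Carrier × S.Carrier) → θ * proj₁ v + proj₁ u ≈ x
    spanning x =
      let uv , e = injection⇒surjection (vectors enum₀ 2) enum
            (trans (cong (s ℕ.*_) (ℕ.*-identityʳ s)) (sym order≡))
            (λ w → θ * proj₁ (w (suc zero)) + proj₁ (w zero))
            (λ e → +-cong (*-congˡ (e (suc zero))) (e zero))
            (λ {w} {w′} → injective {w} {w′}) x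
      in (uv zero , uv (suc zero)) , e
      where
      open SetoidReasoning setoid
      difference : ∀ a b → b + (a + - b) ≈ a
      difference a b = ≈-trans (≈-sym (+-assoc b a (- b))) (≈-trans (+-congʳ (+-comm b a))
        (≈-trans (+-assoc a b (- b)) (y≈0⇒x+y≈x a (-‿inverseʳ b))))
      injective : ∀ {w w′ : Vector S.Carrier 2} →
        θ * proj₁ (w (suc zero)) + proj₁ (w zero) ≈ θ * proj₁ (w′ (suc zero)) + proj₁ (w′ zero) →
        ∀ i → w i S.≈ w′ i
      injective {w} {w′} e = λ { zero → u≈u′ ; (suc zero) → v≈v′ }
        where
        u = proj₁ (w zero) ; v = proj₁ (w (suc zero))
        u′ = proj₁ (w′ zero) ; v′ = proj₁ (w′ (suc zero))
        v≈v′ : v ≈ v′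
        v≈v′ = begin
          v              ≈⟨ difference v v′ ⟨
          v′ + (v + - v′) ≈⟨ y≈0⇒x+y≈x v′ (independent
                             (+-closed (proj₂ (w zero)) (-‿closed (proj₂ (w′ zero))))
                             (+-closed (proj₂ (w (suc zero))) (-‿closed (proj₂ (w′ (suc zero)))))
                             (H.+-cancelˡ′ (θ * v′ + u′) (begin
            θ * v′ + u′ + (θ * (v + - v′) + (u + - u′))   ≈⟨ interchange (θ * v′) u′ (θ * (v + - v′)) (u + - u′) ⟩
            θ * v′ + θ * (v + - v′) + (u′ + (u + - u′))   ≈⟨ +-cong (≈-sym (distribˡ θ v′ (v + - v′))) (difference u u′) ⟩
            θ * (v′ + (v + - v′)) + u                     ≈⟨ +-congʳ (*-congˡ (difference v v′)) ⟩
            θ * v + u                                     ≈⟨ e ⟩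
            θ * v′ + u′                                   ≈⟨ +-identityʳ _ ⟨
            θ * v′ + u′ + 0#                              ∎))) ⟩
          v′             ∎
        u≈u′ : u ≈ u′
        u≈u′ = H.+-cancelˡ′ (θ * v) (≈-trans e (+-congʳ (*-congˡ (≈-sym v≈v′))))

    proj-sum : ∀ {n} (f : Vector S.Carrier n) → proj₁ (H₀.ΣF.sum f) ≡ H.ΣF.sum (proj₁ ∘ f)
    proj-sum {zero}  f = refl
    proj-sum {suc n} f = cong (λ z → proj₁ (f zero) + z) (proj-sum (f ∘ suc))

    proj-pair : ∀ {n} (a : Vector S.Carrier n) X t → proj₁ (H₀.pair a X t) ≡ pair (proj₁ ∘ a) (proj₁ ∘ X) t
    proj-pair a X t = proj-sum (λ i → a i K₀.* X (toℕ i ℕ.+ t))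

    proj-ext : ∀ {N} (y : Vector S.Carrier N) i → proj₁ (H₀.ext y i) ≡ ext (proj₁ ∘ y) i
    proj-ext {zero}  y i       = refl
    proj-ext {suc N} y zero    = refl
    proj-ext {suc N} y (suc i) = proj-ext (tail y) i

    module _ {m j} (X : ℕ → S.Carrier) (a : Vector Carrier m) (ann : Ann j a (proj₁ ∘ X)) where

      u v : Vector S.Carrier m
      u i = proj₁ (proj₁ (spanning (a i)))
      v i = proj₂ (proj₁ (spanning (a i)))

      combined : ∀ t → t < j → θ * proj₁ (H₀.pair v X t) + proj₁ (H₀.pair u X t) ≈ 0#
      combined t t<j = begin
        θ * proj₁ (H₀.pair v X t) + proj₁ (H₀.pair u X t)
          ≈⟨ +-cong (*-congˡ (H.≈-reflexive (proj-pair v X t))) (H.≈-reflexive (proj-pair u X t)) ⟩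
        θ * pair (proj₁ ∘ v) (proj₁ ∘ X) t + pair (proj₁ ∘ u) (proj₁ ∘ X) t
          ≈⟨ H.pair-linear θ (proj₁ ∘ v) (proj₁ ∘ u) (proj₁ ∘ X) t ⟨
        pair (λ i → θ * proj₁ (v i) + proj₁ (u i)) (proj₁ ∘ X) t
          ≈⟨ H.pair-cong (proj₁ ∘ X) (proj₁ ∘ X) t (λ i → proj₂ (spanning (a i))) (λ _ → ≈-refl) ⟩
        pair a (proj₁ ∘ X) t
          ≈⟨ ann t t<j ⟩
        0# ∎
        where open SetoidReasoning setoid

      v-ann : H₀.Ann j v X
      v-ann t t<j = independent (proj₂ (H₀.pair u X t)) (proj₂ (H₀.pair v X t)) (combined t t<j)

      u-ann : H₀.Ann j u X
      u-ann t t<j = ≈-trans (≈-sym (x≈0⇒x+y≈y _ (y≈0⇒x*y≈0 θ (v-ann t t<j)))) (combined t t<j)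

      -- Both components of `a` are relations. If `v` vanishes then `a` equals `u`, so one of the
      -- two is nonzero.
      descend-relation : NonZeroVec a → H₀.Degenerate m j X
      descend-relation a≉0 with H₀.zero? v
      ... | no v≉0  = v , v≉0 , v-ann
      ... | yes v≈0 = u , (λ u≈0 → a≉0 (λ i → ≈-trans (≈-sym (proj₂ (spanning (a i))))
        (≈-trans (x≈0⇒x+y≈y _ (y≈0⇒x*y≈0 θ (v≈0 i))) (u≈0 i)))) , u-ann

    pair-scale : ∀ {m} c (a : Vector Carrier m) X t → pair a (λ i → c * X i) t ≈ c * pair a X t
    pair-scale c a X t = ≈-trans (H.ΣF.sum-cong-≋ (λ i → ≈-trans (≈-sym (*-assoc (a i) c (Z i)))
      (≈-trans (*-congʳ (*-comm (a i) c)) (*-assoc c (a i) (Z i)))))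
      (≈-sym (H.ΣF.*-distribˡ-sum c (λ i → a i * Z i)))
      where
      Z : Fin _ → Carrier
      Z i = X (toℕ i ℕ.+ t)

    module _ (c : Carrier) (c≉0 : c ≉ 0#) where

      scale : ∀ {N} → Vector S.Carrier N → Vector Carrier N
      scale y i = c * proj₁ (y i)

      ext-scale : ∀ {N} (y : Vector S.Carrier N) i → ext (scale y) i ≈ c * proj₁ (H₀.ext y i)
      ext-scale {zero}  y i       = ≈-sym (zeroʳ c)
      ext-scale {suc N} y zero    = ≈-refl
      ext-scale {suc N} y (suc i) = ext-scale (tail y) i

      pair-ext-scale : ∀ {m N} (a : Vector Carrier m) (y : Vector S.Carrier N) t →
        pair a (ext (scale y)) t ≈ c * pair a (proj₁ ∘ H₀.ext y) t
      pair-ext-scale a y t = ≈-trans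
        (H.pair-cong (ext (scale y)) (λ i → c * proj₁ (H₀.ext y i)) t (λ i → ≈-refl {a i}) (ext-scale y))
        (pair-scale c a (proj₁ ∘ H₀.ext y) t)

      degenerate-scale : ∀ m j {N} (y : Vector S.Carrier N) →
        H₀.Degenerate m j (H₀.ext y) → Degenerate m j (ext (scale y))
      degenerate-scale m j y (a , a≉0 , ann) = proj₁ ∘ a , a≉0 , λ t t<j →
        ≈-trans (pair-ext-scale (proj₁ ∘ a) y t)
          (y≈0⇒x*y≈0 c (≈-trans (≈-sym (H.≈-reflexive (proj-pair a (H₀.ext y) t))) (ann t t<j)))

      degenerate-unscale : ∀ m j {N} (y : Vector S.Carrier N) →
        Degenerate m j (ext (scale y)) → H₀.Degenerate m j (H₀.ext y)
      degenerate-unscale m j y (a , a≉0 , ann) = descend-relation (H₀.ext y) a (λ t t<j →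
        H.xy≈0⇒y≈0 c≉0 (≈-trans (≈-sym (pair-ext-scale a y t)) (ann t t<j))) a≉0

      -- `scale` is a bijection from sequences over the subfield to sequences in its multiple by
      -- `c`, and a common nonzero factor does not change the relations. The event `E` is abstract
      -- so that membership in `H` and singularity are both instances.
      degenerate-size-cK : ∀ m j {N} → N ≡ j ℕ.+ m → m ≤ j →
        {E : Pred (Vector Carrier N) ℓ′} (E? : Decidable E) →
        (∀ x → E x → Degenerate (suc m) j (ext x)) → (∀ x → Degenerate (suc m) j (ext x) → E x) →
        (all? : Decidable (λ x → ∀ (i : Fin N) → _∈cK k k₀ enum₀ c (x i))) →
        sizeOf (vectors enum N) (λ x → all? x ×-dec E? x) ≡ s ^ m ℕ.* s ^ m
      degenerate-size-cK m j {N} N≡ m≤j {E} E? E⇒ ⇒E all? = begin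
        sizeOf (vectors enum N) (λ x → all? x ×-dec E? x)
          ≡⟨ sizeOf-bijection (vectors enum N) (vectors enum₀ N)
               {P = λ x → (∀ i → _∈cK k k₀ enum₀ c (x i)) × E x} {Q = λ y → H₀.Degenerate (suc m) j (H₀.ext y)}
               (λ x → all? x ×-dec E? x) (λ y → H₀.Degenerate? (suc m) j (H₀.ext y))
               (λ {x} {x′} x≋x′ (x∈ , e) →
                 (λ i → let z , z∈ , e = x∈ i in z , z∈ , ≈-trans (≈-sym (x≋x′ i)) e)
                 , ⇒E x′ (Degenerate-resp (H.ext-cong x≋x′) (E⇒ x e)))
               (λ {y} {y′} y≋y′ (a , a≉0 , ann) → a , a≉0 , H₀.Ann-respʳ a {H₀.ext y} {H₀.ext y′} (H₀.ext-cong y≋y′) ann)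
               scale (λ y≋y′ i → *-congˡ (y≋y′ i))
               (λ y d → (λ i → proj₁ (y i) , proj₂ (y i) , ≈-refl) , ⇒E _ (degenerate-scale (suc m) j y d))
               (λ y y′ _ _ e i → H.*-cancelˡ c c≉0 (e i))
               (λ x (x∈ , e) → let y = λ i → proj₁ (x∈ i) , proj₁ (proj₂ (x∈ i))
                                   scale≋ = λ i → ≈-sym (proj₂ (proj₂ (x∈ i)))
                 in y , degenerate-unscale (suc m) j y
                        (Degenerate-resp (H.ext-cong (λ i → proj₂ (proj₂ (x∈ i)))) (E⇒ x e)) , scale≋) ⟩
        sizeOf (vectors enum₀ N) (λ y → H₀.Degenerate? (suc m) j (H₀.ext y))
          ≡⟨ H₀.degenerate-size (proj₂ (order≥2 subfield)) m j N≡ m≤j ⟩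
        s ^ m ℕ.* s ^ m ∎
        where
        open ≡-Reasoning
        Degenerate-resp : ∀ {X Y} → (∀ i → X i ≈ Y i) → Degenerate (suc m) j X → Degenerate (suc m) j Y
        Degenerate-resp X≈Y (a , a≉0 , ann) = a , a≉0 , H.Ann-respʳ a X≈Y ann

-- Hankel matrices and probabilities

module HankelMatrix (k : FiniteField c ℓ) where
  open FiniteField k hiding (sum; sum-cong-≋)
  open Hankel k
  open ΣF using (sum)
  open Algebra.Definitions using (Invertible)

  ext-fromℕ< : ∀ {N} (x : Vector Carrier N) {i} (i<N : i < N) → x (fromℕ< i<N) ≡ ext x i
  ext-fromℕ< x i<N = trans (sym (ext-toℕ x (fromℕ< i<N))) (cong (ext x) (Fin.toℕ-fromℕ< i<N))

  module _ (m n : ℕ) (h : 2 ℕ.* m ≤ suc n) (x : Vector Carrier (suc n)) where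

    relation-pair : ∀ a (t : Fin (suc (n ∸ m))) → sum (λ i → a i * shifted k m n h x t i) ≈ pair a (ext x) (toℕ t)
    relation-pair a t = ΣF.sum-cong-≋ {suc m} {λ i → a i * shifted k m n h x t i}
      (λ i → *-congˡ {a i} (≈-reflexive (ext-fromℕ< x (s≤s (i+j≤n k m n h i t)))))

    H⇒Degenerate : H k m n h x → Degenerate (suc m) (suc (n ∸ m)) (ext x)
    H⇒Degenerate (a , a≉0 , rel) = a , a≉0 , λ t t<j →
      subst (λ u → pair a (ext x) u ≈ 0#) (Fin.toℕ-fromℕ< t<j)
        (≈-trans (≈-sym (relation-pair a (fromℕ< t<j))) (rel (fromℕ< t<j)))

    Degenerate⇒H : Degenerate (suc m) (suc (n ∸ m)) (ext x) → H k m n h x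
    Degenerate⇒H (a , a≉0 , ann) = a , a≉0 , λ t → ≈-trans (relation-pair a t) (ann (toℕ t) (Fin.toℕ<n t))

  -- Row vectors, kernels and invertible matrices

  infixl 7 _*ᵛ_
  -- The rows of `M *ᴹ N` are `M i *ᵛ N` by definition, so matrix identities can be checked row by
  -- row.
  _*ᵛ_ : ∀ {n} → Vector Carrier n → Matrix k n → Vector Carrier n
  (v *ᵛ M) j = sum (λ l → v l * M l j)

  *ᵛ-congˡ : ∀ {n} {v w : Vector Carrier n} (M : Matrix k n) → (∀ i → v i ≈ w i) → ∀ j → (v *ᵛ M) j ≈ (w *ᵛ M) j
  *ᵛ-congˡ M v≋w j = ΣF.sum-cong-≋ (λ l → *-congʳ {M l j} (v≋w l))

  *ᵛ-congʳ : ∀ {n} (v : Vector Carrier n) {M N : Matrix k n} → (∀ i j → M i j ≈ N i j) →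
             ∀ j → (v *ᵛ M) j ≈ (v *ᵛ N) j
  *ᵛ-congʳ v M≈N j = ΣF.sum-cong-≋ (λ l → *-congˡ {v l} (M≈N l j))

  *ᵛ-assoc : ∀ {n} (v : Vector Carrier n) (M N : Matrix k n) j → (v *ᵛ M *ᵛ N) j ≈ (v *ᵛ (λ i → M i *ᵛ N)) j
  *ᵛ-assoc v M N j = begin
    sum (λ l → sum (λ i → v i * M i l) * N l j)
      ≈⟨ ΣF.sum-cong-≋ (λ l → ΣF.*-distribʳ-sum (N l j) (λ i → v i * M i l)) ⟩
    sum (λ l → sum (λ i → v i * M i l * N l j))
      ≈⟨ ΣF.∑-comm (λ l i → v i * M i l * N l j) ⟩
    sum (λ i → sum (λ l → v i * M i l * N l j))
      ≈⟨ ΣF.sum-cong-≋ (λ i → ΣF.sum-cong-≋ (λ l → *-assoc (v i) (M i l) (N l j))) ⟩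
    sum (λ i → sum (λ l → v i * (M i l * N l j)))
      ≈⟨ ΣF.sum-cong-≋ (λ i → ΣF.*-distribˡ-sum (v i) (λ l → M i l * N l j)) ⟨
    sum (λ i → v i * sum (λ l → M i l * N l j)) ∎
    where open SetoidReasoning setoid

  1ᴹ-suc : ∀ {n} (i j : Fin n) → 1ᴹ k (suc i) (suc j) ≡ 1ᴹ k i j
  1ᴹ-suc i j with i Fin.≟ j
  ... | yes _ = refl
  ... | no _  = refl

  *ᵛ-identityʳ : ∀ {n} (v : Vector Carrier n) j → (v *ᵛ 1ᴹ k) j ≈ v j
  *ᵛ-identityʳ v zero    = ≈-trans (+-cong (*-identityʳ (v zero)) (sum-zero (λ l → zeroʳ (v (suc l))))) (+-identityʳ _)
  *ᵛ-identityʳ v (suc j) = ≈-trans (x≈0⇒x+y≈y _ (zeroʳ (v zero)))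
    (≈-trans (ΣF.sum-cong-≋ (λ l → *-congˡ {v (suc l)} (≈-reflexive (1ᴹ-suc l j)))) (*ᵛ-identityʳ (v ∘ suc) j))

  *ᵛ-identityˡ : ∀ {n} (M : Matrix k n) i j → (1ᴹ k i *ᵛ M) j ≈ M i j
  *ᵛ-identityˡ M i j = ≈-trans (ΣF.sum-cong-≋ (λ l → ≈-trans (*-comm _ _) (*-congˡ {M l j} (≈-reflexive (symmetric l)))))
    (*ᵛ-identityʳ (λ l → M l j) i)
    where
    symmetric : ∀ l → 1ᴹ k i l ≡ 1ᴹ k l i
    symmetric l with i Fin.≟ l | l Fin.≟ i
    ... | yes _   | yes _   = refl
    ... | no _    | no _    = refl
    ... | yes i≡l | no l≢i  = contradiction (sym i≡l) l≢i
    ... | no i≢l  | yes l≡i = contradiction (sym l≡i) i≢l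

  *ᵛ-zero : ∀ {n} {v : Vector Carrier n} (M : Matrix k n) → (∀ i → v i ≈ 0#) → ∀ j → (v *ᵛ M) j ≈ 0#
  *ᵛ-zero M v≈0 j = sum-zero (λ l → x≈0⇒x*y≈0 (M l j) (v≈0 l))

  minus-one : ∀ x → - 1# * x + x ≈ 0#
  minus-one x = ≈-trans (+-congˡ (≈-sym (*-identityˡ x)))
    (≈-trans (≈-sym (distribʳ x (- 1#) 1#)) (x≈0⇒x*y≈0 x (-‿inverseˡ 1#)))

  module _ {n} (M : Matrix k n) where

    LeftKernel : Set _
    LeftKernel = ∃ λ v → NonZeroVec v × (∀ j → (v *ᵛ M) j ≈ 0#)

    kernel⇒singular : LeftKernel → Singular k M
    kernel⇒singular (v , v≉0 , vM≈0) (N , _ , MN≈1) = v≉0 (λ j → begin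
      v j                       ≈⟨ *ᵛ-identityʳ v j ⟨
      (v *ᵛ 1ᴹ k) j             ≈⟨ *ᵛ-congʳ v MN≈1 j ⟨
      (v *ᵛ (λ i → M i *ᵛ N)) j ≈⟨ *ᵛ-assoc v M N j ⟨
      (v *ᵛ M *ᵛ N) j           ≈⟨ *ᵛ-zero N vM≈0 j ⟩
      0#                        ∎)
      where open SetoidReasoning setoid

    -- Without a left kernel `v ↦ v M` is injective, hence surjective on a finite set, and preimages
    -- of the unit rows form a left inverse `N`. It is also a right inverse:
    -- `(M N) M = M (N M) = M = 1 M`, and `M` cancels on the right by injectivity.
    no-kernel⇒invertible : ¬ LeftKernel → ¬ Singular k M
    no-kernel⇒invertible ¬ker singular = singular (N , NM≈1 , MN≈1)
      where
      open SetoidReasoning setoid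
      *ᵛ-injective : ∀ {v w : Vector Carrier n} → (∀ j → (v *ᵛ M) j ≈ (w *ᵛ M) j) → ∀ i → v i ≈ w i
      *ᵛ-injective {v} {w} e with zero? (λ i → - 1# * w i + v i)
      ... | no d≉0  = contradiction (_ , d≉0 , kernel) ¬ker
        where
        kernel : ∀ j → ((λ i → - 1# * w i + v i) *ᵛ M) j ≈ 0#
        kernel j = begin
          sum (λ l → (- 1# * w l + v l) * M l j)
            ≈⟨ ΣF.sum-cong-≋ (λ l → ≈-trans (distribʳ (M l j) (- 1# * w l) (v l)) (+-congʳ (*-assoc (- 1#) (w l) (M l j)))) ⟩
          sum (λ l → - 1# * (w l * M l j) + v l * M l j)
            ≈⟨ ΣF.∑-distrib-+ (λ l → - 1# * (w l * M l j)) _ ⟩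
          sum (λ l → - 1# * (w l * M l j)) + (v *ᵛ M) j
            ≈⟨ +-cong (≈-sym (ΣF.*-distribˡ-sum (- 1#) (λ l → w l * M l j))) (e j) ⟩
          - 1# * (w *ᵛ M) j + (w *ᵛ M) j
            ≈⟨ minus-one ((w *ᵛ M) j) ⟩
          0# ∎
      ... | yes d≈0 = λ i → +-cancelˡ′ (- 1# * w i) (≈-trans (d≈0 i) (≈-sym (minus-one (w i))))
      row : ∀ i → ∃ λ v → ∀ j → (v *ᵛ M) j ≈ 1ᴹ k i j
      row i = injection⇒surjection (vectors enum n) (vectors enum n) refl (_*ᵛ M)
        (*ᵛ-congˡ M) *ᵛ-injective (1ᴹ k i)
      N : Matrix k n
      N i = proj₁ (row i)
      NM≈1 : ∀ i j → (N i *ᵛ M) j ≈ 1ᴹ k i j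
      NM≈1 i = proj₂ (row i)
      MN≈1 : ∀ i j → (M i *ᵛ N) j ≈ 1ᴹ k i j
      MN≈1 i = *ᵛ-injective (λ j → begin
        (M i *ᵛ N *ᵛ M) j             ≈⟨ *ᵛ-assoc (M i) N M j ⟩
        (M i *ᵛ (λ l → N l *ᵛ M)) j   ≈⟨ *ᵛ-congʳ (M i) NM≈1 j ⟩
        (M i *ᵛ 1ᴹ k) j               ≈⟨ *ᵛ-identityʳ (M i) j ⟩
        M i j                         ≈⟨ *ᵛ-identityˡ M i j ⟨
        (1ᴹ k i *ᵛ M) j               ∎)

  module _ (m : ℕ) (x : Vector Carrier (suc (2 ℕ.* m))) where

    hankel-pair : ∀ a (j : Fin (suc m)) → (a *ᵛ hankel k m x) j ≈ pair a (ext x) (toℕ j)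
    hankel-pair a j = ΣF.sum-cong-≋ {suc m} {λ i → a i * hankel k m x i j}
      (λ i → *-congˡ {a i} (≈-reflexive (ext-fromℕ< x (s≤s (ℕ.+-mono-≤ (Fin.toℕ≤pred[n] i)
        (ℕ.≤-trans (Fin.toℕ≤pred[n] j) (ℕ.m≤m+n m 0)))))))

    Degenerate⇒Singular : Degenerate (suc m) (suc m) (ext x) → Singular k (hankel k m x)
    Degenerate⇒Singular (a , a≉0 , ann) = kernel⇒singular (hankel k m x)
      (a , a≉0 , λ j → ≈-trans (hankel-pair a j) (ann (toℕ j) (Fin.toℕ<n j)))

    Singular⇒Degenerate : Singular k (hankel k m x) → Degenerate (suc m) (suc m) (ext x)
    -- Singularity is a negation and provides no kernel vector; deciding `Degenerate` does.
    Singular⇒Degenerate singular with Degenerate? (suc m) (suc m) (ext x)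
    ... | yes d = d
    ... | no ¬d = contradiction singular (no-kernel⇒invertible (hankel k m x) (λ (a , a≉0 , aM≈0) →
      ¬d (a , a≉0 , λ t t<j → subst (λ u → pair a (ext x) u ≈ 0#) (Fin.toℕ-fromℕ< t<j)
        (≈-trans (≈-sym (hankel-pair a (fromℕ< t<j))) (aM≈0 (fromℕ< t<j))))))

-- Powers and reciprocals of rationals

open UniformTotal using (indicatorℝ; indicatorℕ; sum-indicator; n*1/n)

infixr 8 _^ℚ_
_^ℚ_ : ℚ → ℕ → ℚ
r ^ℚ zero  = 1ℚ
r ^ℚ suc n = r ℚ.* r ^ℚ n

^ℚ-+ : ∀ r m n → r ^ℚ (m ℕ.+ n) ≡ r ^ℚ m ℚ.* r ^ℚ n
^ℚ-+ r zero    n = sym (ℚ.*-identityˡ _)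
^ℚ-+ r (suc m) n = trans (cong (r ℚ.*_) (^ℚ-+ r m n)) (sym (ℚ.*-assoc r _ _))

*-/1 : ∀ m n → + (m ℕ.* n) ℚ./ 1 ≡ (+ m ℚ./ 1) ℚ.* (+ n ℚ./ 1)
*-/1 m n = ℚ.toℚᵘ-injective (ℚᵘ.≃-trans (ℚ.toℚᵘ-fromℚᵘ (mkℚᵘ (+ (m ℕ.* n)) 0))
  (ℚᵘ.≃-sym (ℚᵘ.≃-trans (ℚ.toℚᵘ-homo-* (+ m ℚ./ 1) (+ n ℚ./ 1))
    (ℚᵘ.≃-trans (ℚᵘ.*-cong (ℚ.toℚᵘ-fromℚᵘ (mkℚᵘ (+ m) 0)) (ℚ.toℚᵘ-fromℚᵘ (mkℚᵘ (+ n) 0)))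
      (*≡* (cong (ℤ._* + 1) (sym (ℤ.pos-* m n))))))))

^-/1 : ∀ s n → + (s ^ n) ℚ./ 1 ≡ (+ s ℚ./ 1) ^ℚ n
^-/1 s zero    = refl
^-/1 s (suc n) = trans (*-/1 s (s ^ n)) (cong ((+ s ℚ./ 1) ℚ.*_) (^-/1 s n))

^ℚ-inverse : ∀ {r t} → r ℚ.* t ≡ 1ℚ → ∀ n → r ^ℚ n ℚ.* t ^ℚ n ≡ 1ℚ
^ℚ-inverse rt≡1 zero    = refl
^ℚ-inverse {r} {t} rt≡1 (suc n) = begin
  r ℚ.* r ^ℚ n ℚ.* (t ℚ.* t ^ℚ n)
    ≡⟨ solve 4 (λ r a t b → r :* a :* (t :* b) := (r :* t) :* (a :* b)) refl r (r ^ℚ n) t (t ^ℚ n) ⟩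
  r ℚ.* t ℚ.* (r ^ℚ n ℚ.* t ^ℚ n)   ≡⟨ cong₂ ℚ._*_ rt≡1 (^ℚ-inverse rt≡1 n) ⟩
  1ℚ ∎
  where
  open ≡-Reasoning
  open ℚSolver.+-*-Solver

inverse-unique : ∀ {r t u} → r ℚ.* t ≡ 1ℚ → r ℚ.* u ≡ 1ℚ → t ≡ u
inverse-unique {r} {t} {u} rt≡1 ru≡1 = begin
  t                 ≡⟨ ℚ.*-identityʳ t ⟨
  t ℚ.* 1ℚ          ≡⟨ cong (t ℚ.*_) ru≡1 ⟨
  t ℚ.* (r ℚ.* u)   ≡⟨ solve 3 (λ r t u → t :* (r :* u) := r :* t :* u) refl r t u ⟩
  r ℚ.* t ℚ.* u     ≡⟨ cong (ℚ._* u) rt≡1 ⟩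
  1ℚ ℚ.* u          ≡⟨ ℚ.*-identityˡ u ⟩
  u                 ∎
  where
  open ≡-Reasoning
  open ℚSolver.+-*-Solver

-- Addition, negation and multiplication of reals act termwise, so identities between rationals
-- transfer to reals through this.
≗⇒≃ : ∀ {x y} → (∀ n → seq x n ≡ seq y n) → x ≃ y
≗⇒≃ {x} {y} x≗y = mk≃ λ ε 0<ε → 0 , λ n _ →
  subst (λ z → ℚ.∣ z ∣ ℚ.< ε) (sym (trans (cong (ℚ._- seq y n) (x≗y n)) (ℚ.+-inverseʳ (seq y n)))) 0<ε

seq-sum-cong : ∀ {n} {f g : Vector ℝ n} M → (∀ i → seq (f i) M ≡ seq (g i) M) → seq (sumℝ f) M ≡ seq (sumℝ g) M
seq-sum-cong {zero}  M e = refl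
seq-sum-cong {suc n} M e = cong₂ ℚ._+_ (e zero) (seq-sum-cong M (e ∘ suc))

-- The first factor is the number of favourable sequences, the second the weight of each, with
-- length `e + 2m`.
cancel-powers : ∀ s → 1 ≤ s → ∀ m e →
  (+ (s ^ m ℕ.* s ^ m) ℚ./ 1) ℚ.* 1/ℕ s ^ℚ (e ℕ.+ (m ℕ.+ m)) ≡ 1/ℕ (s ^ e)
cancel-powers s 1≤s m e = begin
  (+ (s ^ m ℕ.* s ^ m) ℚ./ 1) ℚ.* r ^ℚ (e ℕ.+ (m ℕ.+ m))
    ≡⟨ cong₂ ℚ._*_ (trans (*-/1 (s ^ m) (s ^ m)) (cong₂ ℚ._*_ (^-/1 s m) (^-/1 s m)))
                   (trans (^ℚ-+ r e (m ℕ.+ m)) (cong (r ^ℚ e ℚ.*_) (^ℚ-+ r m m))) ⟩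
  S ^ℚ m ℚ.* S ^ℚ m ℚ.* (r ^ℚ e ℚ.* (r ^ℚ m ℚ.* r ^ℚ m))
    ≡⟨ solve 3 (λ a b c → a :* a :* (c :* (b :* b)) := (a :* b) :* (a :* b) :* c) refl (S ^ℚ m) (r ^ℚ m) (r ^ℚ e) ⟩
  S ^ℚ m ℚ.* r ^ℚ m ℚ.* (S ^ℚ m ℚ.* r ^ℚ m) ℚ.* r ^ℚ e
    ≡⟨ cong (λ z → z ℚ.* z ℚ.* r ^ℚ e) (^ℚ-inverse {S} {r} Sr≡1 m) ⟩
  1ℚ ℚ.* 1ℚ ℚ.* r ^ℚ e
    ≡⟨ ℚ.*-identityˡ (r ^ℚ e) ⟩
  r ^ℚ e
    ≡⟨ inverse-unique {S ^ℚ e} (^ℚ-inverse {S} {r} Sr≡1 e)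
         (trans (cong (ℚ._* 1/ℕ (s ^ e)) (sym (^-/1 s e))) (n*1/n (s ^ e) (s^e≥1 e))) ⟩
  1/ℕ (s ^ e) ∎
  where
  open ≡-Reasoning
  open ℚSolver.+-*-Solver
  S = + s ℚ./ 1
  r = 1/ℕ s
  Sr≡1 : S ℚ.* r ≡ 1ℚ
  Sr≡1 = n*1/n s 1≤s
  s^e≥1 : ∀ e → 1 ≤ s ^ e
  s^e≥1 zero    = ℕ.≤-refl
  s^e≥1 (suc e) = ℕ.*-mono-≤ 1≤s (s^e≥1 e)

-- Independent draws from the uniform distribution on `c k₀`

module Probability (k : FiniteField c ℓ) (k₀ : Subfield k p)
                   {s : ℕ} (order≡ : FiniteField.order k ≡ s ℕ.* s)
                   (enum₀ : HasCardinality (Subfield.subsetoid k₀) s)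
                   (c : FiniteField.Carrier k) (c≉0 : ¬ FiniteField._≈_ k c (FiniteField.0# k)) where
  open FiniteField k
  open SubfieldBasis k k₀ enum₀
  private
    μ = uniformOn-cK k k₀ enum₀ c
    _∈C? = _∈cK? k k₀ enum₀ c
    _∈C = _∈cK k k₀ enum₀ c

  s≥1 : 1 ≤ s
  s≥1 with order≥2 subfield
  ... | _ , refl = s≤s z≤n

  size-cK : sizeOf enum _∈C? ≡ s
  size-cK = trans (sizeOf-bijection enum enum₀ {P = _∈C} {Q = λ _ → ⊤} _∈C? (λ _ → yes tt)
      (λ x≈x′ (y , y∈ , e) → y , y∈ , ≈-trans (≈-sym x≈x′) e) (λ _ _ → tt)
      (λ y → c * proj₁ y) *-congˡ
      (λ y _ → proj₁ y , proj₂ y , ≈-refl) (λ _ _ _ _ → H.*-cancelˡ c c≉0)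
      (λ x (y , y∈ , e) → (y , y∈) , tt , ≈-sym e))
    (sizeOf-all enum₀ (λ _ → yes tt) (λ _ → tt))

  open Distribution μ using (prob)

  private
    -- `prob x` is `indicator (x ∈C?)` by definition; with the decision as an argument, a case
    -- distinction on it reduces both sides.
    indicator : ∀ {P : Set ℓ′} → Dec P → ℝ
    indicator d = if does d then recip (sizeOf enum _∈C?) else 0ℝ

  prob-∈ : ∀ x M → x ∈C → seq (prob x) M ≡ 1/ℕ s
  prob-∈ x M x∈ = go (x ∈C?)
    where
    go : (d : Dec (x ∈C)) → seq (indicator d) M ≡ 1/ℕ s
    go (yes _) = cong 1/ℕ size-cK
    go (no x∉) = contradiction x∈ x∉

  prob-∉ : ∀ x M → ¬ (x ∈C) → seq (prob x) M ≡ 0ℚ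
  prob-∉ x M x∉ = go (x ∈C?)
    where
    go : (d : Dec (x ∈C)) → seq (indicator d) M ≡ 0ℚ
    go (yes x∈) = contradiction x∈ x∉
    go (no _)   = refl

  product-const : ∀ {N} (f : Vector ℝ N) r M → (∀ i → seq (f i) M ≡ r) → seq (productℝ f) M ≡ r ^ℚ N
  product-const {zero}  f r M e = refl
  product-const {suc N} f r M e = cong₂ ℚ._*_ (e zero) (product-const (f ∘ suc) r M (e ∘ suc))

  product-zero : ∀ {N} (f : Vector ℝ N) M i → seq (f i) M ≡ 0ℚ → seq (productℝ f) M ≡ 0ℚ
  product-zero f M zero    e = trans (cong (ℚ._* seq (productℝ (f ∘ suc)) M) e) (ℚ.*-zeroˡ (seq (productℝ (f ∘ suc)) M))
  product-zero f M (suc i) e = trans (cong (seq (f zero) M ℚ.*_) (product-zero (f ∘ suc) M i e)) (ℚ.*-zeroʳ (seq (f zero) M))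

  all∈? : ∀ {N} (x : Vector Carrier N) → Dec (∀ i → x i ∈C)
  all∈? x = Fin.all? (λ i → x i ∈C?)

  seq-product : ∀ {N} (x : Vector Carrier N) M (d : Dec (∀ i → x i ∈C)) →
                seq (productℝ (λ i → prob (x i))) M ≡ seq (indicatorℝ (does d) (1/ℕ s ^ℚ N)) M
  seq-product x M (yes x∈) = product-const (λ i → prob (x i)) (1/ℕ s) M (λ i → prob-∈ (x i) M (x∈ i))
  seq-product x M (no ¬x∈) = let i , x∉ = Fin.¬∀⟶∃¬ _ (λ i → x i ∈C) (λ i → x i ∈C?) ¬x∈ in
    product-zero (λ i → prob (x i)) M i (prob-∉ (x i) M x∉)

  -- Every real involved is a constant sequence, so the probability is evaluated exactly at each
  -- index `M`. The length `N` is split twice: as `j + m` for the count and as `e + 2m` for the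
  -- exponent that survives.
  Pr-degenerate : ∀ m j e {N} → N ≡ j ℕ.+ m → m ≤ j → N ≡ e ℕ.+ (m ℕ.+ m) →
    {E : Pred (Vector Carrier N) ℓ′} (E? : Decidable E) →
    (∀ x → E x → H.Degenerate (suc m) j (H.ext x)) → (∀ x → H.Degenerate (suc m) j (H.ext x) → E x) →
    Pr enum μ E? ≃ recip (s ^ e)
  Pr-degenerate m j e {N} N≡ m≤j N≡′ E? E⇒ ⇒E = ≗⇒≃ λ M → begin
    seq (Pr enum μ E?) M
      ≡⟨ seq-sum-cong M (λ i → term M (Inverse.to V i)) ⟩
    seq (∑ℝ V (λ x → indicatorℝ (does (all∈? x ×-dec E? x)) r)) M
      ≡⟨ sum-indicator (λ i → does (all∈? (Inverse.to V i) ×-dec E? (Inverse.to V i))) r M ⟩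
    (+ sizeOf V (λ x → all∈? x ×-dec E? x) ℚ./ 1) ℚ.* r
      ≡⟨ cong₂ (λ a b → (+ a ℚ./ 1) ℚ.* 1/ℕ s ^ℚ b) (degenerate-size-cK order≡ c c≉0 m j N≡ m≤j E? E⇒ ⇒E all∈?) N≡′ ⟩
    (+ (s ^ m ℕ.* s ^ m) ℚ./ 1) ℚ.* 1/ℕ s ^ℚ (e ℕ.+ (m ℕ.+ m))
      ≡⟨ cancel-powers s s≥1 m e ⟩
    1/ℕ (s ^ e) ∎
    where
    open ≡-Reasoning
    V = vectors enum N
    r = 1/ℕ s ^ℚ N
    term : ∀ M x → seq (if does (E? x) then productℝ (λ i → prob (x i)) else 0ℝ) M ≡
                   seq (indicatorℝ (does (all∈? x ×-dec E? x)) r) M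
    term M x = go (E? x) (all∈? x)
      where
      go : ∀ {p} {P : Set p} (d : Dec P) (d′ : Dec (∀ i → x i ∈C)) →
           seq (if does d then productℝ (λ i → prob (x i)) else 0ℝ) M ≡ seq (indicatorℝ (does (d′ ×-dec d)) r) M
      go (yes _) d′@(yes _) = seq-product x M d′
      go (yes _) d′@(no _)  = seq-product x M d′
      go (no _)  (yes _)    = refl
      go (no _)  (no _)     = refl

  open HankelMatrix k

  Pr-H : ∀ m α → Pr enum μ (H? k m (2 ℕ.* m ℕ.+ α) (2m≤1+2m+α m α)) ≃ recip (s ^ suc α)
  -- `H` imposes `n - m + 1` equations, and the length `n + 1` exceeds `2m` by `α + 1`.
  Pr-H m α = Pr-degenerate m (suc (n ∸ m)) (suc α)
    (cong suc (sym (ℕ.m∸n+n≡m m≤n)))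
    (ℕ.m≤n⇒m≤1+n (ℕ.m+n≤o⇒m≤o∸n m m+m≤n))
    (cong suc (trans (cong (λ z → m ℕ.+ z ℕ.+ α) (ℕ.+-identityʳ m)) (ℕ.+-comm (m ℕ.+ m) α)))
    (H? k m n h) (H⇒Degenerate m n h) (Degenerate⇒H m n h)
    where
    n = 2 ℕ.* m ℕ.+ α
    h = 2m≤1+2m+α m α
    m+m≤n : m ℕ.+ m ≤ n
    m+m≤n = ℕ.≤-trans (ℕ.≤-reflexive (cong (m ℕ.+_) (sym (ℕ.+-identityʳ m)))) (ℕ.m≤m+n (2 ℕ.* m) α)
    m≤n : m ≤ n
    m≤n = ℕ.≤-trans (ℕ.m≤m+n m m) m+m≤n

  Pr-singular : ∀ m → Pr enum μ (λ x → Singular? k (hankel k m x)) ≃ recip s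
  Pr-singular m = subst (λ z → Pr enum μ (λ x → Singular? k (hankel k m x)) ≃ recip z) (ℕ.*-identityʳ s)
    -- A square matrix of order `m + 1` gives `m + 1` equations and length `2m + 1`, so `e = 1`; the
    -- result is `recip (s ^ 1)`, hence the transport along `s * 1 ≡ s`.
    (Pr-degenerate m (suc m) 1 (cong (λ z → suc (m ℕ.+ z)) (ℕ.+-identityʳ m)) (ℕ.n≤1+n m)
      (cong (λ z → suc (m ℕ.+ z)) (ℕ.+-identityʳ m))
      (λ x → Singular? k (hankel k m x)) (Singular⇒Degenerate m) (Degenerate⇒Singular m))

-- Real and complex numbers

open Bounding
open _≃_

Eventually : (ℕ → Set) → Set
Eventually P = ∃ λ N → ∀ n → N ≤ n → P n

both : ∀ {P Q : ℕ → Set} → Eventually P → Eventually Q → Eventually (λ n → P n × Q n)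
both (M , f) (N , g) = M ℕ.⊔ N , λ n h → f n (ℕ.m⊔n≤o⇒m≤o M N h) , g n (ℕ.m⊔n≤o⇒n≤o M N h)

module _ where
  open import Data.Rational.Base using (_+_; _*_; -_; _-_)
  open ℚSolver.+-*-Solver

  ≃-sym : ∀ {x y} → x ≃ y → y ≃ x
  ≃-sym {x} {y} x≃y = mk≃ λ ε 0<ε → let N , f = eventually x≃y ε 0<ε in N , λ n N≤n →
    subst (ℚ._< ε) (trans (sym (ℚ.∣-p∣≡∣p∣ (seq x n - seq y n)))
      (cong ∣_∣ (solve 2 (λ a b → :- (a :- b) := b :- a) refl (seq x n) (seq y n)))) (f n N≤n)

  ≃-trans : ∀ {x y z} → x ≃ y → y ≃ z → x ≃ z
  ≃-trans {x} {y} {z} x≃y y≃z = mk≃ λ ε 0<ε →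
    let N , f = both (eventually x≃y (½ * ε) (half>0 0<ε)) (eventually y≃z (½ * ε) (half>0 0<ε)) in
    N , λ n N≤n → subst₂ ℚ._<_
      (cong ∣_∣ (solve 3 (λ a b c → (a :+ b) :- (b :+ c) := a :- c) refl (seq x n) (seq y n) (seq z n)))
      (half+half ε)
      (+-close {seq x n} {seq y n} {seq y n} {seq z n} (proj₁ (f n N≤n)) (proj₂ (f n N≤n)))

  +ℝ-cong : ∀ {x y u v} → x ≃ y → u ≃ v → x +ℝ u ≃ y +ℝ v
  +ℝ-cong {x} {y} {u} {v} x≃y u≃v = mk≃ λ ε 0<ε →
    let N , f = both (eventually x≃y (½ * ε) (half>0 0<ε)) (eventually u≃v (½ * ε) (half>0 0<ε)) in
    N , λ n N≤n → subst (∣ seq x n + seq u n - (seq y n + seq v n) ∣ ℚ.<_) (half+half ε)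
      (+-close {seq x n} {seq u n} {seq y n} {seq v n} (proj₁ (f n N≤n)) (proj₂ (f n N≤n)))

  -ℝ-cong : ∀ {x y} → x ≃ y → -ℝ x ≃ -ℝ y
  -ℝ-cong {x} {y} x≃y = mk≃ λ ε 0<ε → let N , f = eventually x≃y ε 0<ε in
    N , λ n N≤n → neg-close {seq x n} {seq y n} (f n N≤n)

  *ℝ-cong : ∀ {x y u v} → x ≃ y → u ≃ v → x *ℝ u ≃ y *ℝ v
  *ℝ-cong {x} {y} {u} {v} x≃y u≃v = mk≃ λ ε 0<ε →
    let A , 0<A , bx = eventuallyBounded x
        B , 0<B , bv = eventuallyBounded v
        δ , 0<δ , eq = shrink (ℚ.+-mono-< {0ℚ} {A} {0ℚ} {B} 0<A 0<B) 0<ε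
        N , f = both (both bx bv) (both (eventually u≃v δ 0<δ) (eventually x≃y δ 0<δ))
    in N , λ n N≤n → let (xA , vB) , uv , xy = f n N≤n in
      subst (∣ seq x n * seq u n - seq y n * seq v n ∣ ℚ.<_) eq
        (*-close {seq x n} {seq u n} {seq y n} {seq v n} 0<A 0<B xA vB uv xy)

ℝ-commutativeRing : CommutativeRing _ _
ℝ-commutativeRing = record
  { Carrier = ℝ
  ; _≈_     = _≃_
  ; _+_     = _+ℝ_
  ; _*_     = _*ℝ_
  ; -_      = -ℝ_
  ; 0#      = 0ℝ
  ; 1#      = 1ℝ
  ; isCommutativeRing = record
    { isRing = record
      { +-isAbelianGroup = record
        { isGroup = record
          { isMonoid = record
            { isSemigroup = record
              { isMagma = record
                { isEquivalence = record { refl = ≃-refl ; sym = ≃-sym ; trans = ≃-trans }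
                ; ∙-cong = +ℝ-cong
                }
              ; assoc = λ x y z → ≗⇒≃ (λ n → ℚ.+-assoc (seq x n) (seq y n) (seq z n))
              }
            ; identity = (λ x → ≗⇒≃ (λ n → ℚ.+-identityˡ (seq x n))) , (λ x → ≗⇒≃ (λ n → ℚ.+-identityʳ (seq x n)))
            }
          ; inverse = (λ x → ≗⇒≃ (λ n → ℚ.+-inverseˡ (seq x n))) , (λ x → ≗⇒≃ (λ n → ℚ.+-inverseʳ (seq x n)))
          ; ⁻¹-cong = -ℝ-cong
          }
        ; comm = λ x y → ≗⇒≃ (λ n → ℚ.+-comm (seq x n) (seq y n))
        }
      ; *-cong = *ℝ-cong
      ; *-assoc = λ x y z → ≗⇒≃ (λ n → ℚ.*-assoc (seq x n) (seq y n) (seq z n))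
      ; *-identity = (λ x → ≗⇒≃ (λ n → ℚ.*-identityˡ (seq x n))) , (λ x → ≗⇒≃ (λ n → ℚ.*-identityʳ (seq x n)))
      ; distrib = (λ x y z → ≗⇒≃ (λ n → ℚ.*-distribˡ-+ (seq x n) (seq y n) (seq z n)))
                , (λ x y z → ≗⇒≃ (λ n → ℚ.*-distribʳ-+ (seq x n) (seq y n) (seq z n)))
      }
    ; *-comm = λ x y → ≗⇒≃ (λ n → ℚ.*-comm (seq x n) (seq y n))
    }
  }

module R = CommutativeRing ℝ-commutativeRing

-ᶜ_ : ℂ → ℂ
-ᶜ z = (-ℝ re z) +i (-ℝ im z)

ℂ-commutativeRing : CommutativeRing _ _
ℂ-commutativeRing = record
  { Carrier = ℂ
  ; _≈_     = _≃ᶜ_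
  ; _+_     = _+ᶜ_
  ; _*_     = _*ᶜ_
  ; -_      = -ᶜ_
  ; 0#      = 0ᶜ
  ; 1#      = 1ᶜ
  ; isCommutativeRing = record
    { isRing = record
      { +-isAbelianGroup = record
        { isGroup = record
          { isMonoid = record
            { isSemigroup = record
              { isMagma = record
                { isEquivalence = record
                  { refl  = ≃-refl , ≃-refl
                  ; sym   = λ (e , f) → ≃-sym e , ≃-sym f
                  ; trans = λ (e , f) (e′ , f′) → ≃-trans e e′ , ≃-trans f f′
                  }
                ; ∙-cong = λ (e , f) (e′ , f′) → +ℝ-cong e e′ , +ℝ-cong f f′
                }
              ; assoc = λ z w v → R.+-assoc (re z) (re w) (re v) , R.+-assoc (im z) (im w) (im v)
              }
            ; identity = (λ z → R.+-identityˡ (re z) , R.+-identityˡ (im z))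
                       , (λ z → R.+-identityʳ (re z) , R.+-identityʳ (im z))
            }
          ; inverse = (λ z → R.-‿inverseˡ (re z) , R.-‿inverseˡ (im z))
                    , (λ z → R.-‿inverseʳ (re z) , R.-‿inverseʳ (im z))
          ; ⁻¹-cong = λ (e , f) → -ℝ-cong e , -ℝ-cong f
          }
        ; comm = λ z w → R.+-comm (re z) (re w) , R.+-comm (im z) (im w)
        }
      ; *-cong = λ (e , f) (e′ , f′) →
          +ℝ-cong (*ℝ-cong e e′) (-ℝ-cong (*ℝ-cong f f′)) , +ℝ-cong (*ℝ-cong e f′) (*ℝ-cong f e′)
      ; *-assoc = λ z w v →
          ≗⇒≃ (λ n → solve 6 (λ a b c d e f →
            (a :* c :+ :- (b :* d)) :* e :+ :- ((a :* d :+ b :* c) :* f)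
              := a :* (c :* e :+ :- (d :* f)) :+ :- (b :* (c :* f :+ d :* e)))
            refl (seq (re z) n) (seq (im z) n) (seq (re w) n) (seq (im w) n) (seq (re v) n) (seq (im v) n)) ,
          ≗⇒≃ (λ n → solve 6 (λ a b c d e f →
            (a :* c :+ :- (b :* d)) :* f :+ (a :* d :+ b :* c) :* e
              := a :* (c :* f :+ d :* e) :+ b :* (c :* e :+ :- (d :* f)))
            refl (seq (re z) n) (seq (im z) n) (seq (re w) n) (seq (im w) n) (seq (re v) n) (seq (im v) n))
      ; *-identity = identityˡ , (λ z → ℂ-trans (comm z 1ᶜ) (identityˡ z))
      ; distrib = distribˡ , (λ z w v → ℂ-trans (comm (w +ᶜ v) z) (ℂ-trans (distribˡ z w v)
          (+ℝ-cong (proj₁ (comm z w)) (proj₁ (comm z v)) , +ℝ-cong (proj₂ (comm z w)) (proj₂ (comm z v)))))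
      }
    ; *-comm = comm
    }
  }
  where
  open ℚSolver.+-*-Solver
  ℂ-trans : ∀ {z w v} → z ≃ᶜ w → w ≃ᶜ v → z ≃ᶜ v
  ℂ-trans (e , f) (e′ , f′) = ≃-trans e e′ , ≃-trans f f′
  identityˡ : ∀ z → 1ᶜ *ᶜ z ≃ᶜ z
  identityˡ z =
    ≗⇒≃ (λ n → solve 2 (λ a b → con 1ℚ :* a :+ :- (con 0ℚ :* b) := a) refl (seq (re z) n) (seq (im z) n)) ,
    ≗⇒≃ (λ n → solve 2 (λ a b → con 1ℚ :* b :+ con 0ℚ :* a := b) refl (seq (re z) n) (seq (im z) n))
  comm : ∀ z w → z *ᶜ w ≃ᶜ w *ᶜ z
  comm z w =
    ≗⇒≃ (λ n → solve 4 (λ a b c d → a :* c :+ :- (b :* d) := c :* a :+ :- (d :* b)) refl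
      (seq (re z) n) (seq (im z) n) (seq (re w) n) (seq (im w) n)) ,
    ≗⇒≃ (λ n → solve 4 (λ a b c d → a :* d :+ b :* c := c :* b :+ d :* a) refl
      (seq (re z) n) (seq (im z) n) (seq (re w) n) (seq (im w) n))
  distribˡ : ∀ z w v → z *ᶜ (w +ᶜ v) ≃ᶜ z *ᶜ w +ᶜ z *ᶜ v
  distribˡ z w v =
    ≗⇒≃ (λ n → solve 6 (λ a b c d e f →
      a :* (c :+ e) :+ :- (b :* (d :+ f)) := a :* c :+ :- (b :* d) :+ (a :* e :+ :- (b :* f)))
      refl (seq (re z) n) (seq (im z) n) (seq (re w) n) (seq (im w) n) (seq (re v) n) (seq (im v) n)) ,
    ≗⇒≃ (λ n → solve 6 (λ a b c d e f →
      a :* (d :+ f) :+ b :* (c :+ e) := a :* d :+ b :* c :+ (a :* f :+ b :* e))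
      refl (seq (re z) n) (seq (im z) n) (seq (re w) n) (seq (im w) n) (seq (re v) n) (seq (im v) n))

module C = CommutativeRing ℂ-commutativeRing
module ΣC = SemiringSum C.semiring
module ΣR = SemiringSum R.semiring

module _ where
  open import Data.Rational.Base using (_+_; _*_; -_; _-_)
  open ℚSolver.+-*-Solver

  ¼ : ℚ
  ¼ = ½ * ½

  -- From some index on `¼ |x| ≤ |x y|`, so `y` can be cancelled without constructing its inverse.
  bounded-away-cancel : ∀ {x y} → Eventually (λ n → ¼ ℚ.≤ seq y n) → x *ℝ y ≃ 0ℝ → x ≃ 0ℝ
  bounded-away-cancel {x} {y} y≥¼ xy≃0 = mk≃ λ ε 0<ε →
    let N , f = both y≥¼ (eventually xy≃0 (¼ * ε) (*-pos {¼} (ℚ.positive⁻¹ ¼) 0<ε))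
    in N , λ n N≤n → let y≥¼ , xy<ε = f n N≤n in ℚ.*-cancelˡ-<-nonNeg ¼ (begin-strict
      ¼ * ∣ seq x n - 0ℚ ∣                 ≤⟨ ℚ.*-monoʳ-≤-nonNeg ∣ seq x n - 0ℚ ∣ {{ℚ.∣-∣-nonNeg (seq x n - 0ℚ)}} y≥¼ ⟩
      seq y n * ∣ seq x n - 0ℚ ∣           ≡⟨ cong (_* ∣ seq x n - 0ℚ ∣) (ℚ.0≤p⇒∣p∣≡p (ℚ.≤-trans (ℚ.nonNegative⁻¹ ¼) y≥¼)) ⟨
      ∣ seq y n ∣ * ∣ seq x n - 0ℚ ∣       ≡⟨ ℚ.∣p*q∣≡∣p∣*∣q∣ (seq y n) (seq x n - 0ℚ) ⟨
      ∣ seq y n * (seq x n - 0ℚ) ∣         ≡⟨ cong ∣_∣ (solve 2 (λ a b → b :* (a :- con 0ℚ) := a :* b :- con 0ℚ) refl (seq x n) (seq y n)) ⟩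
      ∣ seq x n * seq y n - 0ℚ ∣           <⟨ xy<ε ⟩
      ¼ * ε                                ∎)
    where open ℚ.≤-Reasoning

  -- A single term of the sequence, accurate to `¼`, is compared with `½`. Either outcome bounds one
  -- factor of `x (1 - x) = 0` below by `¼`: `1 - x` if the term is at most `½`, and `x` otherwise.
  -- The other factor is then zero.
  idempotent-ℝ : ∀ x → x *ℝ x ≃ x → x ≃ 0ℝ ⊎ x ≃ 1ℝ
  idempotent-ℝ x xx≃x with cauchy x ¼ (ℚ.positive⁻¹ ¼)
  ... | N , near with seq x N ℚ.≤? ½
  ... | yes x≤½ = inj₁ (bounded-away-cancel {x} {1ℝ -ℝ x}
    (N , λ n N≤n → begin
      ¼                          ≡⟨⟩
      1ℚ - (½ + ¼)               ≤⟨ ℚ.+-monoʳ-≤ 1ℚ (ℚ.neg-antimono-≤ (ℚ.≤-trans (ℚ.<⇒≤ (upper {seq x n} {seq x N} (near n N N≤n ℕ.≤-refl))) (ℚ.+-monoˡ-≤ ¼ x≤½))) ⟩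
      1ℚ - seq x n               ∎)
    (R.trans (≗⇒≃ (λ n → solve 1 (λ a → a :* (con 1ℚ :+ :- a) := a :+ :- (a :* a)) refl (seq x n)))
      (R.trans (+ℝ-cong (R.refl {x}) (-ℝ-cong xx≃x)) (R.-‿inverseʳ x))))
    where open ℚ.≤-Reasoning
  ... | no x≰½ = inj₂ (R.trans (≗⇒≃ (λ n → solve 1 (λ a → a := con 1ℚ :+ (a :+ :- con 1ℚ)) refl (seq x n)))
    (R.trans (R.+-congˡ {1ℝ} (bounded-away-cancel {x -ℝ 1ℝ} {x}
      (N , λ n N≤n → begin
        ¼                          ≡⟨⟩
        ½ - ¼                      ≤⟨ ℚ.+-monoˡ-≤ (- ¼) (ℚ.<⇒≤ (ℚ.<-trans (ℚ.≰⇒> x≰½) (upper {seq x N} {seq x n} (near N n ℕ.≤-refl N≤n)))) ⟩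
        seq x n + ¼ - ¼            ≡⟨ solve 2 (λ a q → a :+ q :- q := a) refl (seq x n) ¼ ⟩
        seq x n                    ∎)
      (R.trans (≗⇒≃ (λ n → solve 1 (λ a → (a :+ :- con 1ℚ) :* a := a :* a :+ :- a) refl (seq x n)))
        (R.trans (R.+-congʳ { -ℝ x} xx≃x) (R.-‿inverseʳ x)))))
      (R.+-identityʳ 1ℝ)))
    where open ℚ.≤-Reasoning

  -- b (1 + 4b²) = 0 because 1 + 4b² = (2a - 1)² and b (2a - 1) = 0.
  idempotent-im : ∀ z → z *ᶜ z ≃ᶜ z → im z ≃ 0ℝ
  idempotent-im (a +i b) (eqa , eqb) = bounded-away-cancel {b} {y}
    (0 , λ n _ → begin
      ¼                                   ≤⟨ ℚ.≤ᵇ⇒≤ _ ⟩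
      1ℚ + 0ℚ                             ≤⟨ ℚ.+-monoʳ-≤ 1ℚ (square≥0 (seq b n + seq b n)) ⟩
      seq y n                             ∎)
    (begin′
      b *ℝ y
        ≈⟨ ≗⇒≃ (λ n → solve 2 (λ a b → b :* (con 1ℚ :+ (b :+ b) :* (b :+ b))
             := (a :* b :+ b :* a :+ :- b) :* (a :+ a :+ :- con 1ℚ) :+
                (b :+ b :+ (b :+ b)) :* (a :+ :- (a :* a :+ :- (b :* b)))) refl (seq a n) (seq b n)) ⟩
      (a *ℝ b +ℝ b *ℝ a -ℝ b) *ℝ (a +ℝ a -ℝ 1ℝ) +ℝ (b +ℝ b +ℝ (b +ℝ b)) *ℝ (a -ℝ (a *ℝ a -ℝ b *ℝ b))
        ≈⟨ +ℝ-cong (*ℝ-cong (R.trans (R.+-congʳ { -ℝ b} eqb) (R.-‿inverseʳ b)) (R.refl {a +ℝ a -ℝ 1ℝ}))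
                   (*ℝ-cong (R.refl {b +ℝ b +ℝ (b +ℝ b)}) (R.trans (R.+-congˡ {a} (-ℝ-cong eqa)) (R.-‿inverseʳ a))) ⟩
      0ℝ *ℝ (a +ℝ a -ℝ 1ℝ) +ℝ (b +ℝ b +ℝ (b +ℝ b)) *ℝ 0ℝ
        ≈⟨ ≗⇒≃ (λ n → solve 2 (λ a b → con 0ℚ :* a :+ b :* con 0ℚ := con 0ℚ) refl
             (seq (a +ℝ a -ℝ 1ℝ) n) (seq (b +ℝ b +ℝ (b +ℝ b)) n)) ⟩
      0ℝ ∎′)
    where
    open ℚ.≤-Reasoning
    open SetoidReasoning R.setoid using (step-≈-⟩) renaming (begin_ to begin′_; _∎ to _∎′)
    y : ℝ
    y = 1ℝ +ℝ (b +ℝ b) *ℝ (b +ℝ b)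
    square≥0 : ∀ q → 0ℚ ℚ.≤ q * q
    square≥0 q with ℚ.≤-total 0ℚ q
    ... | inj₁ 0≤q = subst (ℚ._≤ q * q) (ℚ.*-zeroʳ q) (ℚ.*-monoˡ-≤-nonNeg q {{ℚ.nonNegative 0≤q}} 0≤q)
    ... | inj₂ q≤0 = subst (ℚ._≤ q * q) (ℚ.*-zeroʳ q) (ℚ.*-monoˡ-≤-nonPos q {{ℚ.nonPositive q≤0}} q≤0)

  -- Squares are compared: an error below `η²` in `x` shifts the root by at most `η`, because
  -- `u² + η² ≤ (u + η)²`, and the bisection interval accounts for another `η`. Termwise
  -- nonnegativity of `z` is enough for the constant sequences to which this is applied.
  √-unique : ∀ x z → (∀ n → 0ℚ ℚ.≤ seq z n) → x ≃ z *ℝ z → √ x ≃ z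
  √-unique x z z≥0 x≃zz = mk≃ λ ε 0<ε →
    let η = ½ * ε
        0<η = half>0 0<ε
        B , 0<B , bx = eventuallyBounded x
        0<1+B = ℚ.+-mono-< {0ℚ} {1ℚ} {0ℚ} {B} (ℚ.positive⁻¹ 1ℚ) 0<B
        N , f = both (both bx (Sqrt.widths→0 (1ℚ + B) η 0<1+B 0<η))
                     (eventually x≃zz (η * η) (*-pos 0<η 0<η))
    in N , λ n N≤n → let (x≤B , w≤η) , near = f n N≤n in
      subst (∣ Sqrt.lo (seq x n) n - seq z n ∣ ℚ.<_) (half+half ε)
        (estimate (seq x n) (seq z n) n 0<η (z≥0 n)
          (ℚ.≤-trans (ℚ.*-monoˡ-≤-nonNeg (½^ n) {{ℚ.nonNegative (Sqrt.½^≥0 n)}} (ℚ.+-monoʳ-≤ 1ℚ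
             (ℚ.⊔-lub (ℚ.≤-trans (p≤∣p∣ (seq x n)) x≤B) (ℚ.<⇒≤ 0<B)))) w≤η)
          near)
    where
    open ℚ.≤-Reasoning
    square-shift : ∀ {u η} → 0ℚ ℚ.≤ u → 0ℚ ℚ.< η → u * u + η * η ℚ.≤ (u + η) * (u + η)
    square-shift {u} {η} u≥0 0<η = begin
      u * u + η * η                         ≡⟨ ℚ.+-identityʳ _ ⟨
      u * u + η * η + 0ℚ                    ≤⟨ ℚ.+-monoʳ-≤ (u * u + η * η) (ℚ.+-mono-≤ uη≥0 uη≥0) ⟩
      u * u + η * η + (u * η + u * η)       ≡⟨ solve 2 (λ u e → u :* u :+ e :* e :+ (u :* e :+ u :* e) := (u :+ e) :* (u :+ e)) refl u η ⟩
      (u + η) * (u + η)                     ∎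
      where
      uη≥0 : 0ℚ ℚ.≤ u * η
      uη≥0 = subst (ℚ._≤ u * η) (ℚ.*-zeroʳ u) (ℚ.*-monoˡ-≤-nonNeg u {{ℚ.nonNegative u≥0}} (ℚ.<⇒≤ 0<η))
    square-cancel : ∀ {u v} → 0ℚ ℚ.≤ v → u * u ℚ.< v * v → u ℚ.< v
    square-cancel {u} {v} v≥0 uu<vv with v ℚ.≤? u
    ... | no v≰u  = ℚ.≰⇒> v≰u
    ... | yes v≤u = contradiction (ℚ.<-≤-trans uu<vv (*-mono-≤ v≥0 (ℚ.≤-trans v≥0 v≤u) v≤u v≤u)) (ℚ.<-irrefl refl)
    estimate : ∀ r z n {η} → 0ℚ ℚ.< η → 0ℚ ℚ.≤ z → ½^ n * (1ℚ + (r ℚ.⊔ 0ℚ)) ℚ.≤ η →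
               ∣ r - z * z ∣ ℚ.< η * η → ∣ Sqrt.lo r n - z ∣ ℚ.< η + η
    estimate r z n {η} 0<η z≥0 w≤η near = close lo<z+2η z<lo+2η
      where
      open Sqrt.Bounds (Sqrt.bounds r n)
      lo = Sqrt.lo r n
      hi = proj₂ (√-bounds r n)
      η≥0 = ℚ.<⇒≤ 0<η
      z*z≥0 : 0ℚ ℚ.≤ z * z
      z*z≥0 = subst (ℚ._≤ z * z) (ℚ.*-zeroʳ z) (ℚ.*-monoˡ-≤-nonNeg z {{ℚ.nonNegative z≥0}} z≥0)
      lo<z+2η : lo ℚ.< z + (η + η)
      lo<z+2η = ℚ.<-≤-trans (square-cancel {lo} {z + η} (ℚ.+-mono-≤ z≥0 η≥0) (begin-strict
        lo * lo             ≤⟨ lo²≤r ⟩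
        r ℚ.⊔ 0ℚ            <⟨ Sqrt.⊔0-shift {r} {z * z} (*-pos 0<η 0<η) (upper {r} {z * z} near) ⟩
        (z * z ℚ.⊔ 0ℚ) + η * η ≡⟨ cong (_+ η * η) (ℚ.p≥q⇒p⊔q≡p z*z≥0) ⟩
        z * z + η * η       ≤⟨ square-shift z≥0 0<η ⟩
        (z + η) * (z + η)   ∎))
        (ℚ.+-monoʳ-≤ z (subst (ℚ._≤ η + η) (ℚ.+-identityʳ η) (ℚ.+-monoʳ-≤ η η≥0)))
      hi≤lo+η : hi ℚ.≤ lo + η
      hi≤lo+η = subst (ℚ._≤ lo + η) (sym width) (ℚ.+-monoʳ-≤ lo w≤η)
      hi≥0 : 0ℚ ℚ.≤ hi
      hi≥0 = subst (0ℚ ℚ.≤_) (sym width) (ℚ.+-mono-≤ lo≥0 (subst (ℚ._≤ ½^ n * (1ℚ + (r ℚ.⊔ 0ℚ))) (ℚ.*-zeroʳ (½^ n))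
        (ℚ.*-monoˡ-≤-nonNeg (½^ n) {{ℚ.nonNegative (Sqrt.½^≥0 n)}}
          (ℚ.+-mono-≤ (ℚ.nonNegative⁻¹ 1ℚ) (ℚ.p≤q⊔p r 0ℚ)))))
      z<lo+2η : z ℚ.< lo + (η + η)
      z<lo+2η = ℚ.<-≤-trans (square-cancel {z} {hi + η} (ℚ.+-mono-≤ hi≥0 η≥0) (begin-strict
        z * z               <⟨ upper {z * z} {r} (subst (ℚ._< η * η) (trans (sym (ℚ.∣-p∣≡∣p∣ (r - z * z)))
                                 (cong ∣_∣ (solve 2 (λ a b → :- (a :- b) := b :- a) refl r (z * z)))) near) ⟩
        r + η * η           ≤⟨ ℚ.+-monoˡ-≤ (η * η) (ℚ.p≤p⊔q r 0ℚ) ⟩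
        (r ℚ.⊔ 0ℚ) + η * η  <⟨ ℚ.+-monoˡ-< (η * η) r<hi² ⟩
        hi * hi + η * η     ≤⟨ square-shift hi≥0 0<η ⟩
        (hi + η) * (hi + η) ∎))
        (ℚ.≤-trans (ℚ.+-monoˡ-≤ η hi≤lo+η) (ℚ.≤-reflexive (ℚ.+-assoc lo η η)))

idempotent-ℂ : ∀ z → z *ᶜ z ≃ᶜ z → z ≃ᶜ 0ᶜ ⊎ z ≃ᶜ 1ᶜ
idempotent-ℂ z@(a +i b) zz≃z = go (idempotent-ℝ a (R.trans
    (R.trans (≗⇒≃ (λ n → solve 2 (λ a b → a :* a := a :* a :+ :- (b :* b) :+ b :* b) refl (seq a n) (seq b n)))
      (R.+-congˡ {a *ℝ a -ℝ b *ℝ b} (R.trans (*ℝ-cong b≃0 b≃0) (R.zeroˡ 0ℝ))))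
    (R.trans (R.+-identityʳ (a *ℝ a -ℝ b *ℝ b)) (proj₁ zz≃z))))
  where
  open ℚSolver.+-*-Solver
  b≃0 : b ≃ 0ℝ
  b≃0 = idempotent-im z zz≃z
  go : a ≃ 0ℝ ⊎ a ≃ 1ℝ → z ≃ᶜ 0ᶜ ⊎ z ≃ᶜ 1ᶜ
  go (inj₁ a≃0) = inj₁ (a≃0 , b≃0)
  go (inj₂ a≃1) = inj₂ (a≃1 , b≃0)

modulus-real : ∀ r z → 0ℚ ℚ.≤ r → z ≃ᶜ (fromℚ r +i 0ℝ) → modulus z ≃ fromℚ r
modulus-real r z 0≤r (a≃r , b≃0) = √-unique (re z *ℝ re z +ℝ im z *ℝ im z) (fromℚ r) (λ _ → 0≤r)
  (R.trans (+ℝ-cong (*ℝ-cong a≃r a≃r) (R.trans (*ℝ-cong b≃0 b≃0) (R.zeroˡ 0ℝ))) (R.+-identityʳ (fromℚ r *ℝ fromℚ r)))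

idempotent-modulus : ∀ z → z *ᶜ z ≃ᶜ z → modulus z ≃ re z
idempotent-modulus z zz≃z = go (idempotent-ℂ z zz≃z)
  where
  go : z ≃ᶜ 0ᶜ ⊎ z ≃ᶜ 1ᶜ → modulus z ≃ re z
  go (inj₁ z≃0) = ≃-trans {modulus z} {0ℝ} {re z} (modulus-real 0ℚ z ℚ.≤-refl z≃0) (≃-sym (proj₁ z≃0))
  go (inj₂ z≃1) = ≃-trans {modulus z} {1ℝ} {re z} (modulus-real 1ℚ z (ℚ.nonNegative⁻¹ 1ℚ) z≃1) (≃-sym (proj₁ z≃1))

0≄1 : ¬ (0ℝ ≃ 1ℝ)
0≄1 e with eventually e ½ (ℚ.positive⁻¹ ½)
... | N , f = ℚ.<-irrefl refl (ℚ.<-≤-trans (f N ℕ.≤-refl) (ℚ.≤ᵇ⇒≤ _))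

-- The Fourier transform

module _ {S : Setoid a ℓ} {n : ℕ} (enum : HasCardinality S n) where
  open Setoid S using (Carrier; _≈_) renaming (refl to ≈-refl; sym to ≈-sym; trans to ≈-trans)
  open Inverse enum

  -- Conjugating `φ` by the enumeration gives a permutation of the indices, under which a finite sum
  -- is invariant.
  ∑ᶜ-reindex : (f : Carrier → ℂ) → (∀ {x y} → x ≈ y → f x ≃ᶜ f y) →
               (φ φ⁻¹ : Carrier → Carrier) →
               (∀ {x y} → x ≈ y → φ x ≈ φ y) → (∀ {x y} → x ≈ y → φ⁻¹ x ≈ φ⁻¹ y) →
               (∀ x → φ (φ⁻¹ x) ≈ x) → (∀ x → φ⁻¹ (φ x) ≈ x) →
               ∑ᶜ enum f ≃ᶜ ∑ᶜ enum (f ∘ φ)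
  ∑ᶜ-reindex f f-cong φ φ⁻¹ φ-cong φ⁻¹-cong φφ⁻¹ φ⁻¹φ = C.trans (ΣC.sum-permute (f ∘ to) π)
    (ΣC.sum-cong-≋ {n} {λ i → f (to (from (φ (to i))))} {λ i → f (φ (to i))} (λ i → f-cong (inverseˡ refl)))
    where
    conjugate : (φ φ⁻¹ : Carrier → Carrier) → (∀ {x y} → x ≈ y → φ x ≈ φ y) → (∀ x → φ (φ⁻¹ x) ≈ x) →
                ∀ i → from (φ (to (from (φ⁻¹ (to i))))) ≡ i
    conjugate φ φ⁻¹ φ-cong φφ⁻¹ i = trans (from-cong (≈-trans (φ-cong (inverseˡ refl)) (φφ⁻¹ (to i)))) (inverseʳ ≈-refl)
    π : Perm.Permutation n n
    π = Perm.permutation (from ∘ φ ∘ to) (from ∘ φ⁻¹ ∘ to) (conjugate φ φ⁻¹ φ-cong φφ⁻¹) (conjugate φ⁻¹ φ φ⁻¹-cong φ⁻¹φ)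

embed : ℝ → ℂ
embed r = r +i 0ℝ

embed-cong : ∀ {r t} → r ≃ t → embed r ≃ᶜ embed t
embed-cong e = e , ≃-refl {0ℝ}

•-embed : ∀ r z → r • z ≃ᶜ embed r *ᶜ z
•-embed r z =
  ≗⇒≃ (λ n → solve 3 (λ r a b → r :* a := r :* a :+ :- (con 0ℚ :* b)) refl (seq r n) (seq (re z) n) (seq (im z) n)) ,
  ≗⇒≃ (λ n → solve 3 (λ r a b → r :* b := r :* b :+ con 0ℚ :* a) refl (seq r n) (seq (re z) n) (seq (im z) n))
  where open ℚSolver.+-*-Solver

•-cong : ∀ {r t z w} → r ≃ t → z ≃ᶜ w → r • z ≃ᶜ t • w
•-cong r≃t (e , f) = *ℝ-cong r≃t e , *ℝ-cong r≃t f

re-sum : ∀ {n} (f : Vector ℂ n) → re (sumᶜ f) ≡ sumℝ (re ∘ f)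
re-sum {zero}  f = refl
re-sum {suc n} f = cong (re (f zero) +ℝ_) (re-sum (f ∘ suc))

sum-embed : ∀ {n} (f : Vector ℝ n) → sumᶜ (embed ∘ f) ≃ᶜ embed (sumℝ f)
sum-embed {zero}  f = C.refl {0ᶜ}
sum-embed {suc n} f = C.trans {sumᶜ (embed ∘ f)} {embed (f zero) +ᶜ embed (sumℝ (f ∘ suc))} {embed (sumℝ f)}
  (C.+-congˡ {embed (f zero)} (sum-embed (f ∘ suc)))
  (≃-refl {sumℝ f} , R.+-identityˡ 0ℝ)

sum-single : ∀ {n} (f : Vector ℂ n) i → (∀ j → ¬ (j ≡ i) → f j ≃ᶜ 0ᶜ) → sumᶜ f ≃ᶜ f i
sum-single {suc n} f zero h = C.trans (C.+-congˡ {f zero}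
    (C.trans (ΣC.sum-cong-≋ {n} {f ∘ suc} (λ j → h (suc j) λ ())) (ΣC.sum-replicate-zero n)))
  (C.+-identityʳ (f zero))
sum-single {suc n} f (suc i) h = C.trans (C.+-cong (h zero λ ())
    (sum-single (f ∘ suc) i (λ j j≢i → h (suc j) (j≢i ∘ Fin.suc-injective))))
  (C.+-identityˡ (f (suc i)))

sum-*ʳ : ∀ {n} (f : Vector ℂ n) z → sumᶜ (λ i → f i *ᶜ z) ≃ᶜ sumᶜ f *ᶜ z
sum-*ʳ f z = C.sym {sumᶜ f *ᶜ z} (ΣC.*-distribʳ-sum z f)

sum-*ˡ : ∀ {n} z (f : Vector ℂ n) → sumᶜ (λ i → z *ᶜ f i) ≃ᶜ z *ᶜ sumᶜ f
sum-*ˡ z f = C.sym {z *ᶜ sumᶜ f} (ΣC.*-distribˡ-sum z f)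

size-ℂ : ∀ n → sumᶜ {n} (λ _ → 1ᶜ) ≃ᶜ embed (fromℕ n)
size-ℂ n = C.trans (sum-embed {n} (λ _ → 1ℝ)) (embed-cong (≗⇒≃ (λ M → trans (sum-indicator {n} (λ _ → true) 1ℚ M)
  (trans (ℚ.*-identityʳ _) (cong (λ z → + z ℚ./ 1) (trans (sum-const n 1) (ℕ.*-identityʳ n)))))))
  where open UniformTotal

-- Orthogonality for a nontrivial character

module Characters (k : FiniteField c ℓ) (ψ₀ : NontrivialCharacter k) where
  open FiniteField k
  open NontrivialCharacter ψ₀
  open IsMagmaHomomorphism isHomomorphism using (homo) renaming (⟦⟧-cong to ψ-cong)
  open Hankel k using (_≟_; x≈0⇒x*y≈0; y≈0⇒x*y≈0)
  open SetoidReasoning C.setoid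
  open SemigroupProperties C.*-commutativeSemigroup using (interchange; x∙yz≈y∙xz)

  T Q : ℂ
  T = ∑ᶜ enum ψ
  Q = ∑ᶜ enum (λ _ → 1ᶜ)

  -- `ψ 0#` is idempotent because `0# + 0# ≈ 0#`, and the value `0` is excluded by its modulus being
  -- `1`.
  ψ-0 : ψ 0# ≃ᶜ 1ᶜ
  ψ-0 = go (idempotent-ℂ (ψ 0#) (C.trans (C.sym (homo 0# 0#)) (ψ-cong (+-identityˡ 0#))))
    where
    go : ψ 0# ≃ᶜ 0ᶜ ⊎ ψ 0# ≃ᶜ 1ᶜ → ψ 0# ≃ᶜ 1ᶜ
    go (inj₂ e) = e
    go (inj₁ e) = contradiction (≃-trans {0ℝ} {modulus (ψ 0#)} {1ℝ}
      (≃-sym (modulus-real 0ℚ (ψ 0#) ℚ.≤-refl e)) (on-circle 0#)) 0≄1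

  +-invertible : ∀ w x → x + - w + w ≈ x
  +-invertible w x = ≈-trans (+-assoc x (- w) w) (≈-trans (+-congˡ (-‿inverseˡ w)) (+-identityʳ x))

  +-invertible′ : ∀ w x → x + w + - w ≈ x
  +-invertible′ w x = ≈-trans (+-assoc x w (- w)) (≈-trans (+-congˡ (-‿inverseʳ w)) (+-identityʳ x))

  ψ-shift : ∀ w → ψ w *ᶜ T ≃ᶜ T
  ψ-shift w = begin
    ψ w *ᶜ T                       ≈⟨ sum-*ˡ (ψ w) (ψ ∘ Inverse.to enum) ⟨
    ∑ᶜ enum (λ x → ψ w *ᶜ ψ x)     ≈⟨ ΣC.sum-cong-≋ {order} (λ i → C.trans (C.*-comm (ψ w) (ψ (Inverse.to enum i))) (C.sym (homo (Inverse.to enum i) w))) ⟩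
    ∑ᶜ enum (λ x → ψ (x + w))      ≈⟨ ∑ᶜ-reindex enum ψ ψ-cong (_+ w) (_+ - w) +-congʳ +-congʳ (+-invertible w) (+-invertible′ w) ⟨
    T                              ∎

  -- Each of the summands `ψ x` of one factor is absorbed by the other factor, leaving one copy of
  -- `T` per field element.
  T*T : T *ᶜ T ≃ᶜ Q *ᶜ T
  T*T = begin
    T *ᶜ T                       ≈⟨ sum-*ʳ (ψ ∘ Inverse.to enum) T ⟨
    ∑ᶜ enum (λ x → ψ x *ᶜ T)     ≈⟨ ΣC.sum-cong-≋ {order} (λ i → C.trans (ψ-shift (Inverse.to enum i)) (C.sym (C.*-identityˡ T))) ⟩
    ∑ᶜ enum (λ _ → 1ᶜ *ᶜ T)      ≈⟨ sum-*ʳ {order} (λ _ → 1ᶜ) T ⟩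
    Q *ᶜ T                       ∎

  r : ℂ
  r = embed (recip order)

  order≥1 : 1 ≤ order
  order≥1 with order≥2 k
  ... | _ , e = subst (1 ≤_) (sym e) (s≤s z≤n)

  rQ≃1 : r *ᶜ Q ≃ᶜ 1ᶜ
  rQ≃1 = begin
    r *ᶜ Q                              ≈⟨ C.*-congˡ {r} (size-ℂ order) ⟩
    r *ᶜ embed (fromℕ order)            ≈⟨ •-embed (recip order) (embed (fromℕ order)) ⟨
    recip order • embed (fromℕ order)   ≈⟨ ≗⇒≃ (λ _ → trans (ℚ.*-comm (1/ℕ order) _) (UniformTotal.n*1/n order order≥1)) ,
                                          ≗⇒≃ (λ _ → ℚ.*-zeroʳ (1/ℕ order)) ⟩
    1ᶜ                                  ∎

  rT-idempotent : (r *ᶜ T) *ᶜ (r *ᶜ T) ≃ᶜ r *ᶜ T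
  rT-idempotent = begin
    (r *ᶜ T) *ᶜ (r *ᶜ T)  ≈⟨ interchange r T r T ⟩
    (r *ᶜ r) *ᶜ (T *ᶜ T)  ≈⟨ C.*-congˡ {r *ᶜ r} T*T ⟩
    (r *ᶜ r) *ᶜ (Q *ᶜ T)  ≈⟨ interchange r r Q T ⟩
    (r *ᶜ Q) *ᶜ (r *ᶜ T)  ≈⟨ C.*-congʳ {r *ᶜ T} rQ≃1 ⟩
    1ᶜ *ᶜ (r *ᶜ T)        ≈⟨ C.*-identityˡ (r *ᶜ T) ⟩
    r *ᶜ T                ∎

  -- T / q is idempotent, and T / q ≃ 1 would make ψ trivial since ψ w · T ≃ T.
  T≃0 : T ≃ᶜ 0ᶜ
  T≃0 = go (idempotent-ℂ (r *ᶜ T) rT-idempotent)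
    where
    go : r *ᶜ T ≃ᶜ 0ᶜ ⊎ r *ᶜ T ≃ᶜ 1ᶜ → T ≃ᶜ 0ᶜ
    go (inj₁ e) = begin
      T               ≈⟨ C.*-identityˡ T ⟨
      1ᶜ *ᶜ T         ≈⟨ C.*-congʳ {T} rQ≃1 ⟨
      r *ᶜ Q *ᶜ T     ≈⟨ C.*-congʳ {T} (C.*-comm r Q) ⟩
      Q *ᶜ r *ᶜ T     ≈⟨ C.*-assoc Q r T ⟩
      Q *ᶜ (r *ᶜ T)   ≈⟨ C.*-congˡ {Q} e ⟩
      Q *ᶜ 0ᶜ         ≈⟨ C.zeroʳ Q ⟩
      0ᶜ              ∎
    go (inj₂ e) = contradiction (λ w → begin
      ψ w                   ≈⟨ C.*-identityʳ (ψ w) ⟨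
      ψ w *ᶜ 1ᶜ             ≈⟨ C.*-congˡ {ψ w} e ⟨
      ψ w *ᶜ (r *ᶜ T)       ≈⟨ x∙yz≈y∙xz (ψ w) r T ⟩
      r *ᶜ (ψ w *ᶜ T)       ≈⟨ C.*-congˡ {r} (ψ-shift w) ⟩
      r *ᶜ T                ≈⟨ e ⟩
      1ᶜ                    ∎) nontrivial

  column-0 : ∀ {x} → x ≈ 0# → ∑ᶜ enum (λ y → ψ (y * x)) ≃ᶜ Q
  column-0 x≈0 = ΣC.sum-cong-≋ {order} (λ i → C.trans (ψ-cong (y≈0⇒x*y≈0 (Inverse.to enum i) x≈0)) ψ-0)

  -- Multiplication by a nonzero `x` permutes the field, so this is again the sum `T`.
  column-≉0 : ∀ {x} → x ≉ 0# → ∑ᶜ enum (λ y → ψ (y * x)) ≃ᶜ 0ᶜ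
  column-≉0 {x} x≉0 = let x⁻¹ , x⁻¹x≈1 , xx⁻¹≈1 = inverse x x≉0 in
    C.trans (C.sym (∑ᶜ-reindex enum ψ ψ-cong (_* x) (_* x⁻¹) *-congʳ *-congʳ
      (λ y → ≈-trans (*-assoc y x⁻¹ x) (≈-trans (*-congˡ x⁻¹x≈1) (*-identityʳ y)))
      (λ y → ≈-trans (*-assoc y x x⁻¹) (≈-trans (*-congˡ xx⁻¹≈1) (*-identityʳ y))))) T≃0

-- The transform of the uniform distribution on `c k₀` and its norm

module FourierNorm (k : FiniteField c ℓ) (k₀ : Subfield k p)
                   {s : ℕ} (order≡ : FiniteField.order k ≡ s ℕ.* s)
                   (enum₀ : HasCardinality (Subfield.subsetoid k₀) s)
                   (c : FiniteField.Carrier k) (c≉0 : ¬ FiniteField._≈_ k c (FiniteField.0# k))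
                   (ψ₀ : NontrivialCharacter k) where
  open FiniteField k
  open Subfield k₀
  open NontrivialCharacter ψ₀
  open IsMagmaHomomorphism isHomomorphism using (homo) renaming (⟦⟧-cong to ψ-cong)
  open RingProperties ring using (-‿distribʳ-*)
  open Characters k ψ₀
  open Probability k k₀ order≡ enum₀ c c≉0 using (prob-∈; prob-∉; s≥1)
  open SetoidReasoning C.setoid
  open SemigroupProperties C.*-commutativeSemigroup using (x∙yz≈y∙xz)
  private
    μ = uniformOn-cK k k₀ enum₀ c
    _∈C? = _∈cK? k k₀ enum₀ c
    _∈C = _∈cK k k₀ enum₀ c
    to = Inverse.to enum
  open Distribution μ

  ∈C-shift : ∀ {x w} → w ∈C → x ∈C → (x + w) ∈C
  ∈C-shift (v , v∈ , w≈cv) (u , u∈ , x≈cu) = u + v , +-closed u∈ v∈ ,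
    ≈-trans (+-cong x≈cu w≈cv) (≈-sym (distribˡ c u v))

  ∈C-unshift : ∀ {x w} → w ∈C → (x + w) ∈C → x ∈C
  ∈C-unshift {x} {w} (v , v∈ , w≈cv) (u , u∈ , x+w≈cu) = u + - v , +-closed u∈ (-‿closed v∈) ,
    ≈-trans (≈-sym (+-invertible′ w x)) (≈-trans (+-cong x+w≈cu (-‿cong w≈cv))
      (≈-trans (+-congˡ (-‿distribʳ-* c v)) (≈-sym (distribˡ c u (- v)))))

  -- `c k₀` is an additive group, so translation by one of its elements preserves both membership
  -- and non-membership.
  prob-shift : ∀ {w} → w ∈C → ∀ x → prob (x + w) ≃ prob x
  prob-shift {w} w∈ x = go (x ∈C?)
    where
    go : Dec (x ∈C) → prob (x + w) ≃ prob x
    go (yes x∈) = ≗⇒≃ (λ M → trans (prob-∈ (x + w) M (∈C-shift w∈ x∈)) (sym (prob-∈ x M x∈)))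
    go (no x∉)  = ≗⇒≃ (λ M → trans (prob-∉ (x + w) M (x∉ ∘ ∈C-unshift w∈)) (sym (prob-∉ x M x∉)))

  F : Carrier → ℂ
  F = fourier k ψ₀ μ

  term : Carrier → Carrier → ℂ
  term y x = prob x • ψ (y * x)

  term-shift : ∀ y {w} → w ∈C → ∀ x → ψ (y * w) *ᶜ term y x ≃ᶜ term y (x + w)
  term-shift y {w} w∈ x = begin
    ψ (y * w) *ᶜ (prob x • ψ (y * x))          ≈⟨ C.*-congˡ {ψ (y * w)} (•-embed (prob x) (ψ (y * x))) ⟩
    ψ (y * w) *ᶜ (embed (prob x) *ᶜ ψ (y * x)) ≈⟨ x∙yz≈y∙xz (ψ (y * w)) (embed (prob x)) (ψ (y * x)) ⟩
    embed (prob x) *ᶜ (ψ (y * w) *ᶜ ψ (y * x)) ≈⟨ C.*-cong (embed-cong (≃-sym (prob-shift w∈ x)))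
                                                   (C.trans (C.sym (homo (y * w) (y * x))) (ψ-cong (≈-trans (+-comm (y * w) (y * x)) (≈-sym (distribˡ y x w))))) ⟩
    embed (prob (x + w)) *ᶜ ψ (y * (x + w))    ≈⟨ •-embed (prob (x + w)) (ψ (y * (x + w))) ⟨
    term y (x + w)                             ∎

  fourier-shift : ∀ y {w} → w ∈C → ψ (y * w) *ᶜ F y ≃ᶜ F y
  fourier-shift y {w} w∈ = begin
    ψ (y * w) *ᶜ F y                         ≈⟨ sum-*ˡ (ψ (y * w)) (term y ∘ to) ⟨
    ∑ᶜ enum (λ x → ψ (y * w) *ᶜ term y x)    ≈⟨ ΣC.sum-cong-≋ {order} (λ i → term-shift y w∈ (to i)) ⟩
    ∑ᶜ enum (λ x → term y (x + w))           ≈⟨ ∑ᶜ-reindex enum (term y) (λ x≈ → •-cong (prob-cong x≈) (ψ-cong (*-congˡ x≈)))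
                                                  (_+ w) (_+ - w) +-congʳ +-congʳ (+-invertible w) (+-invertible′ w) ⟨
    F y                                      ∎

  fourier-idempotent : ∀ y → F y *ᶜ F y ≃ᶜ F y
  fourier-idempotent y = begin
    F y *ᶜ F y                               ≈⟨ sum-*ʳ (term y ∘ to) (F y) ⟨
    ∑ᶜ enum (λ x → term y x *ᶜ F y)          ≈⟨ ΣC.sum-cong-≋ {order} (λ i → absorb (to i)) ⟩
    ∑ᶜ enum (λ x → embed (prob x) *ᶜ F y)    ≈⟨ sum-*ʳ (embed ∘ prob ∘ to) (F y) ⟩
    ∑ᶜ enum (embed ∘ prob) *ᶜ F y            ≈⟨ C.*-congʳ {F y} (C.trans (sum-embed (prob ∘ to)) (embed-cong total)) ⟩
    1ᶜ *ᶜ F y                                ≈⟨ C.*-identityˡ (F y) ⟩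
    F y                                      ∎
    where
    -- `fourier-shift` applies only to `x` in `c k₀`; for all other `x` the weight `prob x` makes
    -- both sides zero.
    absorb : ∀ x → term y x *ᶜ F y ≃ᶜ embed (prob x) *ᶜ F y
    absorb x = C.trans (C.*-congʳ {F y} (•-embed (prob x) (ψ (y * x))))
      (C.trans (C.*-assoc (embed (prob x)) (ψ (y * x)) (F y)) (go (x ∈C?)))
      where
      go : Dec (x ∈C) → embed (prob x) *ᶜ (ψ (y * x) *ᶜ F y) ≃ᶜ embed (prob x) *ᶜ F y
      go (yes x∈) = C.*-congˡ {embed (prob x)} (fourier-shift y x∈)
      go (no x∉)  = C.trans (annihilate (ψ (y * x) *ᶜ F y)) (C.sym (annihilate (F y)))
        where
        annihilate : ∀ z → embed (prob x) *ᶜ z ≃ᶜ 0ᶜ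
        annihilate z = C.trans (C.*-congʳ {z} (embed-cong (≗⇒≃ (λ M → prob-∉ x M x∉)))) (C.zeroˡ z)

  -- Fourier inversion at `0#`: after exchanging the sums, orthogonality leaves only the column
  -- `x ≈ 0#`.
  fourier-total : ∑ᶜ enum F ≃ᶜ embed (prob 0#) *ᶜ Q
  fourier-total = begin
    ∑ᶜ enum (λ y → ∑ᶜ enum (λ x → term y x))   ≈⟨ ΣC.∑-comm (λ i j → term (to i) (to j)) ⟩
    ∑ᶜ enum (λ x → ∑ᶜ enum (λ y → term y x))   ≈⟨ ΣC.sum-cong-≋ {order} (λ i → column (to i)) ⟩
    ∑ᶜ enum (λ x → embed (prob x) *ᶜ ∑ᶜ enum (λ y → ψ (y * x)))
      ≈⟨ sum-single (λ i → embed (prob (to i)) *ᶜ ∑ᶜ enum (λ y → ψ (y * to i))) i₀ vanish ⟩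
    embed (prob (to i₀)) *ᶜ ∑ᶜ enum (λ y → ψ (y * to i₀))
      ≈⟨ C.*-cong (embed-cong (prob-cong to-i₀)) (column-0 to-i₀) ⟩
    embed (prob 0#) *ᶜ Q ∎
    where
    i₀ : Fin order
    i₀ = Inverse.from enum 0#
    to-i₀ : to i₀ ≈ 0#
    to-i₀ = Inverse.inverseˡ enum refl
    column : ∀ x → ∑ᶜ enum (λ y → term y x) ≃ᶜ embed (prob x) *ᶜ ∑ᶜ enum (λ y → ψ (y * x))
    column x = C.trans (ΣC.sum-cong-≋ {order} (λ i → •-embed (prob x) (ψ (to i * x))))
      (sum-*ˡ (embed (prob x)) (λ i → ψ (to i * x)))
    vanish : ∀ j → ¬ (j ≡ i₀) → embed (prob (to j)) *ᶜ ∑ᶜ enum (λ y → ψ (y * to j)) ≃ᶜ 0ᶜ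
    vanish j j≢i₀ = C.trans (C.*-congˡ {embed (prob (to j))} (column-≉0 (λ toj≈0 → j≢i₀
      (trans (sym (Inverse.inverseʳ enum ≈-refl)) (Inverse.from-cong enum toj≈0)))))
      (C.zeroʳ (embed (prob (to j))))

  -- `0#` lies in `c k₀` and has weight `1 / s`, while `Q` is `s * s`.
  total-mass : re (embed (prob 0#) *ᶜ Q) ≃ fromℕ s
  total-mass = proj₁ (begin
    embed (prob 0#) *ᶜ Q                      ≈⟨ C.*-congˡ {embed (prob 0#)} (size-ℂ order) ⟩
    embed (prob 0#) *ᶜ embed (fromℕ order)    ≈⟨ •-embed (prob 0#) (embed (fromℕ order)) ⟨
    prob 0# • embed (fromℕ order)             ≈⟨ ≗⇒≃ evaluate , ≗⇒≃ (λ M → ℚ.*-zeroʳ (seq (prob 0#) M)) ⟩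
    embed (fromℕ s)                           ∎)
    where
    evaluate : ∀ M → seq (prob 0# *ℝ fromℕ order) M ≡ + s ℚ./ 1
    evaluate M =
      trans (cong₂ (λ a b → a ℚ.* (+ b ℚ./ 1)) (prob-∈ 0# M (0# , 0∈K , ≈-sym (zeroʳ c))) order≡)
      (trans (cong (1/ℕ s ℚ.*_) (*-/1 s s))
      (trans (sym (ℚ.*-assoc (1/ℕ s) S S))
      (trans (cong (ℚ._* S) (trans (ℚ.*-comm (1/ℕ s) S) (UniformTotal.n*1/n s s≥1)))
      (ℚ.*-identityˡ S))))
      where
      S = + s ℚ./ 1

  ‖fourier‖₁≃s : ‖fourier‖₁ k ψ₀ μ ≃ fromℕ s
  ‖fourier‖₁≃s = ≃-trans {‖fourier‖₁ k ψ₀ μ} {sumℝ (re ∘ F ∘ to)} {fromℕ s}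
    -- Idempotence turns each modulus into a real part. Real parts add up, so the norm is the real
    -- part of `fourier-total`.
    (ΣR.sum-cong-≋ {order} (λ i → idempotent-modulus (F (to i)) (fourier-idempotent (to i))))
    (≃-trans {sumℝ (re ∘ F ∘ to)} {re (embed (prob 0#) *ᶜ Q)} {fromℕ s}
      (subst (_≃ re (embed (prob 0#) *ᶜ Q)) (re-sum (F ∘ to)) (proj₁ fourier-total)) total-mass)

open import Data.Nat.Base using (ℕ; suc; _+_; _*_; _^_)
open FiniteField using (Carrier; _≈_; 0#; order; enum)
open Subfield using (subsetoid)

mainTheorem4 : ∀ {ℓ₁ ℓ₂ ℓ₃} (k : FiniteField ℓ₁ ℓ₂)
    (√q : ℕ) → order k ≡ √q * √q →
    (k₀ : Subfield k ℓ₃) (enum₀ : HasCardinality (subsetoid k₀) √q)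
    (c : Carrier k) → ¬ (_≈_ k c (0# k)) →
    let μ = uniformOn-cK k k₀ enum₀ c in
    (∀ (ψ₀ : NontrivialCharacter k) → ‖fourier‖₁ k ψ₀ μ ≃ fromℕ √q)
    × (∀ (m α : ℕ) →
    Pr (enum k) μ (H? k m (2 * m + α) (2m≤1+2m+α m α)) ≃ recip (√q ^ suc α))
    × (∀ (m : ℕ) →
    Pr (enum k) μ (λ x → Singular? k (hankel k m x)) ≃ recip √q)
mainTheorem4 k √q order≡ k₀ enum₀ c c≉0 =
  FourierNorm.‖fourier‖₁≃s k k₀ order≡ enum₀ c c≉0 ,
  Probability.Pr-H k k₀ order≡ enum₀ c c≉0 ,
  Probability.Pr-singular k k₀ order≡ enum₀ c c≉0
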